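{- For every $\delta>0$ there exists a constant $C$ such that the following holds: for every $\eta>0$ there is $n_0$ such that for all $n\ge n_0$ and all integers $m$ with $Cn^2\le m\le\binom n3$, the number of triangle-free $3$-uniform hypergraphs on vertex set $[n]$ with exactly $m$ edges that cannot be made tripartite by removing at most $\delta m$ edges is at most $\eta$ times the number of all triangle-free $3$-uniform hypergraphs on $[n]$ with exactly $m$ edges. (That is, almost every triangle-free $3$-uniform hypergraph with $n$ vertices and $m$ edges can be made tripartite by removing at most $\delta m$ edges.)
   Context: $F_5$ denotes the $3$-uniform hypergraph with edge set $\{123,124,345\}$; a $3$-uniform hypergraph is triangle-free if it contains no (not necessarily induced) copy of $F_5$. A $3$-uniform hypergraph is tripartite if its vertex set can be partitioned into three parts so that every edge has exactly one vertex in each part. -}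

module Defs where

open import Data.Nat using (ℕ; _∸_)
open import Data.Integer using (+_)
open import Data.Rational using (ℚ; _/_; _≤_; _*_)
open import Data.Fin using (Fin; zero; suc; _<?_)
open import Data.Fin.Subset using (Subset; _∈_; _⊆_; ∣_∣)
open import Data.List using (List; []; _∷_; concatMap; allFin; lookup; length)
open import Data.List.Membership.Propositional using () renaming (_∈_ to _∈ₗ_)
open import Data.List.Relation.Unary.Unique.Propositional using (Unique)
open import Data.List.Relation.Binary.Permutation.Propositional using (_↭_)
open import Data.Product using (Σ; ∃; _×_; _,_; proj₁; proj₂)
open import Data.Bool using (Bool; if_then_else_; _∧_)
open import Relation.Nullary using (¬_; does)
open import Relation.Binary.PropositionalEquality using (_≡_; _≢_)
open import Function.Bundles using (_⇔_)
open import Function.Definitions using (Injective)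

ℕ→ℚ : ℕ → ℚ
ℕ→ℚ k = (+ k) / 1

Triple : ℕ → Set
Triple n = Fin n × Fin n × Fin n

-- all 3-subsets {a,b,c} of [n], listed as strictly increasing triples a < b < c
triples : (n : ℕ) → List (Triple n)
triples n =
  concatMap (λ a → concatMap (λ b → concatMap (λ c →
    if does (a <? b) ∧ does (b <? c) then (a , b , c) ∷ [] else [])
    (allFin n)) (allFin n)) (allFin n)

record Hypergraph (n : ℕ) : Set where
  constructor hypergraph
  field edgeSet : Subset (length (triples n))
open Hypergraph public

edges : ∀ {n} → Hypergraph n → ℕ
edges H = ∣ edgeSet H ∣

Edge : ∀ {n} → Hypergraph n → Fin n → Fin n → Fin n → Set
Edge {n} H x y z = Σ (Fin (length (triples n))) λ i → i ∈ edgeSet H ×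
  (let t = lookup (triples n) i in
   (x ∷ y ∷ z ∷ []) ↭ (proj₁ t ∷ proj₁ (proj₂ t) ∷ proj₂ (proj₂ t) ∷ []))

ContainsF5 : ∀ {n} → Hypergraph n → Set
ContainsF5 {n} H = Σ (Fin 5 → Fin n) λ φ → Injective _≡_ _≡_ φ ×
  Edge H (φ v0) (φ v1) (φ v2) × Edge H (φ v0) (φ v1) (φ v3) × Edge H (φ v2) (φ v3) (φ v4)
  where
  v0 v1 v2 v3 v4 : Fin 5
  v0 = zero
  v1 = suc zero
  v2 = suc (suc zero)
  v3 = suc (suc (suc zero))
  v4 = suc (suc (suc (suc zero)))

TriangleFree : ∀ {n} → Hypergraph n → Set
TriangleFree H = ¬ ContainsF5 H

Tripartite : ∀ {n} → Hypergraph n → Set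
Tripartite {n} H = Σ (Fin n → Fin 3) λ part → ∀ i → i ∈ edgeSet H →
  (let t = lookup (triples n) i
       a = proj₁ t ; b = proj₁ (proj₂ t) ; c = proj₂ (proj₂ t) in
   part a ≢ part b × part b ≢ part c × part a ≢ part c)

TripartiteAfterRemoving : ∀ {n} → ℚ → ℕ → Hypergraph n → Set
TripartiteAfterRemoving {n} δ m H = Σ (Hypergraph n) λ H' → edgeSet H' ⊆ edgeSet H × Tripartite H' ×
  ℕ→ℚ (edges H ∸ edges H') ≤ δ * ℕ→ℚ m

HasCount : {A : Set} → (A → Set) → ℕ → Set
HasCount {A} P k = Σ (List A) λ L → Unique L × (∀ x → (x ∈ₗ L) ⇔ P x) × length L ≡ k

TFm : (n m : ℕ) → Hypergraph n → Set
TFm n m H = TriangleFree H × edges H ≡ m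

BadTFm : (n m : ℕ) → ℚ → Hypergraph n → Set
BadTFm n m δ H = TFm n m H × ¬ TripartiteAfterRemoving δ m H

{-# OPTIONS --safe #-}
module Submission where

-- For a triangle-free H let Γ be the graph of the pairs xy that do not lie together in any link
-- N(pq) = {x : pqx ∈ H}.  If xy ∉ Γ, as witnessed by pq, then every edge xyz has z ∈ {p, q}, so all but O(n²)
-- edges of H are triangles of Γ, and every link N(pq) is independent in Γ.  Choosing Γ costs only a factor
-- 2^(n²), which is negligible for m ≥ Cn².  A greedy choice of O(1) elements from each link gives a fingerprint
-- S ⊆ H of size s = O(n²) such that H ∖ S lies in a set T of triples, determined by Γ and S, in which every
-- vertex x of a link N_T(yz) has at most b = βn Γ-neighbours inside that link.
--
-- Hence g(x) + d(yz) ≤ n + b for xyz ∈ T, where g is the degree in Γ and d the codegree in T.  Summing this over T,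
-- using Cauchy–Schwarz at each vertex and convexity, either T has at most (1 - γ) n³/27 triples, or some xyz ∈ T has
-- d(xy) + d(xz) + d(yz) ≥ (1 - ε) n; then N(yz), N(xy), N(xz) are almost disjoint, almost cover the vertices and span few
-- edges of Γ, so almost all of T is tripartite for this partition.
--
-- The first kind of T contains few m-edge hypergraphs compared with the balanced complete tripartite hypergraph.
-- For the second kind, a hypergraph far from tripartite has at least j = Ω(m) edges among the other triples
-- of T, which are too few to allow this often.

open import Defs
open import Data.Bool as Bool using (Bool; true; false; _∧_; _∨_; not; if_then_else_)
open import Data.Bool.Properties using (∨-zeroʳ)
open import Data.Fin as Fin using (Fin; zero; suc; toℕ; combine; remQuot)
open import Data.Fin.Patterns using (0F; 1F; 2F; 3F; 4F)
import Data.Fin.Properties as Fin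
open import Data.Fin.Subset using (Subset; inside; outside; _∈_; _⊆_; ∣_∣; _∪_; _∩_; _─_; ⊤; ⊥)
open import Data.Fin.Subset.Properties
  using (drop-∷-⊆; in⊆in; out⊆; ⊆-refl; ⊆-antisym; ⊥⊆; ⊆⊤; ∣⊥∣≡0; ∣⊤∣≡n; x∈p∪q⁺; x∈p∪q⁻; x∈p∩q⁺; x∈p∩q⁻;
    p∩q⊆p; p∩q⊆q; x∈p∧x∉q⇒x∈p─q; p─q⊆p; p⊆q⇒∣p∣≤∣q∣; _∈?_)
import Data.Integer as ℤ
import Data.Integer.Properties as ℤ
open import Data.List using (List; []; _∷_; _++_; map; concatMap; length; lookup; allFin; tabulate)
open import Data.List.Membership.Propositional using (lose) renaming (_∈_ to _∈ₗ_)
open import Data.List.Membership.Propositional.Properties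
  using (∈-map⁺; ∈-map⁻; ∈-++⁺ˡ; ∈-++⁺ʳ; ∈-++⁻; ∈-∃++; ∈-concatMap⁺; ∈-lookup)
open import Data.List.Properties using (length-map; length-++; map-++)
open import Data.List.Relation.Binary.Permutation.Propositional
  using (_↭_; refl; prep; swap; ↭-sym; ↭-trans; ↭⇒↭ₛ)
open import Data.List.Relation.Binary.Permutation.Propositional.Properties using (∈-resp-↭; drop-∷; map⁺; ↭-singleton-inv)
import Data.List.Relation.Binary.Permutation.Setoid.Properties as ↭ₛ
open import Data.List.Relation.Unary.All as All using (All; []; _∷_)
import Data.List.Relation.Unary.All.Properties as All
open import Data.List.Relation.Unary.AllPairs using ([]; _∷_)
open import Data.List.Relation.Unary.Any as Any using (here; there)
open import Data.List.Relation.Unary.Unique.Propositional using (Unique)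
import Data.List.Relation.Unary.Unique.Propositional.Properties as Unique
open import Data.Nat
open import Data.Nat.Combinatorics using (_C_; nCk+nC[k+1]≡[n+1]C[k+1]; nC1≡n; nCn≡1; k>n⇒nCk≡0)
open import Data.Nat.DivMod using (m/n*n≤m; m≡m%n+[m/n]*n; m%n<n; /-monoˡ-≤; m*n/n≡m)
open import Data.Nat.ListAction using () renaming (sum to sumₗ)
open import Data.Nat.ListAction.Properties using (sum-++)
open import Data.Nat.Properties
open import Data.Nat.Tactic.RingSolver using (solve-∀)
open import Data.Product using (Σ; _×_; _,_; proj₁; proj₂)
open import Data.Product.Properties using (≡-dec)
open import Data.Rational as ℚ using (ℚ; mkℚ; Positive; toℚᵘ)
import Data.Rational.Properties as ℚ
open import Data.Rational.Unnormalised as ℚᵘ using (mkℚᵘ; *≤*)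
import Data.Rational.Unnormalised.Properties as ℚᵘ
open import Data.Sum using (_⊎_; inj₁; inj₂)
open import Data.Vec as Vec using ([]; _∷_; here)
open import Data.Vec.Properties using (∷-injectiveʳ; []=⇒lookup; lookup⇒[]=; lookup∘tabulate)
open import Function.Bundles using (Equivalence)
open import Relation.Binary.PropositionalEquality
open import Relation.Nullary using (¬_; Dec; yes; no; does; contradiction)
open import Relation.Nullary.Decidable using (map′; _×-dec_; _→-dec_; dec-true; dec-false)
open import Algebra.Properties.Semiring.Sum +-*-semiring
  using (sum; sum-syntax; sum-cong-≗; ∑-distrib-+; ∑-comm; *-distribˡ-sum; *-distribʳ-sum)

-- Finite sums

-- The count is compared with `N₀ C m`, where `N₀` is the number of triples of the balanced
-- tripartite hypergraph, all of whose `m`-subsets are triangle-free. A fingerprint is an arbitrary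
-- `s`-subset of all triples, so its choice must be paid for by the remaining `m - s` edges. Both
-- counts therefore carry a factor `2^s * 2^(n²)` and the number of choices of S: the latter and
-- `2^(n²)` cancel against the choices of S and Γ, and the surplus `2^s ≥ n` beats every η once n is
-- large. For sparse T the saving is `(u/(u+1))^(m-s)`, while a fingerprint costs a constant factor
-- per element; it wins once `s ≤ m/Q`, and as `s` is a multiple of `n²` this is the origin of C.
-- For dense T a factor Λ is saved for each of `j > m/(3q)` exceptional edges against a loss of at
-- most `4000^m`, hence `Λ = 4000^(3q)`. Every m must be covered, even when almost nothing of `N₀`
-- is left over. If more edges are wanted than T, or its exceptional part, can supply, the count is
-- zero; otherwise `N₀ - m` is a constant proportion of `N₀`, as the exchange of binomials requires.

ι : Bool → ℕ
ι true  = 1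
ι false = 0

ι≤1 : ∀ p → ι p ≤ 1
ι≤1 true  = ≤-refl
ι≤1 false = z≤n

# : ∀ {n} → (Fin n → Bool) → ℕ
# {n} p = ∑[ i < n ] ι (p i)

sum-mono-≤ : ∀ {n} {f g : Fin n → ℕ} → (∀ i → f i ≤ g i) → sum f ≤ sum g
sum-mono-≤ {zero}  f≤g = z≤n
sum-mono-≤ {suc n} f≤g = +-mono-≤ (f≤g zero) (sum-mono-≤ (λ i → f≤g (suc i)))

sum-const : ∀ n c → ∑[ i < n ] c ≡ n * c
sum-const zero    c = refl
sum-const (suc n) c = cong (c +_) (sum-const n c)

sum-bounded : ∀ {n} {f : Fin n → ℕ} c → (∀ i → f i ≤ c) → sum f ≤ n * c
sum-bounded {n} c f≤c = ≤-trans (sum-mono-≤ f≤c) (≤-reflexive (sum-const n c))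

#≤n : ∀ {n} (p : Fin n → Bool) → # p ≤ n
#≤n {n} p = ≤-trans (sum-bounded 1 (λ i → ι≤1 (p i))) (≤-reflexive (*-identityʳ n))

#-mono : ∀ {n} {p q : Fin n → Bool} → (∀ i → p i ≡ true → q i ≡ true) → # p ≤ # q
#-mono {p = p} {q} p⇒q = sum-mono-≤ (λ i → lemma (p i) (q i) (p⇒q i))
  where
  lemma : ∀ x y → (x ≡ true → y ≡ true) → ι x ≤ ι y
  lemma false y     _   = z≤n
  lemma true  true  _   = ≤-refl
  lemma true  false imp with () ← imp refl

∑³ : ∀ {n} → (Fin n → Fin n → Fin n → ℕ) → ℕ
∑³ {n} f = ∑[ a < n ] ∑[ b < n ] ∑[ c < n ] f a b c

module _ {n : ℕ} where

  ∑²-distrib-+ : (f g : Fin n → Fin n → ℕ) →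
    ∑[ a < n ] ∑[ b < n ] (f a b + g a b) ≡ ∑[ a < n ] ∑[ b < n ] f a b + ∑[ a < n ] ∑[ b < n ] g a b
  ∑²-distrib-+ f g = trans (sum-cong-≗ (λ a → ∑-distrib-+ (f a) (g a)))
                           (∑-distrib-+ (λ a → sum (f a)) (λ a → sum (g a)))

  ∑³-mono : {f g : Fin n → Fin n → Fin n → ℕ} → (∀ a b c → f a b c ≤ g a b c) → ∑³ f ≤ ∑³ g
  ∑³-mono f≤g = sum-mono-≤ (λ a → sum-mono-≤ (λ b → sum-mono-≤ (f≤g a b)))

  ∑³-cong : {f g : Fin n → Fin n → Fin n → ℕ} → (∀ a b c → f a b c ≡ g a b c) → ∑³ f ≡ ∑³ g
  ∑³-cong f≡g = sum-cong-≗ (λ a → sum-cong-≗ (λ b → sum-cong-≗ (f≡g a b)))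

  ∑³-distrib-+ : (f g : Fin n → Fin n → Fin n → ℕ) → ∑³ (λ a b c → f a b c + g a b c) ≡ ∑³ f + ∑³ g
  ∑³-distrib-+ f g = trans (sum-cong-≗ (λ a → ∑²-distrib-+ (f a) (g a)))
    (∑-distrib-+ (λ a → ∑[ b < n ] sum (f a b)) (λ a → ∑[ b < n ] sum (g a b)))

  ∑³-swap₂₃ : (f : Fin n → Fin n → Fin n → ℕ) → ∑³ f ≡ ∑³ (λ a b c → f a c b)
  ∑³-swap₂₃ f = sum-cong-≗ (λ a → ∑-comm (f a))

  ∑³-swap₁₂ : (f : Fin n → Fin n → Fin n → ℕ) → ∑³ f ≡ ∑³ (λ a b c → f b a c)
  ∑³-swap₁₂ f = ∑-comm (λ a b → sum (f a b))

  ∑³-rotate : (f : Fin n → Fin n → Fin n → ℕ) → ∑³ f ≡ ∑³ (λ a b c → f c a b)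
  ∑³-rotate f = trans (∑³-swap₁₂ f) (∑³-swap₂₃ (λ a b c → f b a c))

  ∑²-*ʳ : (f : Fin n → Fin n → ℕ) (k : ℕ) →
    (∑[ a < n ] ∑[ b < n ] f a b) * k ≡ ∑[ a < n ] ∑[ b < n ] (f a b * k)
  ∑²-*ʳ f k = trans (*-distribʳ-sum k (λ a → sum (f a))) (sum-cong-≗ λ a → *-distribʳ-sum k (f a))

  ∑³-*ʳ : (f : Fin n → Fin n → Fin n → ℕ) (k : ℕ) → ∑³ (λ a b c → f a b c * k) ≡ ∑³ f * k
  ∑³-*ʳ f k = sym (trans (*-distribʳ-sum k (λ a → ∑[ b < n ] sum (f a b)))
    (sum-cong-≗ λ a → ∑²-*ʳ (f a) k))

-- Elementary inequalities

2xy≤x²+y² : ∀ x y → 2 * (x * y) ≤ x * x + y * y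
2xy≤x²+y² x y with ≤-total x y
... | inj₁ x≤y with k , refl ← m≤n⇒∃[o]m+o≡n x≤y = m+n≤o⇒m≤o _ (≤-reflexive (eq x k))
  where
  eq : ∀ x k → 2 * (x * (x + k)) + k * k ≡ x * x + (x + k) * (x + k)
  eq = solve-∀
... | inj₂ y≤x with k , refl ← m≤n⇒∃[o]m+o≡n y≤x = m+n≤o⇒m≤o _ (≤-reflexive (eq y k))
  where
  eq : ∀ x k → 2 * ((x + k) * x) + k * k ≡ (x + k) * (x + k) + x * x
  eq = solve-∀

-- (3s - n)² (6s + n) ≥ 0
27s²n≤54s³+n³ : ∀ s n → 27 * (s * s * n) ≤ 54 * (s * s * s) + n * n * n
27s²n≤54s³+n³ s n with ≤-total (3 * s) n
... | inj₁ le with k , refl ← m≤n⇒∃[o]m+o≡n le = m+n≤o⇒m≤o _ (≤-reflexive (eq s k))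
  where
  eq : ∀ s k → 27 * (s * s * (3 * s + k)) + k * k * (9 * s + k) ≡ 54 * (s * s * s) + (3 * s + k) * (3 * s + k) * (3 * s + k)
  eq = solve-∀
... | inj₂ le with k , eq₁ ← m≤n⇒∃[o]m+o≡n le =
  *-cancelˡ-≤ 27 (m+n≤o⇒m≤o _ (≤-reflexive (trans (cong₂ (λ p q → p + q) (e₁ s n) refl)
    (trans (subst (λ t → 81 * (t * t * n) + 27 * (k * k * (2 * t + n)) ≡ 54 * (t * t * t) + 27 * (n * n * n)) eq₁ (e₂ n k)) (e₃ s n)))))
  where
  e₁ : ∀ s n → 27 * (27 * (s * s * n)) ≡ 81 * ((3 * s) * (3 * s) * n)
  e₁ = solve-∀
  e₂ : ∀ n k → 81 * ((n + k) * (n + k) * n) + 27 * (k * k * (2 * (n + k) + n)) ≡ 54 * ((n + k) * (n + k) * (n + k)) + 27 * (n * n * n)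
  e₂ = solve-∀
  e₃ : ∀ s n → 54 * ((3 * s) * (3 * s) * (3 * s)) + 27 * (n * n * n) ≡ 27 * (54 * (s * s * s) + n * n * n)
  e₃ = solve-∀

-- `s` is the integer part of `√(h/2)`: the upper bound is `h < 2 (s + 1)²`.
⌊√h/2⌋ : ∀ h → Σ ℕ λ s → 2 * (s * s) ≤ h × h ≤ 2 * (s * s) + (4 * s + 1)
⌊√h/2⌋ zero = 0 , z≤n , z≤n
⌊√h/2⌋ (suc h) with ⌊√h/2⌋ h
... | s , lo , hi with suc h ≤? 2 * (s * s) + (4 * s + 1)
...   | yes hi′ = s , m≤n⇒m≤1+n lo , hi′
...   | no ¬hi  = suc s , ≤-trans (≤-reflexive (eq s)) (≰⇒> ¬hi)
                , ≤-trans (s≤s hi) (≤-trans (≤-reflexive (sym (eq s))) (m≤m+n _ _))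
  where
  eq : ∀ s → 2 * (suc s * suc s) ≡ suc (2 * (s * s) + (4 * s + 1))
  eq = solve-∀

-- Twice the cubic inequality above is the case `h = 2 s²`. The rounding error `r ≤ 4 s + 1 ≤ 5 n`
-- adds `27 * 5 n²`, hence the 135.
27nh≤54sh+ : ∀ n h s → 1 ≤ n → s ≤ n → 2 * (s * s) ≤ h → h ≤ 2 * (s * s) + (4 * s + 1) →
  27 * (n * h) ≤ 54 * (s * h) + (2 * (n * n * n) + 135 * (n * n))
27nh≤54sh+ n h s 1≤n s≤n lo hi with r , refl ← m≤n⇒∃[o]m+o≡n lo = begin
  27 * (n * (2 * (s * s) + r))                              ≡⟨ e₁ n s r ⟩
  2 * (27 * (s * s * n)) + 27 * (r * n)                     ≤⟨ +-mono-≤ (*-monoʳ-≤ 2 (27s²n≤54s³+n³ s n)) (*-monoʳ-≤ 27 (*-monoˡ-≤ n r≤5n)) ⟩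
  2 * (54 * (s * s * s) + n * n * n) + 27 * ((5 * n) * n)   ≤⟨ m≤n+m _ (54 * (s * r)) ⟩
  54 * (s * r) + (2 * (54 * (s * s * s) + n * n * n) + 27 * ((5 * n) * n)) ≡⟨ e₂ n s r ⟩
  54 * (s * (2 * (s * s) + r)) + (2 * (n * n * n) + 135 * (n * n)) ∎
  where
  open ≤-Reasoning
  r≤5n : r ≤ 5 * n
  r≤5n = ≤-trans (+-cancelˡ-≤ (2 * (s * s)) r (4 * s + 1) hi)
    (≤-trans (+-mono-≤ (*-monoʳ-≤ 4 s≤n) 1≤n) (≤-reflexive (e n)))
    where
    e : ∀ n → 4 * n + n ≡ 5 * n
    e = solve-∀
  e₁ : ∀ n s r → 27 * (n * (2 * (s * s) + r)) ≡ 2 * (27 * (s * s * n)) + 27 * (r * n)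
  e₁ = solve-∀
  e₂ : ∀ n s r → 54 * (s * r) + (2 * (54 * (s * s * s) + n * n * n) + 27 * ((5 * n) * n))
     ≡ 54 * (s * (2 * (s * s) + r)) + (2 * (n * n * n) + 135 * (n * n))
  e₂ = solve-∀

-- Stability

∧-true : ∀ {p q} → p ∧ q ≡ true → p ≡ true × q ≡ true
∧-true {true} {true} refl = refl , refl

∧-intro : ∀ {p q} → p ≡ true → q ≡ true → p ∧ q ≡ true
∧-intro refl refl = refl

ι-weigh-mono : ∀ p {x y} → (p ≡ true → x ≤ y) → ι p * x ≤ ι p * y
ι-weigh-mono true  imp = *-monoʳ-≤ 1 (imp refl)
ι-weigh-mono false _   = z≤n

ι+ι≤1+∧ : ∀ p q → ι p + ι q ≤ 1 + ι (p ∧ q)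
ι+ι≤1+∧ true  q = ≤-refl
ι+ι≤1+∧ false q = ≤-trans (ι≤1 q) (m≤m+n 1 _)

rainbow : ∀ {n} → (Fin n → Fin 3) → Fin n → Fin n → Fin n → Bool
rainbow part u v w = not (does (part u Fin.≟ part v)) ∧ not (does (part v Fin.≟ part w)) ∧ not (does (part u Fin.≟ part w))

module Stability {n : ℕ} (Γ : Fin n → Fin n → Bool) (T : Fin n → Fin n → Fin n → Bool)
  (sym₁₂ : ∀ x y z → T x y z ≡ T y x z) (sym₂₃ : ∀ x y z → T x y z ≡ T x z y)
  (T⇒Γ : ∀ {x y z} → T x y z ≡ true → Γ x y ≡ true)
  (b : ℕ) (local : ∀ {x y z} → T x y z ≡ true → # (λ v → Γ x v ∧ T y z v) ≤ b) where

  T-rotate : ∀ x y z → T x y z ≡ T y z x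
  T-rotate x y z = trans (sym₁₂ x y z) (sym₂₃ y x z)

  d : Fin n → Fin n → ℕ
  d x y = # (T x y)

  g h : Fin n → ℕ
  g x = # (Γ x)
  h x = ∑[ y < n ] d x y

  τ G Q : ℕ
  τ = ∑³ (λ x y z → ι (T x y z))
  G = ∑[ x < n ] (h x * g x)
  Q = ∑[ x < n ] ∑[ y < n ] (d x y * d x y)

  weighted : (Fin n → Fin n → Fin n → ℕ) → ℕ
  weighted f = ∑³ (λ x y z → ι (T x y z) * f x y z)

  weighted-mono : {f f′ : Fin n → Fin n → Fin n → ℕ} →
    (∀ {x y z} → T x y z ≡ true → f x y z ≤ f′ x y z) → weighted f ≤ weighted f′
  weighted-mono le = ∑³-mono (λ x y z → ι-weigh-mono (T x y z) le)

  weighted-+ : (f f′ : Fin n → Fin n → Fin n → ℕ) →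
    weighted (λ x y z → f x y z + f′ x y z) ≡ weighted f + weighted f′
  weighted-+ f f′ = trans (∑³-cong (λ x y z → *-distribˡ-+ (ι (T x y z)) (f x y z) (f′ x y z)))
    (∑³-distrib-+ (λ x y z → ι (T x y z) * f x y z) (λ x y z → ι (T x y z) * f′ x y z))

  weighted-const : ∀ c → weighted (λ _ _ _ → c) ≡ τ * c
  weighted-const c = ∑³-*ʳ (λ x y z → ι (T x y z)) c

  weighted-g : weighted (λ x _ _ → g x) ≡ G
  weighted-g = sum-cong-≗ (λ x → sym (∑²-*ʳ (λ y z → ι (T x y z)) (g x)))

  weighted-d₁₂ : weighted (λ x y _ → d x y) ≡ Q
  weighted-d₁₂ = sum-cong-≗ (λ x → sum-cong-≗ (λ y → sym (*-distribʳ-sum (d x y) (λ z → ι (T x y z)))))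

  weighted-d₁₃ : weighted (λ x _ z → d x z) ≡ Q
  weighted-d₁₃ = trans (∑³-swap₂₃ (λ x y z → ι (T x y z) * d x z))
    (trans (∑³-cong (λ x y z → cong (λ t → ι t * d x y) (sym₂₃ x z y))) weighted-d₁₂)

  weighted-d₂₃ : weighted (λ _ y z → d y z) ≡ Q
  weighted-d₂₃ = trans (∑³-rotate (λ x y z → ι (T x y z) * d y z))
    (trans (∑³-cong (λ x y z → cong (λ t → ι t * d x y) (T-rotate z x y))) weighted-d₁₂)

  -- The Γ-neighbourhood of `x` and the link of `yz` are subsets of the `n` vertices which by
  -- `local` overlap in at most `b`.
  degree+codegree : ∀ {x y z} → T x y z ≡ true → g x + d y z ≤ n + b
  degree+codegree {x} {y} {z} t = begin
    g x + d y z                                    ≡⟨ ∑-distrib-+ (λ v → ι (Γ x v)) (λ v → ι (T y z v)) ⟨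
    ∑[ v < n ] (ι (Γ x v) + ι (T y z v))           ≤⟨ sum-mono-≤ (λ v → ι+ι≤1+∧ (Γ x v) (T y z v)) ⟩
    ∑[ v < n ] (1 + ι (Γ x v ∧ T y z v))           ≡⟨ ∑-distrib-+ (λ _ → 1) (λ v → ι (Γ x v ∧ T y z v)) ⟩
    ∑[ v < n ] 1 + # (λ v → Γ x v ∧ T y z v)       ≤⟨ +-mono-≤ (≤-reflexive (trans (sum-const n 1) (*-identityʳ n))) (local t) ⟩
    n + b ∎
    where open ≤-Reasoning

  degree-sum : G + Q ≤ τ * (n + b)
  degree-sum = begin
    G + Q                                                     ≡⟨ cong₂ _+_ weighted-g weighted-d₂₃ ⟨
    weighted (λ x _ _ → g x) + weighted (λ _ y z → d y z)     ≡⟨ weighted-+ (λ x _ _ → g x) (λ _ y z → d y z) ⟨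
    weighted (λ x y z → g x + d y z)                          ≤⟨ weighted-mono degree+codegree ⟩
    weighted (λ _ _ _ → n + b)                                ≡⟨ weighted-const (n + b) ⟩
    τ * (n + b) ∎
    where open ≤-Reasoning

  μ : Fin n → Fin n → Fin n → ℕ
  μ x y z = d x y + d x z + d y z

  codegree-sum : ∀ e → (∀ {x y z} → T x y z ≡ true → μ x y z + e ≤ n) → 3 * Q + τ * e ≤ τ * n
  codegree-sum e small = begin
    3 * Q + τ * e
      ≡⟨ cong₂ _+_ (trans (eq Q) (cong₂ _+_ (cong₂ _+_ (sym weighted-d₁₂) (sym weighted-d₁₃)) (sym weighted-d₂₃))) (sym (weighted-const e)) ⟩
    weighted (λ x y _ → d x y) + weighted (λ x _ z → d x z) + weighted (λ _ y z → d y z) + weighted (λ _ _ _ → e)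
      ≡⟨ cong (λ t → t + weighted (λ _ y z → d y z) + weighted (λ _ _ _ → e)) (weighted-+ (λ x y _ → d x y) (λ x _ z → d x z)) ⟨
    weighted (λ x y z → d x y + d x z) + weighted (λ _ y z → d y z) + weighted (λ _ _ _ → e)
      ≡⟨ cong (_+ weighted (λ _ _ _ → e)) (weighted-+ (λ x y z → d x y + d x z) (λ _ y z → d y z)) ⟨
    weighted μ + weighted (λ _ _ _ → e)
      ≡⟨ weighted-+ μ (λ _ _ _ → e) ⟨
    weighted (λ x y z → μ x y z + e)
      ≤⟨ weighted-mono small ⟩
    weighted (λ _ _ _ → n)
      ≡⟨ weighted-const n ⟩
    τ * n ∎
    where
    open ≤-Reasoning
    eq : ∀ q → 3 * q ≡ q + q + q
    eq = solve-∀

  ¬Γ⇒d≡0 : ∀ x y → Γ x y ≡ false → d x y ≡ 0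
  ¬Γ⇒d≡0 x y ¬Γ = trans (sum-cong-≗ (λ z → cong ι (¬T z))) (trans (sum-const n 0) (*-zeroʳ n))
    where
    ¬T : ∀ z → T x y z ≡ false
    ¬T z with T x y z in eq
    ... | false = refl
    ... | true with () ← trans (sym ¬Γ) (T⇒Γ eq)

  -- AM-GM for a pair in Γ; outside Γ the codegree vanishes. Hence `s²` is paid only `g x` times
  -- when summed over `y`, which is how the Γ-degree enters.
  tangent : ∀ s x y → 2 * s * d x y ≤ d x y * d x y + ι (Γ x y) * (s * s)
  tangent s x y with Γ x y in eq
  ... | true  = ≤-trans (≤-reflexive (e₁ s (d x y))) (≤-trans (2xy≤x²+y² (d x y) s) (≤-reflexive (e₂ s (d x y))))
    where
    e₁ : ∀ s k → 2 * s * k ≡ 2 * (k * s)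
    e₁ = solve-∀
    e₂ : ∀ s k → k * k + s * s ≡ k * k + 1 * (s * s)
    e₂ = solve-∀
  ... | false rewrite ¬Γ⇒d≡0 x y eq = ≤-reflexive (*-zeroʳ (2 * s))

  Qₓ : Fin n → ℕ
  Qₓ x = ∑[ y < n ] (d x y * d x y)

  tangent-sum : ∀ s x → 2 * s * h x ≤ Qₓ x + g x * (s * s)
  tangent-sum s x = begin
    2 * s * h x                                                ≡⟨ *-distribˡ-sum (2 * s) (d x) ⟩
    ∑[ y < n ] (2 * s * d x y)                                 ≤⟨ sum-mono-≤ (tangent s x) ⟩
    ∑[ y < n ] (d x y * d x y + ι (Γ x y) * (s * s))           ≡⟨ ∑-distrib-+ (λ y → d x y * d x y) (λ y → ι (Γ x y) * (s * s)) ⟩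
    Qₓ x + ∑[ y < n ] (ι (Γ x y) * (s * s))                    ≡⟨ cong (Qₓ x +_) (*-distribʳ-sum (s * s) (λ y → ι (Γ x y))) ⟨
    Qₓ x + g x * (s * s) ∎
    where open ≤-Reasoning

  h≤n² : ∀ x → h x ≤ n * n
  h≤n² x = sum-bounded n (λ y → #≤n (T x y))

  1≤n : Fin n → 1 ≤ n
  1≤n zero    = s≤s z≤n
  1≤n (suc _) = s≤s z≤n

  -- With s = √(h/2), AM-GM in the form g h + 2Q ≥ 4 s h reduces the claim to the tangent line of
  -- h ↦ h^{3/2} at the extremal value h = 2(n/3)².
  vertex-bound : ∀ x → 54 * (n * h x) ≤ 54 * Qₓ x + 27 * (h x * g x) + (4 * (n * n * n) + 270 * (n * n))
  vertex-bound x with s , lo , hi ← ⌊√h/2⌋ (h x) = begin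
    54 * (n * h x)                                                     ≡⟨ e₁ (n * h x) ⟩
    2 * (27 * (n * h x))                                               ≤⟨ *-monoʳ-≤ 2 (27nh≤54sh+ n (h x) s (1≤n x) s≤n lo hi) ⟩
    2 * (54 * (s * h x) + (2 * (n * n * n) + 135 * (n * n)))           ≡⟨ e₂ n s (h x) ⟩
    54 * (2 * s * h x) + r                                             ≤⟨ +-monoˡ-≤ r (*-monoʳ-≤ 54 (tangent-sum s x)) ⟩
    54 * (Qₓ x + g x * (s * s)) + r                                    ≡⟨ e₃ (Qₓ x) (g x) (s * s) r ⟩
    54 * Qₓ x + 27 * (2 * (s * s) * g x) + r                           ≤⟨ +-monoˡ-≤ r (+-monoʳ-≤ (54 * Qₓ x) (*-monoʳ-≤ 27 (*-monoˡ-≤ (g x) lo))) ⟩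
    54 * Qₓ x + 27 * (h x * g x) + r ∎
    where
    open ≤-Reasoning
    r : ℕ
    r = 4 * (n * n * n) + 270 * (n * n)
    s≤n : s ≤ n
    s≤n with s ≤? n
    ... | yes le = le
    ... | no ¬le = contradiction (≤-trans (m≤n*m (s * s) 2) (≤-trans lo (h≤n² x)))
                     (<⇒≱ (*-mono-< (≰⇒> ¬le) (≰⇒> ¬le)))
    e₁ : ∀ k → 54 * k ≡ 2 * (27 * k)
    e₁ = solve-∀
    e₂ : ∀ n s k → 2 * (54 * (s * k) + (2 * (n * n * n) + 135 * (n * n))) ≡ 54 * (2 * s * k) + (4 * (n * n * n) + 270 * (n * n))
    e₂ = solve-∀
    e₃ : ∀ q g s r → 54 * (q + g * s) + r ≡ 54 * q + 27 * (2 * s * g) + r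
    e₃ = solve-∀

  vertex-sum : 54 * (n * τ) ≤ 54 * Q + 27 * G + n * (4 * (n * n * n) + 270 * (n * n))
  vertex-sum = begin
    54 * (n * τ)                                            ≡⟨ *-assoc 54 n τ ⟨
    54 * n * τ                                              ≡⟨ *-distribˡ-sum (54 * n) h ⟩
    ∑[ x < n ] (54 * n * h x)                               ≤⟨ sum-mono-≤ (λ x → ≤-trans (≤-reflexive (*-assoc 54 n (h x))) (vertex-bound x)) ⟩
    ∑[ x < n ] (54 * Qₓ x + 27 * (h x * g x) + r)           ≡⟨ ∑-distrib-+ (λ x → 54 * Qₓ x + 27 * (h x * g x)) (λ _ → r) ⟩
    ∑[ x < n ] (54 * Qₓ x + 27 * (h x * g x)) + ∑[ x < n ] r
      ≡⟨ cong₂ _+_ (∑-distrib-+ (λ x → 54 * Qₓ x) (λ x → 27 * (h x * g x))) (sum-const n r) ⟩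
    ∑[ x < n ] (54 * Qₓ x) + ∑[ x < n ] (27 * (h x * g x)) + n * r
      ≡⟨ cong (_+ n * r) (cong₂ _+_ (*-distribˡ-sum 54 Qₓ) (*-distribˡ-sum 27 (λ x → h x * g x))) ⟨
    54 * Q + 27 * G + n * r ∎
    where
    open ≤-Reasoning
    r : ℕ
    r = 4 * (n * n * n) + 270 * (n * n)

  -- Writing `54 Q + 27 G` as `27 (G + Q) + 9 (3 Q)` uses the two sums in the proportion in which
  -- they are both tight for the balanced tripartite hypergraph. For `b = e = 0` the bound is
  -- `6 n³/27` ordered triples, up to lower order.
  density : ∀ e → (∀ {x y z} → T x y z ≡ true → μ x y z + e ≤ n) →
    (18 * n + 9 * e) * τ ≤ 27 * b * τ + n * (4 * (n * n * n) + 270 * (n * n))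
  density e small = +-cancelˡ-≤ (36 * (n * τ)) _ _ (begin
    36 * (n * τ) + (18 * n + 9 * e) * τ                   ≡⟨ e₁ n τ e ⟩
    54 * (n * τ) + 9 * (τ * e)                            ≤⟨ +-monoˡ-≤ _ vertex-sum ⟩
    54 * Q + 27 * G + r + 9 * (τ * e)                     ≡⟨ e₂ Q G r τ e ⟩
    27 * (G + Q) + 9 * (3 * Q + τ * e) + r                ≤⟨ +-monoˡ-≤ r (+-mono-≤ (*-monoʳ-≤ 27 degree-sum) (*-monoʳ-≤ 9 (codegree-sum e small))) ⟩
    27 * (τ * (n + b)) + 9 * (τ * n) + r                  ≡⟨ e₃ τ n b r ⟩
    36 * (n * τ) + (27 * b * τ + r) ∎)
    where
    open ≤-Reasoning
    r : ℕ
    r = n * (4 * (n * n * n) + 270 * (n * n))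
    e₁ : ∀ n τ e → 36 * (n * τ) + (18 * n + 9 * e) * τ ≡ 54 * (n * τ) + 9 * (τ * e)
    e₁ = solve-∀
    e₂ : ∀ Q G r τ e → 54 * Q + 27 * G + r + 9 * (τ * e) ≡ 27 * (G + Q) + 9 * (3 * Q + τ * e) + r
    e₂ = solve-∀
    e₃ : ∀ τ n b r → 27 * (τ * (n + b)) + 9 * (τ * n) + r ≡ 36 * (n * τ) + (27 * b * τ + r)
    e₃ = solve-∀

  module Partition {x y z : Fin n} (t : T x y z ≡ true) where

    -- Overlaps of links are resolved by priority. Vertices in no link get part 0 by default and are
    -- charged to `uncovered` in `same-color`.
    color : Bool → Bool → Bool → Fin 3
    color true  _     _     = 0F
    color false true  _     = 1F
    color false false true  = 2F
    color false false false = 0F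

    part : Fin n → Fin 3
    part v = color (T y z v) (T x y v) (T x z v)

    uncovered : Fin n → Bool
    uncovered v = not (T y z v ∨ T x y v ∨ T x z v)

    monochromatic : Fin n → Fin n → Bool
    monochromatic u v = Γ u v ∧ does (part u Fin.≟ part v)

    -- Bonferroni's inequality at a single vertex.
    ι-cover : ∀ p q r → ι (not (p ∨ q ∨ r)) + (ι p + ι q + ι r) ≤ 1 + (ι (p ∧ q) + ι (p ∧ r) + ι (q ∧ r))
    ι-cover true  true  true  = s≤s (s≤s (s≤s z≤n))
    ι-cover true  true  false = ≤-refl
    ι-cover true  false true  = ≤-refl
    ι-cover true  false false = ≤-refl
    ι-cover false true  true  = ≤-refl
    ι-cover false true  false = ≤-refl
    ι-cover false false true  = ≤-refl
    ι-cover false false false = ≤-refl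

    -- Two of the three links meet only in Γ-neighbours of a base vertex: if `xyv` and `yzv` are in
    -- T, then `v` lies in the link of `yz` and is Γ-adjacent to `x`. So `local` bounds each
    -- overlap.
    #overlap : {p q : Fin n → Bool} {u v w : Fin n} → T u v w ≡ true →
      (∀ k → p k ≡ true → q k ≡ true → Γ u k ≡ true × T v w k ≡ true) → # (λ k → p k ∧ q k) ≤ b
    #overlap {p} {q} {u} {v} {w} t′ imp = ≤-trans
      (#-mono {q = λ k → Γ u k ∧ T v w k} λ k pq → let pk , qk = ∧-true {p k} pq ; γ , t″ = imp k pk qk in ∧-intro γ t″)
      (local t′)

    3-sum : ∀ {k} (f₁ f₂ f₃ : Fin k → ℕ) → ∑[ i < k ] (f₁ i + f₂ i + f₃ i) ≡ sum f₁ + sum f₂ + sum f₃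
    3-sum f₁ f₂ f₃ = trans (∑-distrib-+ (λ i → f₁ i + f₂ i) f₃) (cong (_+ sum f₃) (∑-distrib-+ f₁ f₂))

    #uncovered : # uncovered + μ x y z ≤ n + 3 * b
    #uncovered = begin
      # uncovered + (d x y + d x z + d y z)
        ≡⟨ cong (# uncovered +_) (trans (eq (d x y) (d x z) (d y z)) (sym (3-sum (λ v → ι (T y z v)) (λ v → ι (T x y v)) (λ v → ι (T x z v))))) ⟩
      # uncovered + ∑[ v < n ] (ι (T y z v) + ι (T x y v) + ι (T x z v))
        ≡⟨ ∑-distrib-+ (λ v → ι (uncovered v)) (λ v → ι (T y z v) + ι (T x y v) + ι (T x z v)) ⟨
      ∑[ v < n ] (ι (uncovered v) + (ι (T y z v) + ι (T x y v) + ι (T x z v)))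
        ≤⟨ sum-mono-≤ (λ v → ι-cover (T y z v) (T x y v) (T x z v)) ⟩
      ∑[ v < n ] (1 + (ι (T y z v ∧ T x y v) + ι (T y z v ∧ T x z v) + ι (T x y v ∧ T x z v)))
        ≡⟨ ∑-distrib-+ (λ _ → 1) (λ v → ι (T y z v ∧ T x y v) + ι (T y z v ∧ T x z v) + ι (T x y v ∧ T x z v)) ⟩
      ∑[ v < n ] 1 + ∑[ v < n ] (ι (T y z v ∧ T x y v) + ι (T y z v ∧ T x z v) + ι (T x y v ∧ T x z v))
        ≡⟨ cong₂ _+_ (trans (sum-const n 1) (*-identityʳ n)) (3-sum (λ v → ι (T y z v ∧ T x y v)) (λ v → ι (T y z v ∧ T x z v)) (λ v → ι (T x y v ∧ T x z v))) ⟩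
      n + (# (λ v → T y z v ∧ T x y v) + # (λ v → T y z v ∧ T x z v) + # (λ v → T x y v ∧ T x z v))
        ≤⟨ +-monoʳ-≤ n (+-mono-≤ (+-mono-≤
             (#overlap {T y z} {T x y} t λ k p q → T⇒Γ (trans (sym₂₃ x k y) q) , p)
             (#overlap {T y z} {T x z} t λ k p q → T⇒Γ (trans (sym₂₃ x k z) q) , p))
             (#overlap {T x y} {T x z} {y} {x} {z} (trans (sym₁₂ y x z) t) λ k p q → T⇒Γ {z = x} (trans (sym (T-rotate x y k)) p) , q)) ⟩
      n + (b + b + b)
        ≡⟨ cong (n +_) (eq₃ b) ⟩
      n + 3 * b ∎
      where
      open ≤-Reasoning
      eq : ∀ p q r → p + q + r ≡ r + p + q
      eq = solve-∀
      eq₃ : ∀ k → k + k + k ≡ 3 * k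
      eq₃ = solve-∀

    -- Equal colours come from a common link, or else from a default value, and then one of the two
    -- vertices is uncovered.
    same-color : ∀ p q r p′ q′ r′ γ →
      ι (γ ∧ does (color p q r Fin.≟ color p′ q′ r′)) ≤
      ι (p ∧ (γ ∧ p′)) + ι (q ∧ (γ ∧ q′)) + ι (r ∧ (γ ∧ r′)) + (ι (not (p ∨ q ∨ r)) + ι (not (p′ ∨ q′ ∨ r′)))
    same-color p q r p′ q′ r′ false = z≤n
    same-color false false false p′ q′ r′ true = ≤-trans (ι≤1 _) (m≤m+n 1 _)
    same-color true _ _ true _ _ true = s≤s z≤n
    same-color true  q r false true  r′ true = z≤n
    same-color true  q r false false true true = z≤n
    same-color true  q r false false false true = m≤n+m 1 _
    same-color false true r true q′ r′ true = z≤n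
    same-color false true r false true r′ true = s≤s z≤n
    same-color false true r false false true true = z≤n
    same-color false true r false false false true = z≤n
    same-color false false true true q′ r′ true = z≤n
    same-color false false true false true r′ true = z≤n
    same-color false false true false false true true = s≤s z≤n
    same-color false false true false false false true = z≤n

    -- A vertex `w` of the link of `uv` forms the triple `wuv` of T, and `local` for this triple
    -- bounds the Γ-degree of `w` inside the link.
    #inside : {u v : Fin n} → (∀ w → T u v w ≡ true → T w u v ≡ true) →
      ∑[ w < n ] ∑[ w′ < n ] ι (T u v w ∧ (Γ w w′ ∧ T u v w′)) ≤ n * b
    #inside {u} {v} rot = sum-bounded b λ w → row w
      where
      row : ∀ w → ∑[ w′ < n ] ι (T u v w ∧ (Γ w w′ ∧ T u v w′)) ≤ b
      row w with T u v w in eq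
      ... | true  = local (rot w eq)
      ... | false = ≤-trans (≤-reflexive (trans (sum-const n 0) (*-zeroʳ n))) z≤n

    #monochromatic : ∑[ u < n ] ∑[ v < n ] ι (monochromatic u v) ≤ 3 * (n * b) + 2 * (n * # uncovered)
    #monochromatic = begin
      ∑[ u < n ] ∑[ v < n ] ι (monochromatic u v)
        ≤⟨ sum-mono-≤ (λ u → sum-mono-≤ (λ v → same-color (T y z u) (T x y u) (T x z u) (T y z v) (T x y v) (T x z v) (Γ u v))) ⟩
      ∑[ u < n ] ∑[ v < n ] (A u v + B u v + C u v + (ι (uncovered u) + ι (uncovered v)))
        ≡⟨ ∑²-distrib-+ (λ u v → A u v + B u v + C u v) (λ u v → ι (uncovered u) + ι (uncovered v)) ⟩
      ∑[ u < n ] ∑[ v < n ] (A u v + B u v + C u v) + ∑[ u < n ] ∑[ v < n ] (ι (uncovered u) + ι (uncovered v))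
        ≡⟨ cong₂ _+_ (trans (∑²-distrib-+ (λ u v → A u v + B u v) C) (cong (_+ ∑[ u < n ] sum (C u)) (∑²-distrib-+ A B)))
                     (∑²-distrib-+ (λ u _ → ι (uncovered u)) (λ _ v → ι (uncovered v))) ⟩
      ∑[ u < n ] sum (A u) + ∑[ u < n ] sum (B u) + ∑[ u < n ] sum (C u)
        + (∑[ u < n ] ∑[ v < n ] ι (uncovered u) + ∑[ u < n ] # uncovered)
        ≤⟨ +-mono-≤ (+-mono-≤ (+-mono-≤ (#inside (λ w → trans (T-rotate w y z))) (#inside (λ w → trans (T-rotate w x y)))) (#inside (λ w → trans (T-rotate w x z))))
             (≤-reflexive (cong₂ _+_ (trans (∑-comm (λ u (v : Fin n) → ι (uncovered u))) (sum-const n (# uncovered))) (sum-const n (# uncovered)))) ⟩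
      n * b + n * b + n * b + (n * # uncovered + n * # uncovered)
        ≡⟨ eq (n * b) (n * # uncovered) ⟩
      3 * (n * b) + 2 * (n * # uncovered) ∎
      where
      open ≤-Reasoning
      A B C : Fin n → Fin n → ℕ
      A u v = ι (T y z u ∧ (Γ u v ∧ T y z v))
      B u v = ι (T x y u ∧ (Γ u v ∧ T x y v))
      C u v = ι (T x z u ∧ (Γ u v ∧ T x z v))
      eq : ∀ p q → p + p + p + (q + q) ≡ 3 * p + 2 * q
      eq = solve-∀

    nonrainbow-cases : ∀ t p q r γ₁ γ₂ γ₃ → (t ≡ true → γ₁ ≡ true) → (t ≡ true → γ₂ ≡ true) → (t ≡ true → γ₃ ≡ true) →
      ι (t ∧ not (not p ∧ not q ∧ not r)) ≤ ι (γ₁ ∧ p) + ι (γ₂ ∧ q) + ι (γ₃ ∧ r)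
    nonrainbow-cases false p q r γ₁ γ₂ γ₃ i₁ i₂ i₃ = z≤n
    nonrainbow-cases true p q r γ₁ γ₂ γ₃ i₁ i₂ i₃ rewrite i₁ refl | i₂ refl | i₃ refl = go p q r
      where
      go : ∀ p q r → ι (not (not p ∧ not q ∧ not r)) ≤ ι p + ι q + ι r
      go true  q     r     = s≤s z≤n
      go false true  r     = s≤s z≤n
      go false false true  = ≤-refl
      go false false false = z≤n

    -- All pairs of a triple of T lie in Γ, so a triple that is not rainbow contains a monochromatic
    -- Γ-pair. There are three positions for the pair and `n` choices for the third vertex.
    #nonrainbow : ∀ e → n ≤ μ x y z + e → ∑³ (λ u v w → ι (T u v w ∧ not (rainbow part u v w))) ≤ 3 * (n * (n * (9 * b + 2 * e)))
    #nonrainbow e big = begin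
      ∑³ (λ u v w → ι (T u v w ∧ not (rainbow part u v w)))
        ≤⟨ ∑³-mono (λ u v w → nonrainbow-cases (T u v w) _ _ _ (Γ u v) (Γ v w) (Γ u w)
             T⇒Γ (λ t′ → T⇒Γ {z = u} (trans (sym (T-rotate u v w)) t′)) (λ t′ → T⇒Γ (trans (sym₂₃ u w v) t′))) ⟩
      ∑³ (λ u v w → m u v + m v w + m u w)
        ≡⟨ ∑³-distrib-+ (λ u v w → m u v + m v w) (λ u v w → m u w) ⟩
      ∑³ (λ u v w → m u v + m v w) + ∑³ (λ u v w → m u w)
        ≡⟨ cong (_+ ∑³ (λ u v w → m u w)) (∑³-distrib-+ (λ u v w → m u v) (λ u v w → m v w)) ⟩
      ∑³ (λ u v w → m u v) + ∑³ (λ u v w → m v w) + ∑³ (λ u v w → m u w)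
        ≡⟨ cong₂ _+_ (cong₂ _+_ (trans (sym (∑³-rotate (λ u v w → m v w))) ∑³-const) ∑³-const) (trans (∑³-swap₁₂ (λ u v w → m u w)) ∑³-const) ⟩
      n * M + n * M + n * M
        ≡⟨ e₁ n M ⟩
      3 * (n * M)
        ≤⟨ *-monoʳ-≤ 3 (*-monoʳ-≤ n (≤-trans #monochromatic (+-monoʳ-≤ (3 * (n * b)) (*-monoʳ-≤ 2 (*-monoʳ-≤ n U≤))))) ⟩
      3 * (n * (3 * (n * b) + 2 * (n * (e + 3 * b))))
        ≡⟨ e₂ n b e ⟩
      3 * (n * (n * (9 * b + 2 * e))) ∎
      where
      open ≤-Reasoning
      m : Fin n → Fin n → ℕ
      m u v = ι (monochromatic u v)
      M : ℕ
      M = ∑[ u < n ] sum (m u)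
      ∑³-const : ∑³ {n} (λ u v w → m v w) ≡ n * M
      ∑³-const = sum-const n M
      U≤ : # uncovered ≤ e + 3 * b
      U≤ = +-cancelˡ-≤ (μ x y z) _ _ (begin
        μ x y z + # uncovered     ≡⟨ +-comm (μ x y z) _ ⟩
        # uncovered + μ x y z     ≤⟨ #uncovered ⟩
        n + 3 * b                 ≤⟨ +-monoˡ-≤ (3 * b) big ⟩
        μ x y z + e + 3 * b       ≡⟨ +-assoc (μ x y z) e (3 * b) ⟩
        μ x y z + (e + 3 * b) ∎)
      e₁ : ∀ n m → n * m + n * m + n * m ≡ 3 * (n * m)
      e₁ = solve-∀
      e₂ : ∀ n b e → 3 * (n * (3 * (n * b) + 2 * (n * (e + 3 * b)))) ≡ 3 * (n * (n * (9 * b + 2 * e)))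
      e₂ = solve-∀

-- Binomial coefficients

-- The recurrence `(k+1) C(n,k+1) = (n-k) C(n,k)` without subtraction, so that Pascal's rule proves
-- it by induction for all `k`.
absorption : ∀ n k → suc k * (n C suc k) + k * (n C k) ≡ n * (n C k)
absorption zero    zero    = refl
absorption zero    (suc k) = trans (cong₂ _+_ (*-zeroʳ (2 + k)) (*-zeroʳ (suc k))) refl
absorption (suc n) zero    = trans (+-identityʳ _) (trans (*-identityˡ _) (trans (nC1≡n (suc n)) (sym (*-identityʳ (suc n)))))
absorption (suc n) (suc k) = begin
  suc (suc k) * (suc n C suc (suc k)) + suc k * (suc n C suc k)
    ≡⟨ cong₂ (λ x y → suc (suc k) * x + suc k * y) (nCk+nC[k+1]≡[n+1]C[k+1] n (suc k)) (nCk+nC[k+1]≡[n+1]C[k+1] n k) ⟨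
  suc (suc k) * (n C suc k + n C suc (suc k)) + suc k * (n C k + n C suc k)
    ≡⟨ e₁ k (n C k) (n C suc k) (n C suc (suc k)) ⟩
  (suc (suc k) * (n C suc (suc k)) + suc k * (n C suc k)) + (suc k * (n C suc k) + k * (n C k)) + (n C k + n C suc k)
    ≡⟨ cong₂ (λ x y → x + y + (n C k + n C suc k)) (absorption n (suc k)) (absorption n k) ⟩
  n * (n C suc k) + n * (n C k) + (n C k + n C suc k)
    ≡⟨ e₂ n (n C k) (n C suc k) ⟩
  suc n * (n C k + n C suc k)
    ≡⟨ cong (suc n *_) (nCk+nC[k+1]≡[n+1]C[k+1] n k) ⟩
  suc n * (suc n C suc k) ∎
  where
  open ≡-Reasoning
  e₁ : ∀ k w x y → suc (suc k) * (x + y) + suc k * (w + x) ≡ (suc (suc k) * y + suc k * x) + (suc k * x + k * w) + (w + x)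
  e₁ = solve-∀
  e₂ : ∀ n w x → n * x + n * w + (w + x) ≡ suc n * (w + x)
  e₂ = solve-∀

[k+1]nC[k+1] : ∀ n k → suc k * (n C suc k) ≡ (n ∸ k) * (n C k)
[k+1]nC[k+1] n k = +-cancelʳ-≡ (k * (n C k)) _ _ (trans (absorption n k) lemma)
  where
  lemma : n * (n C k) ≡ (n ∸ k) * (n C k) + k * (n C k)
  lemma with k ≤? n
  ... | yes k≤n = trans (cong (_* (n C k)) (sym (m∸n+n≡m k≤n))) (*-distribʳ-+ (n C k) (n ∸ k) k)
  ... | no  k≰n rewrite k>n⇒nCk≡0 (≰⇒> k≰n) | *-zeroʳ n | *-zeroʳ (n ∸ k) | *-zeroʳ k = refl

[k+1][n+1]C[k+1] : ∀ n k → suc k * (suc n C suc k) ≡ suc n * (n C k)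
[k+1][n+1]C[k+1] n k = begin
  suc k * (suc n C suc k)                        ≡⟨ cong (suc k *_) (nCk+nC[k+1]≡[n+1]C[k+1] n k) ⟨
  suc k * (n C k + n C suc k)                    ≡⟨ e k (n C k) (n C suc k) ⟩
  n C k + (suc k * (n C suc k) + k * (n C k))    ≡⟨ cong (n C k +_) (absorption n k) ⟩
  suc n * (n C k) ∎
  where
  open ≡-Reasoning
  e : ∀ k w x → suc k * (w + x) ≡ w + (suc k * x + k * w)
  e = solve-∀

-- An `s`-subset of A and a `k`-subset of N are traded for a `(k+s)`-subset of N with `s` marked
-- elements. Raising `s` by one multiplies the left side by at most `κ A / (s+1)` and the right side
-- by `λ′ (N - (k+s)) / (s+1)`; the hypothesis for the final `s` implies that for all smaller ones.
exchange : ∀ {κ λ′ A N} k s → κ * A ≤ λ′ * (N ∸ (k + s)) →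
  κ ^ s * ((A C s) * (N C k)) ≤ λ′ ^ s * (((k + s) C s) * (N C (k + s)))
exchange {κ} {λ′} {A} {N} k zero    hyp rewrite +-identityʳ k = ≤-refl
exchange {κ} {λ′} {A} {N} k (suc s) hyp = *-cancelˡ-≤ (suc s) (begin
  suc s * (κ ^ suc s * ((A C suc s) * (N C k)))
    ≡⟨ e₁ (suc s) κ (κ ^ s) (A C suc s) (N C k) ⟩
  κ * κ ^ s * (suc s * (A C suc s)) * (N C k)
    ≡⟨ cong (λ t → κ * κ ^ s * t * (N C k)) ([k+1]nC[k+1] A s) ⟩
  κ * κ ^ s * ((A ∸ s) * (A C s)) * (N C k)
    ≤⟨ *-monoˡ-≤ (N C k) (*-monoʳ-≤ (κ * κ ^ s) (*-monoˡ-≤ (A C s) (m∸n≤m A s))) ⟩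
  κ * κ ^ s * (A * (A C s)) * (N C k)
    ≡⟨ e₂ κ (κ ^ s) A (A C s) (N C k) ⟩
  κ * A * (κ ^ s * ((A C s) * (N C k)))
    ≤⟨ *-mono-≤ hyp′ (exchange k s hyp′) ⟩
  λ′ * (N ∸ (k + s)) * (λ′ ^ s * (((k + s) C s) * (N C (k + s))))
    ≡⟨ e₃ λ′ (N ∸ (k + s)) (λ′ ^ s) ((k + s) C s) (N C (k + s)) ⟩
  λ′ * λ′ ^ s * ((k + s) C s) * ((N ∸ (k + s)) * (N C (k + s)))
    ≡⟨ cong (λ′ * λ′ ^ s * ((k + s) C s) *_) ([k+1]nC[k+1] N (k + s)) ⟨
  λ′ * λ′ ^ s * ((k + s) C s) * (suc (k + s) * (N C suc (k + s)))
    ≡⟨ e₄ (λ′ * λ′ ^ s) ((k + s) C s) (suc (k + s)) (N C suc (k + s)) ⟩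
  λ′ * λ′ ^ s * ((suc (k + s) * ((k + s) C s)) * (N C suc (k + s)))
    ≡⟨ cong (λ t → λ′ * λ′ ^ s * (t * (N C suc (k + s)))) ([k+1][n+1]C[k+1] (k + s) s) ⟨
  λ′ * λ′ ^ s * ((suc s * (suc (k + s) C suc s)) * (N C suc (k + s)))
    ≡⟨ e₅ (λ′ * λ′ ^ s) (suc s) (suc (k + s) C suc s) (N C suc (k + s)) ⟩
  suc s * (λ′ ^ suc s * ((suc (k + s) C suc s) * (N C suc (k + s))))
    ≡⟨ cong (λ t → suc s * (λ′ ^ suc s * ((t C suc s) * (N C t)))) (+-suc k s) ⟨
  suc s * (λ′ ^ suc s * (((k + suc s) C suc s) * (N C (k + suc s)))) ∎)
  where
  open ≤-Reasoning
  hyp′ : κ * A ≤ λ′ * (N ∸ (k + s))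
  hyp′ = ≤-trans hyp (*-monoʳ-≤ λ′ (∸-monoʳ-≤ N (+-monoʳ-≤ k (n≤1+n s))))
  e₁ : ∀ s k p a n → s * (k * p * (a * n)) ≡ k * p * (s * a) * n
  e₁ = solve-∀
  e₂ : ∀ k p a c n → k * p * (a * c) * n ≡ k * a * (p * (c * n))
  e₂ = solve-∀
  e₃ : ∀ l d p c n → l * d * (p * (c * n)) ≡ l * p * c * (d * n)
  e₃ = solve-∀
  e₄ : ∀ l c t n → l * c * (t * n) ≡ l * ((t * c) * n)
  e₄ = solve-∀
  e₅ : ∀ l s c n → l * ((s * c) * n) ≡ s * (l * (c * n))
  e₅ = solve-∀

-- Each factor satisfies `κ (M - i) ≤ λ′ (N - i)`: by `λ′ ≤ κ` the left side loses at least as much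
-- as the right.
C-shrink : ∀ {κ λ′ M N} → λ′ ≤ κ → κ * M ≤ λ′ * N → ∀ k → κ ^ k * (M C k) ≤ λ′ ^ k * (N C k)
C-shrink λ≤κ hyp zero = ≤-refl
C-shrink {κ} {λ′} {M} {N} λ≤κ hyp (suc k) = *-cancelˡ-≤ (suc k) (begin
  suc k * (κ ^ suc k * (M C suc k))           ≡⟨ e₁ (suc k) κ (κ ^ k) (M C suc k) ⟩
  κ * κ ^ k * (suc k * (M C suc k))           ≡⟨ cong (κ * κ ^ k *_) ([k+1]nC[k+1] M k) ⟩
  κ * κ ^ k * ((M ∸ k) * (M C k))             ≡⟨ e₂ κ (κ ^ k) (M ∸ k) (M C k) ⟩
  κ * (M ∸ k) * (κ ^ k * (M C k))             ≤⟨ *-mono-≤ step (C-shrink λ≤κ hyp k) ⟩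
  λ′ * (N ∸ k) * (λ′ ^ k * (N C k))           ≡⟨ e₂ λ′ (λ′ ^ k) (N ∸ k) (N C k) ⟨
  λ′ * λ′ ^ k * ((N ∸ k) * (N C k))           ≡⟨ cong (λ′ * λ′ ^ k *_) ([k+1]nC[k+1] N k) ⟨
  λ′ * λ′ ^ k * (suc k * (N C suc k))         ≡⟨ e₁ (suc k) λ′ (λ′ ^ k) (N C suc k) ⟨
  suc k * (λ′ ^ suc k * (N C suc k)) ∎)
  where
  open ≤-Reasoning
  e₁ : ∀ s k p a → s * (k * p * a) ≡ k * p * (s * a)
  e₁ = solve-∀
  e₂ : ∀ k p a c → k * p * (a * c) ≡ k * a * (p * c)
  e₂ = solve-∀
  step : κ * (M ∸ k) ≤ λ′ * (N ∸ k)
  step = begin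
    κ * (M ∸ k)         ≡⟨ *-distribˡ-∸ κ M k ⟩
    κ * M ∸ κ * k       ≤⟨ ∸-mono hyp (*-monoˡ-≤ k λ≤κ) ⟩
    λ′ * N ∸ λ′ * k     ≡⟨ *-distribˡ-∸ λ′ N k ⟨
    λ′ * (N ∸ k) ∎

-- A single term of the expansion of `(1 + z)^(k + s)`.
binomial-term : ∀ z k s → ((k + s) C s) * z ^ k ≤ suc z ^ (k + s)
binomial-term z zero    s       = begin
  (s C s) * 1     ≡⟨ trans (*-identityʳ _) (nCn≡1 s) ⟩
  1               ≤⟨ m^n>0 (suc z) s ⟩
  suc z ^ s ∎
  where open ≤-Reasoning
binomial-term z (suc k) zero    = ≤-trans (≤-reflexive (*-identityˡ _))
  (≤-trans (^-monoˡ-≤ (suc k) (n≤1+n z)) (≤-reflexive (cong (suc z ^_) (sym (+-identityʳ (suc k))))))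
binomial-term z (suc k) (suc s) = begin
  ((suc k + suc s) C suc s) * z ^ suc k
    ≡⟨ cong (_* z ^ suc k) (nCk+nC[k+1]≡[n+1]C[k+1] (k + suc s) s) ⟨
  ((k + suc s) C s + (k + suc s) C suc s) * z ^ suc k
    ≡⟨ e ((k + suc s) C s) ((k + suc s) C suc s) z (z ^ k) ⟩
  ((k + suc s) C s) * z ^ suc k + z * (((k + suc s) C suc s) * z ^ k)
    ≡⟨ cong (λ t → (t C s) * z ^ suc k + z * (((k + suc s) C suc s) * z ^ k)) (+-suc k s) ⟩
  ((suc k + s) C s) * z ^ suc k + z * (((k + suc s) C suc s) * z ^ k)
    ≤⟨ +-mono-≤ (binomial-term z (suc k) s) (*-monoʳ-≤ z (binomial-term z k (suc s))) ⟩
  suc z ^ (suc k + s) + z * suc z ^ (k + suc s)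
    ≡⟨ cong (λ t → suc z ^ t + z * suc z ^ (k + suc s)) (+-suc k s) ⟨
  suc z ^ (suc k + suc s) ∎
  where
  open ≤-Reasoning
  e : ∀ x y z p → (x + y) * (z * p) ≡ x * (z * p) + z * (y * p)
  e = solve-∀

nCk≤2^n : ∀ k s → (k + s) C s ≤ 2 ^ (k + s)
nCk≤2^n k s = ≤-trans (≤-reflexive (trans (sym (*-identityʳ _)) (cong (((k + s) C s) *_) (sym (^-zeroˡ k))))) (binomial-term 1 k s)

-- `1 + k/w ≤ (1 + 1/w)^k`, cleared of denominators.
bernoulli : ∀ w k → w ^ k * (w + k) ≤ suc w ^ k * w
bernoulli w zero    = ≤-reflexive (cong (1 *_) (+-identityʳ w))
bernoulli w (suc k) = begin
  w * w ^ k * (w + suc k)                 ≤⟨ m≤m+n _ (w ^ k * k) ⟩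
  w * w ^ k * (w + suc k) + w ^ k * k     ≡⟨ e₁ w k (w ^ k) ⟩
  suc w * (w ^ k * (w + k))               ≤⟨ *-monoʳ-≤ (suc w) (bernoulli w k) ⟩
  suc w * (suc w ^ k * w)                 ≡⟨ *-assoc (suc w) (suc w ^ k) w ⟨
  suc w ^ suc k * w ∎
  where
  open ≤-Reasoning
  e₁ : ∀ w k p → w * p * (w + suc k) + p * k ≡ suc w * (p * (w + k))
  e₁ = solve-∀

^-distribʳ-* : ∀ m n k → (m * n) ^ k ≡ m ^ k * n ^ k
^-distribʳ-* m n zero    = refl
^-distribʳ-* m n (suc k) = trans (cong (m * n *_) (^-distribʳ-* m n k)) (e m n (m ^ k) (n ^ k))
  where
  e : ∀ m n x y → m * n * (x * y) ≡ m * x * (n * y)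
  e = solve-∀

-- Each block of `w * B` factors gains `(1 + 1/w)^(w B) ≥ 1 + B`, which pays for one factor `B`; the
-- `o` factors left over are only not allowed to lose.
power-gap : ∀ w .{{_ : NonZero w}} B s k → w * B * s ≤ k → w ^ k * B ^ s ≤ suc w ^ k
power-gap w B s k le with o , refl ← m≤n⇒∃[o]m+o≡n le = begin
  w ^ (w * B * s + o) * B ^ s             ≡⟨ cong (_* B ^ s) (^-distribˡ-+-* w (w * B * s) o) ⟩
  w ^ (w * B * s) * w ^ o * B ^ s         ≡⟨ cong (λ t → t * w ^ o * B ^ s) (sym (^-*-assoc w (w * B) s)) ⟩
  (w ^ (w * B)) ^ s * w ^ o * B ^ s       ≡⟨ e ((w ^ (w * B)) ^ s) (w ^ o) (B ^ s) ⟩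
  (w ^ (w * B)) ^ s * B ^ s * w ^ o       ≡⟨ cong (_* w ^ o) (^-distribʳ-* (w ^ (w * B)) B s) ⟨
  (w ^ (w * B) * B) ^ s * w ^ o           ≤⟨ *-mono-≤ (^-monoˡ-≤ s one) (^-monoˡ-≤ o (n≤1+n w)) ⟩
  (suc w ^ (w * B)) ^ s * suc w ^ o       ≡⟨ cong (_* suc w ^ o) (^-*-assoc (suc w) (w * B) s) ⟩
  suc w ^ (w * B * s) * suc w ^ o         ≡⟨ ^-distribˡ-+-* (suc w) (w * B * s) o ⟨
  suc w ^ (w * B * s + o) ∎
  where
  open ≤-Reasoning
  e : ∀ x y z → x * y * z ≡ x * z * y
  e = solve-∀
  one : w ^ (w * B) * B ≤ suc w ^ (w * B)
  one = *-cancelʳ-≤ _ _ w (begin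
    w ^ (w * B) * B * w           ≡⟨ trans (*-assoc (w ^ (w * B)) B w) (cong (w ^ (w * B) *_) (*-comm B w)) ⟩
    w ^ (w * B) * (w * B)         ≤⟨ *-monoʳ-≤ (w ^ (w * B)) (m≤n+m (w * B) w) ⟩
    w ^ (w * B) * (w + w * B)     ≤⟨ bernoulli w (w * B) ⟩
    suc w ^ (w * B) * w ∎)

2^s*2^r≤4^s : ∀ {r s} → r ≤ s → 2 ^ s * 2 ^ r ≤ 4 ^ s
2^s*2^r≤4^s {r} {s} r≤s = ≤-trans (*-monoʳ-≤ (2 ^ s) (^-monoʳ-≤ 2 r≤s)) (≤-reflexive (sym (^-distribʳ-* 2 2 s)))

-- The saving `(u/(u+1))^k` is `(2u/w)^k * (w/(w+1))^k` with `w = 2u + 1`. The first factor absorbs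
-- the binomial `(k + s) C s` left by `exchange`, up to `w^s`. The second absorbs the remaining
-- `(4 L w)^s` by `power-gap`, the 4 covering `2^s * 2^r`.
count-sparse : ∀ u L .{{_ : NonZero L}} {A M N} r s k (let w = suc (2 * u)) → r ≤ s → w * (4 * (L * w)) * s ≤ k →
  suc u * M ≤ u * N → A ≤ L * (N ∸ (k + s)) → 2 ^ s * 2 ^ r * ((A C s) * (M C k)) ≤ N C (k + s)
count-sparse u L {A} {M} {N} r s k r≤s large M≤ A≤ =
  ≤-trans (*-monoˡ-≤ (X * Y) (2^s*2^r≤4^s r≤s)) (*-cancelˡ-≤ (w ^ k * (L * w) ^ s) {{nz}} (begin
    w ^ k * (L * w) ^ s * (4 ^ s * (X * Y))           ≡⟨ e₁ (w ^ k) ((L * w) ^ s) (4 ^ s) (X * Y) ⟩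
    w ^ k * (4 ^ s * (L * w) ^ s) * (X * Y)           ≡⟨ cong (λ t → w ^ k * t * (X * Y)) (^-distribʳ-* 4 (L * w) s) ⟨
    w ^ k * (4 * (L * w)) ^ s * (X * Y)               ≤⟨ *-monoˡ-≤ (X * Y) (power-gap w (4 * (L * w)) s k large) ⟩
    suc w ^ k * (X * Y)                               ≡⟨ cong (λ t → t ^ k * (X * Y)) (e₂ u) ⟩
    (2 * suc u) ^ k * (X * Y)                         ≡⟨ cong (_* (X * Y)) (^-distribʳ-* 2 (suc u) k) ⟩
    2 ^ k * suc u ^ k * (X * Y)                       ≡⟨ e₃ (2 ^ k) (suc u ^ k) X Y ⟩
    2 ^ k * X * (suc u ^ k * Y)                       ≤⟨ *-monoʳ-≤ (2 ^ k * X) (C-shrink (n≤1+n u) M≤ k) ⟩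
    2 ^ k * X * (u ^ k * (N C k))                     ≡⟨ e₄ (2 ^ k) X (u ^ k) (N C k) ⟩
    2 ^ k * u ^ k * (X * (N C k))                     ≡⟨ cong₂ _*_ (sym (^-distribʳ-* 2 u k)) (sym (trans (cong (_* (X * (N C k))) (^-zeroˡ s)) (*-identityˡ _))) ⟩
    (2 * u) ^ k * (1 ^ s * (X * (N C k)))             ≤⟨ *-monoʳ-≤ ((2 * u) ^ k) (exchange k s (≤-trans (≤-reflexive (*-identityˡ A)) A≤)) ⟩
    (2 * u) ^ k * (L ^ s * (((k + s) C s) * Z))       ≡⟨ e₅ ((2 * u) ^ k) (L ^ s) ((k + s) C s) Z ⟩
    L ^ s * (((k + s) C s) * (2 * u) ^ k) * Z         ≤⟨ *-monoˡ-≤ Z (*-monoʳ-≤ (L ^ s) (binomial-term (2 * u) k s)) ⟩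
    L ^ s * w ^ (k + s) * Z                           ≡⟨ cong (λ t → L ^ s * t * Z) (^-distribˡ-+-* w k s) ⟩
    L ^ s * (w ^ k * w ^ s) * Z                       ≡⟨ e₆ (L ^ s) (w ^ k) (w ^ s) Z ⟩
    w ^ k * (L ^ s * w ^ s) * Z                       ≡⟨ cong (λ t → w ^ k * t * Z) (^-distribʳ-* L w s) ⟨
    w ^ k * (L * w) ^ s * Z ∎))
  where
  open ≤-Reasoning
  w X Y Z : ℕ
  w = suc (2 * u)
  X = A C s
  Y = M C k
  Z = N C (k + s)
  nz : NonZero (w ^ k * (L * w) ^ s)
  nz = m*n≢0 (w ^ k) ((L * w) ^ s) {{m^n≢0 w k}} {{m^n≢0 (L * w) s {{m*n≢0 L w}}}}
  e₁ : ∀ a b c d → a * b * (c * d) ≡ a * (c * b) * d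
  e₁ = solve-∀
  e₂ : ∀ u → suc (suc (2 * u)) ≡ 2 * suc u
  e₂ = solve-∀
  e₃ : ∀ a b c d → a * b * (c * d) ≡ a * c * (b * d)
  e₃ = solve-∀
  e₄ : ∀ a b c d → a * b * (c * d) ≡ a * c * (b * d)
  e₄ = solve-∀
  e₅ : ∀ a b c d → a * (b * (c * d)) ≡ b * (c * a) * d
  e₅ = solve-∀
  e₆ : ∀ a b c d → a * (b * c) * d ≡ b * (a * c) * d
  e₆ = solve-∀

-- The `j` elements from the small set B save `(16 L)^(q j) ≥ (16 L)^m`. This covers at most `4^m`
-- for `2^s * 2^r`, `L^m` for enlarging N to A, and `2^m` for each of the two binomials left by
-- `exchange`.
count-dense : ∀ L .{{_ : NonZero L}} q {A B N} r s j k (let m = k + j + s) → r ≤ s → m ≤ q * j →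
  (16 * L) ^ q * B ≤ N ∸ m → A ≤ L * (N ∸ m) → 2 ^ s * 2 ^ r * ((A C s) * ((B C j) * (A C k))) ≤ N C m
count-dense L q {A} {B} {N} r s j k r≤s m≤qj B≤ A≤ =
  ≤-trans (*-monoˡ-≤ W (≤-trans (2^s*2^r≤4^s r≤s) (^-monoʳ-≤ 4 (m≤n+m s (k + j))))) (*-cancelˡ-≤ ((4 * L) ^ m) {{m^n≢0 (4 * L) m {{m*n≢0 4 L}}}} (begin
    (4 * L) ^ m * (4 ^ m * W)                 ≡⟨ *-assoc ((4 * L) ^ m) (4 ^ m) W ⟨
    (4 * L) ^ m * 4 ^ m * W                   ≡⟨ cong (_* W) (trans (sym (^-distribʳ-* (4 * L) 4 m)) (cong (_^ m) (e₁ L))) ⟩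
    (16 * L) ^ m * W                          ≤⟨ *-monoˡ-≤ W (^-monoʳ-≤ (16 * L) {{m*n≢0 16 L}} m≤qj) ⟩
    (16 * L) ^ (q * j) * W                    ≡⟨ cong (_* W) (^-*-assoc (16 * L) q j) ⟨
    Λ ^ j * (X * (Y * (A C k)))               ≤⟨ *-monoʳ-≤ (Λ ^ j) (*-monoʳ-≤ X (*-monoʳ-≤ Y A-C≤)) ⟩
    Λ ^ j * (X * (Y * (L ^ k * (N C k))))     ≡⟨ e₂ (Λ ^ j) X Y (L ^ k) (N C k) ⟩
    X * L ^ k * (Λ ^ j * (Y * (N C k)))       ≤⟨ *-monoʳ-≤ (X * L ^ k) (exchange k j (≤-trans B≤ (≤-trans (∸-monoʳ-≤ N (m≤m+n (k + j) s)) (≤-reflexive (sym (*-identityˡ _)))))) ⟩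
    X * L ^ k * (1 ^ j * (((k + j) C j) * (N C (k + j))))
      ≤⟨ *-monoʳ-≤ (X * L ^ k) (≤-trans (≤-reflexive (trans (cong (_* (((k + j) C j) * (N C (k + j)))) (^-zeroˡ j)) (*-identityˡ _)))
           (*-monoˡ-≤ (N C (k + j)) (≤-trans (nCk≤2^n k j) (^-monoʳ-≤ 2 (m≤m+n (k + j) s))))) ⟩
    X * L ^ k * (2 ^ m * (N C (k + j)))       ≡⟨ e₃ X (L ^ k) (2 ^ m) (N C (k + j)) ⟩
    L ^ k * 2 ^ m * (X * (N C (k + j)))       ≡⟨ cong (L ^ k * 2 ^ m *_) (trans (cong (_* (X * (N C (k + j)))) (^-zeroˡ s)) (*-identityˡ _)) ⟨
    L ^ k * 2 ^ m * (1 ^ s * (X * (N C (k + j))))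
      ≤⟨ *-monoʳ-≤ (L ^ k * 2 ^ m) (exchange (k + j) s (≤-trans (≤-reflexive (*-identityˡ A)) A≤)) ⟩
    L ^ k * 2 ^ m * (L ^ s * ((m C s) * Z))   ≡⟨ e₄ (L ^ k) (2 ^ m) (L ^ s) (m C s) Z ⟩
    L ^ k * L ^ s * (2 ^ m * (m C s)) * Z     ≤⟨ *-monoˡ-≤ Z (*-mono-≤ L-power (*-monoʳ-≤ (2 ^ m) (nCk≤2^n (k + j) s))) ⟩
    L ^ m * (2 ^ m * 2 ^ m) * Z               ≡⟨ cong (λ t → L ^ m * t * Z) (^-distribʳ-* 2 2 m) ⟨
    L ^ m * 4 ^ m * Z                         ≡⟨ cong (_* Z) (trans (*-comm (L ^ m) (4 ^ m)) (sym (^-distribʳ-* 4 L m))) ⟩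
    (4 * L) ^ m * Z ∎))
  where
  open ≤-Reasoning
  m Λ X Y W Z : ℕ
  m = k + j + s
  Λ = (16 * L) ^ q
  X = A C s
  Y = B C j
  W = X * (Y * (A C k))
  Z = N C m
  A-C≤ : A C k ≤ L ^ k * (N C k)
  A-C≤ = begin
    A C k                               ≡⟨ trans (cong (_* (A C k)) (^-zeroˡ k)) (*-identityˡ _) ⟨
    1 ^ k * (A C k)                     ≡⟨ cong (1 ^ k *_) (*-identityʳ _) ⟨
    1 ^ k * ((A C k) * (N C 0))         ≤⟨ exchange 0 k (≤-trans (≤-reflexive (*-identityˡ A)) (≤-trans A≤ (*-monoʳ-≤ L (∸-monoʳ-≤ N (≤-trans (m≤m+n k j) (m≤m+n (k + j) s)))))) ⟩
    L ^ k * ((k C k) * (N C k))         ≡⟨ cong (L ^ k *_) (trans (cong (_* (N C k)) (nCn≡1 k)) (*-identityˡ _)) ⟩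
    L ^ k * (N C k) ∎
  L-power : L ^ k * L ^ s ≤ L ^ m
  L-power = ≤-trans (≤-reflexive (sym (^-distribˡ-+-* L k s))) (^-monoʳ-≤ L (+-monoˡ-≤ s (m≤m+n k j)))
  e₁ : ∀ L → 4 * L * 4 ≡ 16 * L
  e₁ = solve-∀
  e₂ : ∀ a x y l n → a * (x * (y * (l * n))) ≡ x * l * (a * (y * n))
  e₂ = solve-∀
  e₃ : ∀ x l p n → x * l * (p * n) ≡ l * p * (x * n)
  e₃ = solve-∀
  e₄ : ∀ a b c d z → a * b * (c * (d * z)) ≡ a * c * (b * d) * z
  e₄ = solve-∀

-- Lists of subsets

module _ {A : Set} where

  Unique-length-≤ : ∀ {xs ys : List A} → Unique xs → (∀ {x} → x ∈ₗ xs → x ∈ₗ ys) → length xs ≤ length ys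
  Unique-length-≤ {[]}     []         xs⊆ys = z≤n
  Unique-length-≤ {x ∷ xs} (x∉ ∷ uniq) xs⊆ys
    with as , bs , refl ← ∈-∃++ (xs⊆ys (Any.here refl)) = begin
      suc (length xs)              ≤⟨ s≤s (Unique-length-≤ uniq avoid) ⟩
      suc (length (as ++ bs))      ≡⟨ cong suc (length-++ as) ⟩
      suc (length as + length bs)  ≡⟨ +-suc (length as) (length bs) ⟨
      length as + suc (length bs)  ≡⟨ length-++ as ⟨
      length (as ++ x ∷ bs) ∎
    where
    open ≤-Reasoning
    avoid : ∀ {y} → y ∈ₗ xs → y ∈ₗ as ++ bs
    avoid y∈ with ∈-++⁻ as (xs⊆ys (Any.there y∈))
    ... | inj₁ y∈as             = ∈-++⁺ˡ y∈as
    ... | inj₂ (Any.here refl)  = contradiction refl (All.lookup x∉ y∈)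
    ... | inj₂ (Any.there y∈bs) = ∈-++⁺ʳ as y∈bs

  -- The multiplier `D` keeps the counting free of division: estimates are stated as `D * count ≤ X`
  -- and the common factors are cancelled at the end.
  length-concatMap-≤ : ∀ {B : Set} (f : A → List B) D E → (∀ x → D * length (f x) ≤ E) →
    ∀ xs → D * length (concatMap f xs) ≤ length xs * E
  length-concatMap-≤ f D E bound []       = ≤-reflexive (*-zeroʳ D)
  length-concatMap-≤ f D E bound (x ∷ xs) = begin
    D * length (f x ++ concatMap f xs)                 ≡⟨ cong (D *_) (length-++ (f x)) ⟩
    D * (length (f x) + length (concatMap f xs))       ≡⟨ *-distribˡ-+ D (length (f x)) _ ⟩
    D * length (f x) + D * length (concatMap f xs)     ≤⟨ +-mono-≤ (bound x) (length-concatMap-≤ f D E bound xs) ⟩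
    E + length xs * E ∎
    where open ≤-Reasoning

subsets : ∀ n → List (Subset n)
subsets zero    = [] ∷ []
subsets (suc n) = map (inside ∷_) (subsets n) ++ map (outside ∷_) (subsets n)

∈-subsets : ∀ {n} (p : Subset n) → p ∈ₗ subsets n
∈-subsets []            = Any.here refl
∈-subsets (inside  ∷ p) = ∈-++⁺ˡ (∈-map⁺ (inside ∷_) (∈-subsets p))
∈-subsets (outside ∷ p) = ∈-++⁺ʳ (map (inside ∷_) (subsets _)) (∈-map⁺ (outside ∷_) (∈-subsets p))

length-subsets : ∀ n → length (subsets n) ≡ 2 ^ n
length-subsets zero    = refl
length-subsets (suc n) = trans (length-++ (map (inside ∷_) (subsets n)))
  (cong₂ _+_ (trans (length-map (inside ∷_) (subsets n)) (length-subsets n))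
    (trans (length-map (outside ∷_) (subsets n)) (trans (length-subsets n) (sym (+-identityʳ (2 ^ n))))))

choose : ∀ {n} → Subset n → ℕ → List (Subset n)
choose []            zero    = [] ∷ []
choose []            (suc k) = []
choose (outside ∷ p) k       = map (outside ∷_) (choose p k)
choose (inside  ∷ p) zero    = map (outside ∷_) (choose p zero)
choose (inside  ∷ p) (suc k) = map (inside ∷_) (choose p k) ++ map (outside ∷_) (choose p (suc k))

length-choose : ∀ {n} (p : Subset n) k → length (choose p k) ≡ ∣ p ∣ C k
length-choose []            zero    = refl
length-choose []            (suc k) = refl
length-choose (outside ∷ p) k       = trans (length-map (outside ∷_) (choose p k)) (length-choose p k)
length-choose (inside  ∷ p) zero    = trans (length-map (outside ∷_) (choose p zero)) (length-choose p zero)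
length-choose (inside  ∷ p) (suc k) = begin
  length (map (inside ∷_) (choose p k) ++ map (outside ∷_) (choose p (suc k)))
    ≡⟨ length-++ (map (inside ∷_) (choose p k)) ⟩
  length (map (inside ∷_) (choose p k)) + length (map (outside ∷_) (choose p (suc k)))
    ≡⟨ cong₂ _+_ (trans (length-map (inside ∷_) (choose p k)) (length-choose p k))
                 (trans (length-map (outside ∷_) (choose p (suc k))) (length-choose p (suc k))) ⟩
  ∣ p ∣ C k + ∣ p ∣ C suc k
    ≡⟨ nCk+nC[k+1]≡[n+1]C[k+1] ∣ p ∣ k ⟩
  suc ∣ p ∣ C suc k ∎
  where open ≡-Reasoning

∈-choose⁺ : ∀ {n} {p q : Subset n} → q ⊆ p → q ∈ₗ choose p ∣ q ∣
∈-choose⁺ {p = []}          {[]}          q⊆p = Any.here refl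
∈-choose⁺ {p = outside ∷ p} {inside ∷ q}  q⊆p with () ← q⊆p here
∈-choose⁺ {p = outside ∷ p} {outside ∷ q} q⊆p = ∈-map⁺ (outside ∷_) (∈-choose⁺ (drop-∷-⊆ q⊆p))
∈-choose⁺ {p = inside ∷ p}  {inside ∷ q}  q⊆p = ∈-++⁺ˡ (∈-map⁺ (inside ∷_) (∈-choose⁺ (drop-∷-⊆ q⊆p)))
∈-choose⁺ {p = inside ∷ p}  {outside ∷ q} q⊆p with ∣ q ∣ | ∈-choose⁺ (drop-∷-⊆ q⊆p)
... | zero  | q∈ = ∈-map⁺ (outside ∷_) q∈
... | suc k | q∈ = ∈-++⁺ʳ (map (inside ∷_) (choose p k)) (∈-map⁺ (outside ∷_) q∈)

∈-choose⁻ : ∀ {n} (p : Subset n) k {q} → q ∈ₗ choose p k → q ⊆ p × ∣ q ∣ ≡ k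
∈-choose⁻ []            zero    (Any.here refl) = ⊆-refl , refl
∈-choose⁻ (outside ∷ p) k       q∈ with q , q∈′ , refl ← ∈-map⁻ (outside ∷_) q∈ =
  let q⊆ , eq = ∈-choose⁻ p k q∈′ in out⊆ q⊆ , eq
∈-choose⁻ (inside ∷ p)  zero    q∈ with q , q∈′ , refl ← ∈-map⁻ (outside ∷_) q∈ =
  let q⊆ , eq = ∈-choose⁻ p zero q∈′ in out⊆ q⊆ , eq
∈-choose⁻ (inside ∷ p)  (suc k) q∈ with ∈-++⁻ (map (inside ∷_) (choose p k)) q∈
... | inj₁ q∈₁ with q , q∈′ , refl ← ∈-map⁻ (inside ∷_) q∈₁ =
  let q⊆ , eq = ∈-choose⁻ p k q∈′ in in⊆in q⊆ , cong suc eq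
... | inj₂ q∈₂ with q , q∈′ , refl ← ∈-map⁻ (outside ∷_) q∈₂ =
  let q⊆ , eq = ∈-choose⁻ p (suc k) q∈′ in out⊆ q⊆ , eq

choose-Unique : ∀ {n} (p : Subset n) k → Unique (choose p k)
choose-Unique []            zero    = [] ∷ []
choose-Unique []            (suc k) = []
choose-Unique (outside ∷ p) k       = Unique.map⁺ ∷-injectiveʳ (choose-Unique p k)
choose-Unique (inside ∷ p)  zero    = Unique.map⁺ ∷-injectiveʳ (choose-Unique p zero)
choose-Unique (inside ∷ p)  (suc k) =
  Unique.++⁺ (Unique.map⁺ ∷-injectiveʳ (choose-Unique p k)) (Unique.map⁺ ∷-injectiveʳ (choose-Unique p (suc k))) disjoint
  where
  disjoint : ∀ {q} → ¬ (q ∈ₗ map (inside ∷_) (choose p k) × q ∈ₗ map (outside ∷_) (choose p (suc k)))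
  disjoint (q∈₁ , q∈₂) with _ , _ , refl ← ∈-map⁻ (inside ∷_) q∈₁ with () ← proj₂ (proj₂ (∈-map⁻ (outside ∷_) q∈₂))

-- Pads a fingerprint to exactly `s` edges inside H, and, starting from `⊥`, picks exactly `j`
-- exceptional edges.
subset-between : ∀ {n} (p q : Subset n) k → p ⊆ q → ∣ p ∣ ≤ k → k ≤ ∣ q ∣ → Σ (Subset n) λ r → p ⊆ r × r ⊆ q × ∣ r ∣ ≡ k
subset-between []            []            zero    _   _ _ = [] , ⊆-refl , ⊆-refl , refl
subset-between (outside ∷ p) (outside ∷ q) k       p⊆q lo hi =
  let r , p⊆r , r⊆q , eq = subset-between p q k (drop-∷-⊆ p⊆q) lo hi in outside ∷ r , out⊆ p⊆r , out⊆ r⊆q , eq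
subset-between (inside ∷ p)  (outside ∷ q) k       p⊆q lo hi with () ← p⊆q here
subset-between (inside ∷ p)  (inside ∷ q)  (suc k) p⊆q (s≤s lo) (s≤s hi) =
  let r , p⊆r , r⊆q , eq = subset-between p q k (drop-∷-⊆ p⊆q) lo hi in inside ∷ r , in⊆in p⊆r , in⊆in r⊆q , cong suc eq
subset-between (outside ∷ p) (inside ∷ q)  k       p⊆q lo hi with k ≤? ∣ q ∣
... | yes hi′ = let r , p⊆r , r⊆q , eq = subset-between p q k (drop-∷-⊆ p⊆q) lo hi′ in outside ∷ r , out⊆ p⊆r , out⊆ r⊆q , eq
... | no  ¬hi′ = inside ∷ q , out⊆ (drop-∷-⊆ p⊆q) , in⊆in ⊆-refl , ≤-antisym (≰⇒> ¬hi′) hi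

∪-─ : ∀ {n} {p q : Subset n} → p ⊆ q → p ∪ (q ─ p) ≡ q
∪-─ {p = p} {q} p⊆q = ⊆-antisym to from
  where
  to : p ∪ (q ─ p) ⊆ q
  to x∈ with x∈p∪q⁻ p (q ─ p) x∈
  ... | inj₁ x∈p = p⊆q x∈p
  ... | inj₂ x∈q─p = p─q⊆p q p x∈q─p
  from : q ⊆ p ∪ (q ─ p)
  from {x} x∈q with x ∈? p
  ... | yes x∈p = x∈p∪q⁺ (inj₁ x∈p)
  ... | no  x∉p = x∈p∪q⁺ {p = p} (inj₂ (x∈p∧x∉q⇒x∈p─q x∈q x∉p))

∣p∣+∣q─p∣≡∣q∣ : ∀ {n} {p q : Subset n} → p ⊆ q → ∣ p ∣ + ∣ q ─ p ∣ ≡ ∣ q ∣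
∣p∣+∣q─p∣≡∣q∣ {p = []}          {[]}          p⊆q = refl
∣p∣+∣q─p∣≡∣q∣ {p = outside ∷ p} {outside ∷ q} p⊆q = ∣p∣+∣q─p∣≡∣q∣ (drop-∷-⊆ p⊆q)
∣p∣+∣q─p∣≡∣q∣ {p = outside ∷ p} {inside ∷ q}  p⊆q = trans (+-suc ∣ p ∣ _) (cong suc (∣p∣+∣q─p∣≡∣q∣ (drop-∷-⊆ p⊆q)))
∣p∣+∣q─p∣≡∣q∣ {p = inside ∷ p}  {outside ∷ q} p⊆q with () ← p⊆q here
∣p∣+∣q─p∣≡∣q∣ {p = inside ∷ p}  {inside ∷ q}  p⊆q = cong suc (∣p∣+∣q─p∣≡∣q∣ (drop-∷-⊆ p⊆q))

∈─⇒∉ : ∀ {k} (p q : Subset k) {i} → i ∈ p ─ q → ¬ i ∈ q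
∈─⇒∉ (_ Vec.∷ p) (inside Vec.∷ q)  (Vec.there i∈) (Vec.there i∈q) = ∈─⇒∉ p q i∈ i∈q
∈─⇒∉ (_ Vec.∷ p) (outside Vec.∷ q) (Vec.there i∈) (Vec.there i∈q) = ∈─⇒∉ p q i∈ i∈q

∣q─p∣≡∣q∣∸∣p∣ : ∀ {k} {p q : Subset k} → p ⊆ q → ∣ q ─ p ∣ ≡ ∣ q ∣ ∸ ∣ p ∣
∣q─p∣≡∣q∣∸∣p∣ {p = p} {q} p⊆q = trans (sym (m+n∸m≡n ∣ p ∣ ∣ q ─ p ∣)) (cong (_∸ ∣ p ∣) (∣p∣+∣q─p∣≡∣q∣ p⊆q))

-- Triples

does-true : ∀ {P : Set} (P? : Dec P) → does P? ≡ true → P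
does-true (yes p) _ = p

does-false : ∀ {P : Set} (P? : Dec P) → does P? ≡ false → ¬ P
does-false (no ¬p) _ = ¬p

Bool-ext : ∀ {p q} → (p ≡ true → q ≡ true) → (q ≡ true → p ≡ true) → p ≡ q
Bool-ext {true}  {q}     p⇒q _   = sym (p⇒q refl)
Bool-ext {false} {true}  _   q⇒p with () ← q⇒p refl
Bool-ext {false} {false} _   _   = refl

∣p∪q∣≤∣p∣+∣q∣ : ∀ {n} (p q : Subset n) → ∣ p ∪ q ∣ ≤ ∣ p ∣ + ∣ q ∣
∣p∪q∣≤∣p∣+∣q∣ Vec.[]              Vec.[]              = z≤n
∣p∪q∣≤∣p∣+∣q∣ (outside Vec.∷ p) (outside Vec.∷ q) = ∣p∪q∣≤∣p∣+∣q∣ p q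
∣p∪q∣≤∣p∣+∣q∣ (outside Vec.∷ p) (inside  Vec.∷ q) = ≤-trans (s≤s (∣p∪q∣≤∣p∣+∣q∣ p q)) (≤-reflexive (sym (+-suc ∣ p ∣ ∣ q ∣)))
∣p∪q∣≤∣p∣+∣q∣ (inside  Vec.∷ p) (outside Vec.∷ q) = s≤s (∣p∪q∣≤∣p∣+∣q∣ p q)
∣p∪q∣≤∣p∣+∣q∣ (inside  Vec.∷ p) (inside  Vec.∷ q) = s≤s (≤-trans (∣p∪q∣≤∣p∣+∣q∣ p q) (+-monoʳ-≤ ∣ p ∣ (n≤1+n ∣ q ∣)))

triple : ∀ {n} → Fin (length (triples n)) → Triple n
triple {n} = lookup (triples n)

increasing : ∀ {n} → Fin n → Fin n → Fin n → Bool
increasing a b c = does (a Fin.<? b) ∧ does (b Fin.<? c)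

All-concatMap : ∀ {A B : Set} {P : B → Set} {f : A → List B} → (∀ x → All P (f x)) → ∀ xs → All P (concatMap f xs)
All-concatMap {f = f} all xs = All.concat⁺ (All.map⁺ (All.universal all xs))

All-if : ∀ {A : Set} {P : A → Set} {x : A} p → (p ≡ true → P x) → All P (if p then x ∷ [] else [])
All-if true  px = px refl ∷ []
All-if false _  = []

Increasing : ∀ {n} → Triple n → Set
Increasing (a , b , c) = a Fin.< b × b Fin.< c

triple-increasing : ∀ {n} (i : Fin (length (triples n))) → Increasing (triple i)
triple-increasing {n} i = All.lookup
  (All-concatMap (λ a → All-concatMap (λ b → All-concatMap (λ c →
    All-if {P = Increasing} {x = a , b , c} (increasing a b c) (λ eq → let p , q = ∧-true eq in
      does-true (a Fin.<? b) p , does-true (b Fin.<? c) q))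
    (allFin n)) (allFin n)) (allFin n))
  (∈-lookup i)

∣tabulate∣ : ∀ {A : Set} (p : A → Bool) (xs : List A) → ∣ Vec.tabulate (λ i → p (lookup xs i)) ∣ ≡ sumₗ (map (λ x → ι (p x)) xs)
∣tabulate∣ p []       = refl
∣tabulate∣ p (x ∷ xs) with p x
... | true  = cong suc (∣tabulate∣ p xs)
... | false = ∣tabulate∣ p xs

sum-concatMap : ∀ {A B : Set} {n} (w : B → ℕ) (f : A → List B) (g : Fin n → A) →
  sumₗ (map w (concatMap f (tabulate g))) ≡ ∑[ i < n ] sumₗ (map w (f (g i)))
sum-concatMap {n = zero}  w f g = refl
sum-concatMap {n = suc n} w f g = begin
  sumₗ (map w (f (g zero) ++ concatMap f (tabulate (λ i → g (suc i)))))
    ≡⟨ cong sumₗ (map-++ w (f (g zero)) _) ⟩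
  sumₗ (map w (f (g zero)) ++ map w (concatMap f (tabulate (λ i → g (suc i)))))
    ≡⟨ sum-++ (map w (f (g zero))) _ ⟩
  sumₗ (map w (f (g zero))) + sumₗ (map w (concatMap f (tabulate (λ i → g (suc i)))))
    ≡⟨ cong (sumₗ (map w (f (g zero))) +_) (sum-concatMap w f (λ i → g (suc i))) ⟩
  sumₗ (map w (f (g zero))) + ∑[ i < n ] sumₗ (map w (f (g (suc i)))) ∎
  where open ≡-Reasoning

opaque
  -- A predicate is evaluated only at the increasing listing of each 3-set, so its values at the
  -- other five orders are ignored.
  restrict : ∀ {n} → (Fin n → Fin n → Fin n → Bool) → Subset (length (triples n))
  restrict P = Vec.tabulate (λ i → let a , b , c = triple i in P a b c)

module _ {n : ℕ} (P : Fin n → Fin n → Fin n → Bool) where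

  opaque
    unfolding restrict

    ∈-restrict⁺ : ∀ {i} → (let a , b , c = triple i in P a b c ≡ true) → i ∈ restrict P
    ∈-restrict⁺ {i} eq = lookup⇒[]= i _ (trans (lookup∘tabulate _ i) eq)

    ∈-restrict⁻ : ∀ {i} → i ∈ restrict P → let a , b , c = triple i in P a b c ≡ true
    ∈-restrict⁻ {i} i∈ = trans (sym (lookup∘tabulate _ i)) ([]=⇒lookup i∈)

    ∣restrict∣ : ∣ restrict P ∣ ≡ ∑³ (λ a b c → ι (increasing a b c ∧ P a b c))
    ∣restrict∣ = trans (∣tabulate∣ p (triples n))
      (trans (sum-concatMap w f₁ (λ a → a)) (sum-cong-≗ λ a →
        trans (sum-concatMap w (f₂ a) (λ b → b)) (sum-cong-≗ λ b →
          trans (sum-concatMap w (f₃ a b) (λ c → c)) (sum-cong-≗ λ c → single a b c))))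
      where
      p : Triple n → Bool
      p (a , b , c) = P a b c
      w : Triple n → ℕ
      w t = ι (p t)
      f₃ : Fin n → Fin n → Fin n → List (Triple n)
      f₃ a b c = if does (a Fin.<? b) ∧ does (b Fin.<? c) then (a , b , c) ∷ [] else []
      f₂ : Fin n → Fin n → List (Triple n)
      f₂ a b = concatMap (f₃ a b) (allFin n)
      f₁ : Fin n → List (Triple n)
      f₁ a = concatMap (f₂ a) (allFin n)
      single : ∀ a b c → sumₗ (map w (f₃ a b c)) ≡ ι (increasing a b c ∧ P a b c)
      single a b c = sum-if (increasing a b c)
        where
        sum-if : ∀ q → sumₗ (map w (if q then (a , b , c) ∷ [] else [])) ≡ ι (q ∧ P a b c)
        sum-if true  = +-identityʳ _
        sum-if false = refl

  ∣restrict∣≤∑³ : ∣ restrict P ∣ ≤ ∑³ (λ a b c → ι (P a b c))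
  ∣restrict∣≤∑³ = ≤-trans (≤-reflexive ∣restrict∣) (∑³-mono λ a b c → drop (increasing a b c) (P a b c))
    where
    drop : ∀ p q → ι (p ∧ q) ≤ ι q
    drop true  q = ≤-refl
    drop false q = z≤n

-- The letters stand for `a < b`, `b < c`, `a < c`, primes for the converse relations. Besides
-- asymmetry, the two cyclic patterns have to be excluded, since each would make three of the six
-- conjunctions true.
six-orders : ∀ p p′ q q′ r r′ → p ∧ p′ ≡ false → q ∧ q′ ≡ false → r ∧ r′ ≡ false →
  (p ∧ q) ∧ r′ ≡ false → (q′ ∧ p′) ∧ r ≡ false →
  ι (p ∧ q) + ι (r ∧ q′) + ι (p′ ∧ r) + ι (q ∧ r′) + ι (r′ ∧ p) + ι (q′ ∧ p′) ≤ 1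
six-orders true  false true  false r     false _ _ _ _ _ with r
... | true  = ≤-refl
... | false = ≤-refl
six-orders true  false false true  true  false _ _ _ _ _ = ≤-refl
six-orders true  false false true  false true  _ _ _ _ _ = ≤-refl
six-orders true  false false true  false false _ _ _ _ _ = z≤n
six-orders true  false false false true  false _ _ _ _ _ = z≤n
six-orders true  false false false false true  _ _ _ _ _ = ≤-refl
six-orders true  false false false false false _ _ _ _ _ = z≤n
six-orders false true  false true  false r′    _ _ _ _ _ with r′
... | true  = ≤-refl
... | false = ≤-refl
six-orders false true  true  false true  false _ _ _ _ _ = ≤-refl
six-orders false true  false false true  false _ _ _ _ _ = ≤-refl
six-orders false true  true  false false true  _ _ _ _ _ = ≤-refl
six-orders false true  true  false false false _ _ _ _ _ = z≤n
six-orders false true  false false false true  _ _ _ _ _ = z≤n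
six-orders false true  false false false false _ _ _ _ _ = z≤n
six-orders false false true  false r     true  _ _ _ _ _ with r
... | true  = ≤-refl
... | false = ≤-refl
six-orders false false true  false r     false _ _ _ _ _ with r
... | true  = z≤n
... | false = z≤n
six-orders false false false true  true  r′    _ _ _ _ _ with r′
... | true  = ≤-refl
... | false = ≤-refl
six-orders false false false true  false r′    _ _ _ _ _ with r′
... | true  = z≤n
... | false = z≤n
six-orders false false false false r     r′    _ _ _ _ _ with r | r′
... | true  | true  = z≤n
... | true  | false = z≤n
... | false | true  = z≤n
... | false | false = z≤n

∧-false : ∀ {P Q : Set} (P? : Dec P) (Q? : Dec Q) → ¬ (P × Q) → does P? ∧ does Q? ≡ false
∧-false (yes p) (yes q) ¬pq = contradiction (p , q) ¬pq
∧-false (yes _) (no  _) _   = refl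
∧-false (no  _) _       _   = refl

six-increasing : ∀ {n} (a b c : Fin n) →
  ι (increasing a b c) + ι (increasing a c b) + ι (increasing b a c) + ι (increasing b c a) + ι (increasing c a b) + ι (increasing c b a) ≤ 1
six-increasing a b c = six-orders
  (does (a Fin.<? b)) (does (b Fin.<? a)) (does (b Fin.<? c)) (does (c Fin.<? b)) (does (a Fin.<? c)) (does (c Fin.<? a))
  (∧-false (a Fin.<? b) (b Fin.<? a) (λ (p , q) → Fin.<-asym p q))
  (∧-false (b Fin.<? c) (c Fin.<? b) (λ (p , q) → Fin.<-asym p q))
  (∧-false (a Fin.<? c) (c Fin.<? a) (λ (p , q) → Fin.<-asym p q))
  (∧-false ((a Fin.<? b) ×-dec (b Fin.<? c)) (c Fin.<? a) (λ ((p , q) , r) → Fin.<-asym (Fin.<-trans p q) r))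
  (∧-false ((c Fin.<? b) ×-dec (b Fin.<? a)) (a Fin.<? c) (λ ((p , q) , r) → Fin.<-asym (Fin.<-trans p q) r))

module _ {n : ℕ} (f : Fin n → Fin n → Fin n → ℕ) where

  ∑³-six : ∑³ (λ a b c → f a b c + f a c b + f b a c + f b c a + f c a b + f c b a) ≡ 6 * ∑³ f
  ∑³-six = begin
    ∑³ (λ a b c → f a b c + f a c b + f b a c + f b c a + f c a b + f c b a)
      ≡⟨ ∑³-distrib-+ (λ a b c → f a b c + f a c b + f b a c + f b c a + f c a b) (λ a b c → f c b a) ⟩
    ∑³ (λ a b c → f a b c + f a c b + f b a c + f b c a + f c a b) + ∑³ (λ a b c → f c b a)
      ≡⟨ cong₂ _+_ (∑³-distrib-+ (λ a b c → f a b c + f a c b + f b a c + f b c a) (λ a b c → f c a b))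
                   (trans (∑³-swap₁₂ (λ a b c → f c b a)) (sym (∑³-rotate f))) ⟩
    ∑³ (λ a b c → f a b c + f a c b + f b a c + f b c a) + ∑³ (λ a b c → f c a b) + ∑³ f
      ≡⟨ cong₂ (λ x y → x + y + ∑³ f) (∑³-distrib-+ (λ a b c → f a b c + f a c b + f b a c) (λ a b c → f b c a)) (sym (∑³-rotate f)) ⟩
    ∑³ (λ a b c → f a b c + f a c b + f b a c) + ∑³ (λ a b c → f b c a) + ∑³ f + ∑³ f
      ≡⟨ cong₂ (λ x y → x + y + ∑³ f + ∑³ f) (∑³-distrib-+ (λ a b c → f a b c + f a c b) (λ a b c → f b a c)) (∑³-rotate (λ a b c → f b c a)) ⟩
    ∑³ (λ a b c → f a b c + f a c b) + ∑³ (λ a b c → f b a c) + ∑³ f + ∑³ f + ∑³ f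
      ≡⟨ cong₂ (λ x y → x + y + ∑³ f + ∑³ f + ∑³ f) (∑³-distrib-+ f (λ a b c → f a c b)) (sym (∑³-swap₁₂ f)) ⟩
    ∑³ f + ∑³ (λ a b c → f a c b) + ∑³ f + ∑³ f + ∑³ f + ∑³ f
      ≡⟨ cong (λ x → ∑³ f + x + ∑³ f + ∑³ f + ∑³ f + ∑³ f) (sym (∑³-swap₂₃ f)) ⟩
    ∑³ f + ∑³ f + ∑³ f + ∑³ f + ∑³ f + ∑³ f
      ≡⟨ e (∑³ f) ⟩
    6 * ∑³ f ∎
    where
    open ≡-Reasoning
    e : ∀ x → x + x + x + x + x + x ≡ 6 * x
    e = solve-∀

module _ {n : ℕ} (P : Fin n → Fin n → Fin n → Bool)
  (sym₁₂ : ∀ a b c → P a b c ≡ P b a c) (sym₂₃ : ∀ a b c → P a b c ≡ P a c b) where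

  -- Turns the count of ordered triples used for stability into a count of 3-sets: the six orders of
  -- a triple have the same value of `P`, and at most one of them is increasing.
  6∣restrict∣≤∑³ : 6 * ∣ restrict P ∣ ≤ ∑³ (λ a b c → ι (P a b c))
  6∣restrict∣≤∑³ = begin
    6 * ∣ restrict P ∣                  ≡⟨ cong (6 *_) (∣restrict∣ P) ⟩
    6 * ∑³ f                            ≡⟨ ∑³-six f ⟨
    ∑³ (λ a b c → f a b c + f a c b + f b a c + f b c a + f c a b + f c b a)
                                        ≤⟨ ∑³-mono pointwise ⟩
    ∑³ (λ a b c → ι (P a b c)) ∎
    where
    open ≤-Reasoning
    f : Fin n → Fin n → Fin n → ℕ
    f a b c = ι (increasing a b c ∧ P a b c)
    collect : ∀ p p₁ p₂ p₃ p₄ p₅ p₆ → ι p₁ + ι p₂ + ι p₃ + ι p₄ + ι p₅ + ι p₆ ≤ 1 →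
      ι (p₁ ∧ p) + ι (p₂ ∧ p) + ι (p₃ ∧ p) + ι (p₄ ∧ p) + ι (p₅ ∧ p) + ι (p₆ ∧ p) ≤ ι p
    collect true p₁ p₂ p₃ p₄ p₅ p₆ le = ≤-trans (≤-reflexive
      (cong₂ _+_ (cong₂ _+_ (cong₂ _+_ (cong₂ _+_ (cong₂ _+_ (t p₁) (t p₂)) (t p₃)) (t p₄)) (t p₅)) (t p₆))) le
      where
      t : ∀ q → ι (q ∧ true) ≡ ι q
      t true  = refl
      t false = refl
    collect false p₁ p₂ p₃ p₄ p₅ p₆ le = ≤-reflexive
      (cong₂ _+_ (cong₂ _+_ (cong₂ _+_ (cong₂ _+_ (cong₂ _+_ (t p₁) (t p₂)) (t p₃)) (t p₄)) (t p₅)) (t p₆))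
      where
      t : ∀ q → ι (q ∧ false) ≡ 0
      t true  = refl
      t false = refl
    pointwise : ∀ a b c → f a b c + f a c b + f b a c + f b c a + f c a b + f c b a ≤ ι (P a b c)
    pointwise a b c
      rewrite sym (sym₂₃ a b c)
            | sym (sym₁₂ a b c)
            | sym (trans (sym₁₂ a b c) (sym₂₃ b a c))
            | sym (trans (sym₂₃ a b c) (sym₁₂ a c b))
            | sym (trans (trans (sym₂₃ a b c) (sym₁₂ a c b)) (sym₂₃ c a b))
      = collect (P a b c) (increasing a b c) (increasing a c b) (increasing b a c) (increasing b c a) (increasing c a b) (increasing c b a) (six-increasing a b c)

-- Edges

module _ {A : Set} where

  -- Membership in an explicit list is decidable, and through its equivalence with permutation so is
  -- `Edge`.
  orders : A → A → A → List (A × A × A)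
  orders x y z = (x , y , z) ∷ (x , z , y) ∷ (y , x , z) ∷ (y , z , x) ∷ (z , x , y) ∷ (z , y , x) ∷ []

  ↭₁ : {c z : A} → c ∷ [] ↭ z ∷ [] → c ≡ z
  ↭₁ p with refl ← ↭-singleton-inv p = refl

  ↭₂ : {b c y z : A} → b ∷ c ∷ [] ↭ y ∷ z ∷ [] → (b ≡ y × c ≡ z) ⊎ (b ≡ z × c ≡ y)
  ↭₂ {y = y} {z} p with ∈-resp-↭ p (here refl)
  ... | here refl         = inj₁ (refl , ↭₁ (drop-∷ p))
  ... | there (here refl) = inj₂ (refl , ↭₁ (drop-∷ (↭-trans p (swap y z refl))))

  ↭₃⇒orders : {a b c x y z : A} → a ∷ b ∷ c ∷ [] ↭ x ∷ y ∷ z ∷ [] → (a , b , c) ∈ₗ orders x y z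
  ↭₃⇒orders {x = x} {y} {z} p with ∈-resp-↭ p (here refl)
  ... | here refl with ↭₂ (drop-∷ p)
  ...   | inj₁ (refl , refl) = here refl
  ...   | inj₂ (refl , refl) = there (here refl)
  ↭₃⇒orders {x = x} {y} {z} p | there (here refl) with ↭₂ (drop-∷ (↭-trans p (swap x y refl)))
  ...   | inj₁ (refl , refl) = there (there (here refl))
  ...   | inj₂ (refl , refl) = there (there (there (here refl)))
  ↭₃⇒orders {x = x} {y} {z} p | there (there (here refl)) with ↭₂ (drop-∷ (↭-trans p (↭-trans (prep x (swap y z refl)) (swap x z refl))))
  ...   | inj₁ (refl , refl) = there (there (there (there (here refl))))
  ...   | inj₂ (refl , refl) = there (there (there (there (there (here refl)))))

  orders⇒↭₃ : {a b c x y z : A} → (a , b , c) ∈ₗ orders x y z → a ∷ b ∷ c ∷ [] ↭ x ∷ y ∷ z ∷ []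
  orders⇒↭₃ (here refl)                                 = refl
  orders⇒↭₃ {x = x} {y} {z} (there (here refl))         = prep x (swap z y refl)
  orders⇒↭₃ {x = x} {y} {z} (there (there (here refl))) = swap y x refl
  orders⇒↭₃ {x = x} {y} {z} (there (there (there (here refl))))                 = ↭-trans (prep y (swap z x refl)) (swap y x refl)
  orders⇒↭₃ {x = x} {y} {z} (there (there (there (there (here refl)))))         = ↭-trans (swap z x refl) (prep x (swap z y refl))
  orders⇒↭₃ {x = x} {y} {z} (there (there (there (there (there (here refl)))))) = ↭-trans (swap z y refl) (↭-trans (prep y (swap z x refl)) (swap y x refl))

module _ {n : ℕ} where

  open import Data.List.Membership.DecPropositional (≡-dec (Fin._≟_ {n}) (≡-dec (Fin._≟_ {n}) (Fin._≟_ {n}))) using () renaming (_∈?_ to _∈ₗ?_)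

  Edge? : (H : Hypergraph n) → ∀ x y z → Dec (Edge H x y z)
  Edge? H x y z = Fin.any? λ i → (i ∈? edgeSet H) ×-dec
    (let a , b , c = triple i in map′ orders⇒↭₃ ↭₃⇒orders ((x , y , z) ∈ₗ? orders a b c))

  opaque
    edge : Hypergraph n → Fin n → Fin n → Fin n → Bool
    edge H x y z = does (Edge? H x y z)

module _ {n : ℕ} (H : Hypergraph n) where

  Edge-sym₁₂ : ∀ {x y z} → Edge H x y z → Edge H y x z
  Edge-sym₁₂ {x} {y} {z} (i , i∈ , p) = i , i∈ , ↭-trans (swap y x refl) p

  Edge-sym₂₃ : ∀ {x y z} → Edge H x y z → Edge H x z y
  Edge-sym₂₃ {x} {y} {z} (i , i∈ , p) = i , i∈ , ↭-trans (prep x (swap z y refl)) p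

  opaque
    unfolding edge

    edge⇒Edge : ∀ {x y z} → edge H x y z ≡ true → Edge H x y z
    edge⇒Edge {x} {y} {z} = does-true (Edge? H x y z)

    Edge⇒edge : ∀ {x y z} → Edge H x y z → edge H x y z ≡ true
    Edge⇒edge {x} {y} {z} = dec-true (Edge? H x y z)

  edge-sym₁₂ : ∀ x y z → edge H x y z ≡ edge H y x z
  edge-sym₁₂ x y z = Bool-ext (λ e → Edge⇒edge (Edge-sym₁₂ (edge⇒Edge {x} {y} {z} e))) (λ e → Edge⇒edge (Edge-sym₁₂ (edge⇒Edge {y} {x} {z} e)))

  edge-sym₂₃ : ∀ x y z → edge H x y z ≡ edge H x z y
  edge-sym₂₃ x y z = Bool-ext (λ e → Edge⇒edge (Edge-sym₂₃ (edge⇒Edge {x} {y} {z} e))) (λ e → Edge⇒edge (Edge-sym₂₃ (edge⇒Edge {x} {z} {y} e)))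

  Edge-distinct : ∀ {x y z} → Edge H x y z → x ≢ y × y ≢ z × x ≢ z
  Edge-distinct {x} {y} {z} (i , _ , p)
    with a<b , b<c ← triple-increasing i
    with (x≢y ∷ x≢z ∷ []) ∷ (y≢z ∷ []) ∷ _ ← ↭ₛ.Unique-resp-↭ (setoid (Fin n)) (↭⇒↭ₛ (↭-sym p))
           ((Fin.<⇒≢ a<b ∷ Fin.<⇒≢ (Fin.<-trans a<b b<c) ∷ []) ∷ (Fin.<⇒≢ b<c ∷ []) ∷ [] ∷ [])
    = x≢y , y≢z , x≢z

  Edge-rainbow : (part : Fin n → Fin 3) →
    (∀ i → i ∈ edgeSet H → let a , b , c = triple i in part a ≢ part b × part b ≢ part c × part a ≢ part c) →
    ∀ {x y z} → Edge H x y z → part x ≢ part y × part y ≢ part z × part x ≢ part z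
  Edge-rainbow part tri {x} {y} {z} (i , i∈ , p)
    with a≢b , b≢c , a≢c ← tri i i∈
    with (x≢y ∷ x≢z ∷ []) ∷ (y≢z ∷ []) ∷ _ ← ↭ₛ.Unique-resp-↭ (setoid (Fin 3)) (↭⇒↭ₛ (↭-sym (map⁺ part p)))
           ((a≢b ∷ a≢c ∷ []) ∷ (b≢c ∷ []) ∷ [] ∷ [])
    = x≢y , y≢z , x≢z

  -- Any two of the vertices 1, 2, 3, 4 of F₅ lie in a common edge (the pair 34 in 345), so they
  -- would need four different parts.
  Tripartite⇒TriangleFree : Tripartite H → TriangleFree H
  Tripartite⇒TriangleFree (part , tri) (φ , _ , e₁ , e₂ , e₃)
    with 0≢1 , 1≢2 , 0≢2 ← Edge-rainbow part tri e₁
    with _ , 1≢3 , 0≢3 ← Edge-rainbow part tri e₂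
    with 2≢3 , _ ← Edge-rainbow part tri e₃
    with Fin.pigeonhole {m = 3} {n = 4} ≤-refl (λ i → part (φ (Fin.inject₁ i)))
  ... | 0F , 1F , _ , eq = 0≢1 eq
  ... | 0F , 2F , _ , eq = 0≢2 eq
  ... | 0F , 3F , _ , eq = 0≢3 eq
  ... | 1F , 2F , _ , eq = 1≢2 eq
  ... | 1F , 3F , _ , eq = 1≢3 eq
  ... | 2F , 3F , _ , eq = 2≢3 eq
  ... | 1F , 1F , s≤s () , _
  ... | suc (suc _) , 1F , s≤s () , _
  ... | suc (suc _) , 2F , s≤s (s≤s ()) , _
  ... | suc (suc (suc _)) , 3F , s≤s (s≤s (s≤s ())) , _

  extend-Edge : {S : Hypergraph n} → edgeSet H ⊆ edgeSet S → ∀ {x y z} → Edge H x y z → Edge S x y z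
  extend-Edge H⊆S (i , i∈ , p) = i , H⊆S i∈ , p

-- Containers

true≢false : ∀ {p : Bool} → p ≡ true → p ≡ false → ∀ {A : Set} → A
true≢false refl ()

module _ {n : ℕ} where

  -- Graphs are stored as subsets of the `n * n` matrix entries, so that the choices of Γ can be
  -- listed and number `2^(n * n)`.
  graph : Subset (n * n) → Fin n → Fin n → Bool
  graph G x y = Vec.lookup G (combine x y)

  encode : (Fin n → Fin n → Bool) → Subset (n * n)
  encode Γ = Vec.tabulate (λ k → let x , y = remQuot n k in Γ x y)

  graph-encode : ∀ Γ x y → graph (encode Γ) x y ≡ Γ x y
  graph-encode Γ x y = trans (lookup∘tabulate _ (combine x y))
    (cong (λ xy → Γ (proj₁ xy) (proj₂ xy)) (Fin.remQuot-combine x y))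

∧⁶-true : ∀ p q r s t {u} → p ∧ (q ∧ (r ∧ (s ∧ (t ∧ u)))) ≡ true →
  p ≡ true × q ≡ true × r ≡ true × s ≡ true × t ≡ true × u ≡ true
∧⁶-true true true true true true refl = refl , refl , refl , refl , refl , refl

-- T consists of the triples which a triangle-free H ⊇ S whose graph of unshared pairs is Γ may have outside S.
module Container {n : ℕ} (b : ℕ) (Γ : Fin n → Fin n → Bool) (S : Hypergraph n) where

  -- A necessary condition, visible from S alone, for `v` to lie in the link of `yz` in H: it then
  -- shares this link with every `f` in the S-link, so `fv` is not in Γ.
  Free : Fin n → Fin n → Fin n → Set
  Free y z v = ∀ f → edge S y z f ≡ true → Γ f v ≡ false

  Free? : ∀ y z v → Dec (Free y z v)
  Free? y z v = Fin.all? λ f → (edge S y z f Bool.≟ true) →-dec (Γ f v Bool.≟ false)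

  free : Fin n → Fin n → Fin n → Bool
  free y z v = does (Free? y z v)

  sparse : Fin n → Fin n → Fin n → Bool
  sparse x y z = does (# (λ v → Γ x v ∧ free y z v) ≤? b)

  admissible : Fin n → Fin n → Fin n → Bool
  admissible x y z = Γ x y ∧ (free y z x ∧ sparse x y z)

  opaque
    -- Requiring all six orders makes T symmetric, as the stability argument demands, and loses no
    -- edge of H outside S.
    T : Fin n → Fin n → Fin n → Bool
    T x y z = admissible x y z ∧ (admissible x z y ∧ (admissible y x z ∧ (admissible y z x ∧ (admissible z x y ∧ admissible z y x))))

  opaque
    unfolding T

    T-intro : ∀ {x y z} → admissible x y z ≡ true → admissible x z y ≡ true → admissible y x z ≡ true →
      admissible y z x ≡ true → admissible z x y ≡ true → admissible z y x ≡ true → T x y z ≡ true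
    T-intro p q r s t u = ∧-intro p (∧-intro q (∧-intro r (∧-intro s (∧-intro t u))))

    T-elim : ∀ x y z → T x y z ≡ true → admissible x y z ≡ true × admissible x z y ≡ true × admissible y x z ≡ true ×
      admissible y z x ≡ true × admissible z x y ≡ true × admissible z y x ≡ true
    T-elim x y z = ∧⁶-true (admissible x y z) (admissible x z y) (admissible y x z) (admissible y z x) (admissible z x y)

  T-sym₁₂ : ∀ x y z → T x y z ≡ T y x z
  T-sym₁₂ x y z = Bool-ext (flip x y z) (flip y x z)
    where
    flip : ∀ x y z → T x y z ≡ true → T y x z ≡ true
    flip x y z eq = let p , q , r , s , t , u = T-elim x y z eq in T-intro {y} {x} {z} r s p q u t

  T-sym₂₃ : ∀ x y z → T x y z ≡ T x z y
  T-sym₂₃ x y z = Bool-ext (flip x y z) (flip x z y)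
    where
    flip : ∀ x y z → T x y z ≡ true → T x z y ≡ true
    flip x y z eq = let p , q , r , s , t , u = T-elim x y z eq in T-intro {x} {z} {y} q p t u r s

  T⇒Γ : ∀ {x y z} → T x y z ≡ true → Γ x y ≡ true
  T⇒Γ {x} {y} {z} eq = proj₁ (∧-true {Γ x y} (proj₁ (T-elim x y z eq)))

  -- The T-link of `yz` consists of free vertices, among which `sparse` bounds the Γ-degree of `x`.
  -- Stating `sparse` with `free` instead of T avoids a circular definition.
  local : ∀ {x y z} → T x y z ≡ true → # (λ v → Γ x v ∧ T y z v) ≤ b
  local {x} {y} {z} eq = ≤-trans (#-mono inner)
    (does-true (# (λ v → Γ x v ∧ free y z v) ≤? b) (proj₂ (∧-true {free y z x} (proj₂ (∧-true {Γ x y} (proj₁ (T-elim x y z eq)))))))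
    where
    inner : ∀ v → Γ x v ∧ T y z v ≡ true → Γ x v ∧ free y z v ≡ true
    inner v eq′ = let γ , t = ∧-true {Γ x v} eq′ ; _ , _ , _ , _ , k , _ = T-elim y z v t in
      ∧-intro γ (proj₁ (∧-true {free y z v} (proj₂ (∧-true {Γ v y} k))))

  open Stability Γ T T-sym₁₂ T-sym₂₃ (λ {x} {y} {z} → T⇒Γ {x} {y} {z}) b (λ {x} {y} {z} → local {x} {y} {z}) public
    hiding (T-rotate)

-- Fingerprints

#-singleton : ∀ {n} (c : Fin n) → # (λ v → does (v Fin.≟ c)) ≡ 1
#-singleton {suc n} zero    = cong suc (trans (sum-const n 0) (*-zeroʳ n))
#-singleton {suc n} (suc c) = #-singleton c

ι-∨ : ∀ p q → ι (p ∨ q) ≤ ι p + ι q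
ι-∨ true  q = s≤s z≤n
ι-∨ false q = ≤-refl

#-∨ : ∀ {n} (p q : Fin n → Bool) → # (λ v → p v ∨ q v) ≤ # p + # q
#-∨ p q = ≤-trans (sum-mono-≤ (λ v → ι-∨ (p v) (q v))) (≤-reflexive (∑-distrib-+ (λ v → ι (p v)) (λ v → ι (q v))))

∧-projˡ : ∀ {p q} → p ∧ q ≡ true → p ≡ true
∧-projˡ eq = proj₁ (∧-true eq)

module Greedy {n : ℕ} (Γ : Fin n → Fin n → Bool) (E : Fin n → Bool) (b w : ℕ) (n<w[b+1] : n < w * suc b) where

  Avoids : (Fin n → Bool) → Fin n → Set
  Avoids F d = ∀ f → E f ∧ F f ≡ true → Γ f d ≡ false

  Avoids? : ∀ F d → Dec (Avoids F d)
  Avoids? F d = Fin.all? λ f → (E f ∧ F f Bool.≟ true) →-dec (Γ f d Bool.≟ false)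

  avoids : (Fin n → Bool) → Fin n → Bool
  avoids F d = does (Avoids? F d)

  Fingerprint : Set
  Fingerprint = Σ (Fin n → Bool) λ F → # (λ c → E c ∧ F c) ≤ w × (∀ c → E c ≡ true → # (λ d → Γ c d ∧ avoids F d) ≤ b)

  insert : (Fin n → Bool) → Fin n → Fin n → Bool
  insert F c v = F v ∨ does (v Fin.≟ c)

  #insert : ∀ F c → # (insert F c) ≤ suc (# F)
  #insert F c = ≤-trans (#-∨ F (λ v → does (v Fin.≟ c))) (≤-reflexive (trans (cong (# F +_) (#-singleton c)) (+-comm (# F) 1)))

  -- A vertex that avoids the enlarged set is not a Γ-neighbour of `c`; hence the survivors and the
  -- former avoiders adjacent to `c` are disjoint sets of former avoiders.
  avoids-insert : ∀ F c → E c ≡ true → ∀ d → ι (avoids (insert F c) d) + ι (Γ c d ∧ avoids F d) ≤ ι (avoids F d)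
  avoids-insert F c Ec d = case (avoids (insert F c) d) (Γ c d) (avoids F d)
    (λ eq → dec-true (Avoids? F d) λ f ef → does-true (Avoids? (insert F c) d) eq f
      (let e , m = ∧-true {E f} ef in ∧-intro e (cong (_∨ does (f Fin.≟ c)) m)))
    (λ eq → does-true (Avoids? (insert F c) d) eq c (∧-intro Ec (trans (cong (F c ∨_) (dec-true (c Fin.≟ c) refl)) (∨-zeroʳ (F c)))))
    where
    case : ∀ p γ q → (p ≡ true → q ≡ true) → (p ≡ true → γ ≡ false) → ι p + ι (γ ∧ q) ≤ ι q
    case true  γ q i₁ i₂ rewrite i₁ refl | i₂ refl = ≤-refl
    case false true  q _ _ = ≤-refl
    case false false q _ _ = z≤n

  -- Every inserted vertex eliminates at least `b + 1` avoiders, so the budget inequality is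
  -- invariant, and `n < w (b + 1)` keeps `# F` below `w`. The fuel bounds the number of avoiders,
  -- which strictly decreases.
  grow : ∀ fuel F → # (avoids F) < fuel → # F * suc b + # (avoids F) ≤ n → Fingerprint
  grow (suc fuel) F (s≤s enough) budget
    with Fin.any? (λ c → (E c Bool.≟ true) ×-dec (suc b ≤? # (λ d → Γ c d ∧ avoids F d)))
  ... | yes (c , Ec , large) = grow fuel (insert F c)
    (≤-trans (≤-trans (≤-trans (s≤s (m≤m+n _ b)) (≤-reflexive (sym (+-suc _ b)))) shrink) enough)
    (begin
      # (insert F c) * suc b + # (avoids (insert F c))       ≤⟨ +-monoˡ-≤ _ (*-monoˡ-≤ (suc b) (#insert F c)) ⟩
      suc b + # F * suc b + # (avoids (insert F c))          ≡⟨ e (suc b) (# F * suc b) (# (avoids (insert F c))) ⟩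
      # F * suc b + (# (avoids (insert F c)) + suc b)        ≤⟨ +-monoʳ-≤ (# F * suc b) shrink ⟩
      # F * suc b + # (avoids F)                             ≤⟨ budget ⟩
      n ∎)
    where
    open ≤-Reasoning
    e : ∀ x y z → x + y + z ≡ y + (z + x)
    e = solve-∀
    shrink : # (avoids (insert F c)) + suc b ≤ # (avoids F)
    shrink = begin
      # (avoids (insert F c)) + suc b
        ≤⟨ +-monoʳ-≤ _ large ⟩
      # (avoids (insert F c)) + # (λ d → Γ c d ∧ avoids F d)
        ≡⟨ ∑-distrib-+ (λ d → ι (avoids (insert F c) d)) (λ d → ι (Γ c d ∧ avoids F d)) ⟨
      ∑[ d < n ] (ι (avoids (insert F c) d) + ι (Γ c d ∧ avoids F d))
        ≤⟨ sum-mono-≤ (avoids-insert F c Ec) ⟩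
      # (avoids F) ∎
  ... | no ¬large = F
    , ≤-trans (#-mono {p = λ c → E c ∧ F c} {F} (λ c eq → proj₂ (∧-true {E c} eq)))
        (<⇒≤ (*-cancelʳ-< (suc b) (# F) w (≤-<-trans (≤-trans (m≤m+n _ _) budget) n<w[b+1])))
    , λ c Ec → ≮⇒≥ (λ large → ¬large (c , Ec , large))

  fingerprint : Fingerprint
  fingerprint = grow (suc n) (λ _ → false) (s≤s (#≤n (avoids (λ _ → false))))
    (≤-trans (≤-reflexive (cong (λ t → t * suc b + # (avoids (λ _ → false))) (trans (sum-const n 0) (*-zeroʳ n)))) (#≤n (avoids (λ _ → false))))

five : ∀ {A : Set} → A → A → A → A → A → Fin 5 → A
five p q x y z 0F = p
five p q x y z 1F = q
five p q x y z 2F = x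
five p q x y z 3F = y
five p q x y z 4F = z

module _ {A : Set} {p q x y z : A} (p≢q : p ≢ q) (p≢x : p ≢ x) (p≢y : p ≢ y) (p≢z : p ≢ z) (q≢x : q ≢ x) (q≢y : q ≢ y) (q≢z : q ≢ z) (x≢y : x ≢ y) (x≢z : x ≢ z) (y≢z : y ≢ z) where

  five-injective : ∀ {i j} → five p q x y z i ≡ five p q x y z j → i ≡ j
  five-injective {0F} {0F} eq = refl
  five-injective {0F} {1F} eq = contradiction eq p≢q
  five-injective {0F} {2F} eq = contradiction eq p≢x
  five-injective {0F} {3F} eq = contradiction eq p≢y
  five-injective {0F} {4F} eq = contradiction eq p≢z
  five-injective {1F} {0F} eq = contradiction (sym eq) p≢q
  five-injective {1F} {1F} eq = refl
  five-injective {1F} {2F} eq = contradiction eq q≢x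
  five-injective {1F} {3F} eq = contradiction eq q≢y
  five-injective {1F} {4F} eq = contradiction eq q≢z
  five-injective {2F} {0F} eq = contradiction (sym eq) p≢x
  five-injective {2F} {1F} eq = contradiction (sym eq) q≢x
  five-injective {2F} {2F} eq = refl
  five-injective {2F} {3F} eq = contradiction eq x≢y
  five-injective {2F} {4F} eq = contradiction eq x≢z
  five-injective {3F} {0F} eq = contradiction (sym eq) p≢y
  five-injective {3F} {1F} eq = contradiction (sym eq) q≢y
  five-injective {3F} {2F} eq = contradiction (sym eq) x≢y
  five-injective {3F} {3F} eq = refl
  five-injective {3F} {4F} eq = contradiction eq y≢z
  five-injective {4F} {0F} eq = contradiction (sym eq) p≢z
  five-injective {4F} {1F} eq = contradiction (sym eq) q≢z
  five-injective {4F} {2F} eq = contradiction (sym eq) x≢z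
  five-injective {4F} {3F} eq = contradiction (sym eq) y≢z
  five-injective {4F} {4F} eq = refl


-- Links of a triangle-free hypergraph and their fingerprint

module _ {n : ℕ} {H : Hypergraph n} (free : TriangleFree H) where

  -- The pattern pqx, pqy, xyz is F₅ unless z is p or q.
  shared-pair : ∀ {p q x y z} → Edge H p q x → Edge H p q y → Edge H x y z → z ≡ p ⊎ z ≡ q
  shared-pair {p} {q} {x} {y} {z} e₁ e₂ e₃ with z Fin.≟ p | z Fin.≟ q
  ... | yes z≡p | _       = inj₁ z≡p
  ... | no  _   | yes z≡q = inj₂ z≡q
  ... | no  z≢p | no  z≢q
    with p≢q , q≢x , p≢x ← Edge-distinct H e₁
       | _ , q≢y , p≢y ← Edge-distinct H e₂
       | x≢y , y≢z , x≢z ← Edge-distinct H e₃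
    = contradiction (five p q x y z , (λ {i} {j} → five-injective p≢q p≢x p≢y (λ eq → z≢p (sym eq)) q≢x q≢y (λ eq → z≢q (sym eq)) x≢y x≢z y≢z {i} {j}) , e₁ , e₂ , e₃) free

module _ {n : ℕ} (H : Hypergraph n) where

  Shared : Fin n → Fin n → Set
  Shared x y = Σ (Fin n) λ p → Σ (Fin n) λ q → edge H p q x ≡ true × edge H p q y ≡ true

  Shared? : ∀ x y → Dec (Shared x y)
  Shared? x y = Fin.any? λ p → Fin.any? λ q → (edge H p q x Bool.≟ true) ×-dec (edge H p q y Bool.≟ true)

  opaque
    unshared : Subset (n * n)
    unshared = encode (λ x y → not (does (Shared? x y)))

  private
    Γ : Fin n → Fin n → Bool
    Γ = graph unshared

  opaque
    unfolding unshared

    Shared⇒¬Γ : ∀ {x y} → Shared x y → Γ x y ≡ false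
    Shared⇒¬Γ {x} {y} s = trans (graph-encode _ x y) (cong not (dec-true (Shared? x y) s))

    ¬Γ⇒Shared : ∀ {x y} → Γ x y ≡ false → Shared x y
    ¬Γ⇒Shared {x} {y} eq = does-true (Shared? x y) (not-false (trans (sym (graph-encode _ x y)) eq))
      where
      not-false : ∀ {p} → not p ≡ false → p ≡ true
      not-false {true} _ = refl

  module _ (free : TriangleFree H) (b w : ℕ) (2≤w : 2 ≤ w) (n<w[b+1] : n < w * suc b) where

    -- The second component marks the whole link of a pair outside Γ: its edges have to go into the
    -- fingerprint, because triples of T have all their pairs in Γ.
    Mark : Fin n → Fin n → Set
    Mark x y = Σ (Greedy.Fingerprint Γ (edge H x y) b w n<w[b+1]) λ F → Γ x y ≡ false → ∀ z → edge H x y z ≡ true → proj₁ F z ≡ true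

    -- By `shared-pair` the link of `xy` is contained in the witnessing pair `{p, q}`, so all of it
    -- can be marked; this is the use of `2 ≤ w`. A link vertex `c` is then itself a mark, and no
    -- Γ-neighbour of `c` avoids the marks.
    mark-shared : ∀ x y → Γ x y ≡ false → Mark x y
    mark-shared x y ¬γ with p , q , e₁ , e₂ ← ¬Γ⇒Shared {x} {y} ¬γ =
      ((λ _ → true) , few , empty) , λ _ _ _ → refl
      where
      open Greedy Γ (edge H x y) b w n<w[b+1]
      few : # (λ c → edge H x y c ∧ true) ≤ w
      few = ≤-trans (#-mono {q = λ c → does (c Fin.≟ p) ∨ does (c Fin.≟ q)} in-pq)
        (≤-trans (#-∨ (λ c → does (c Fin.≟ p)) (λ c → does (c Fin.≟ q)))
          (≤-trans (≤-reflexive (cong₂ _+_ (#-singleton p) (#-singleton q))) 2≤w))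
        where
        in-pq : ∀ c → edge H x y c ∧ true ≡ true → does (c Fin.≟ p) ∨ does (c Fin.≟ q) ≡ true
        in-pq c eq with shared-pair free (edge⇒Edge H {p} {q} {x} e₁) (edge⇒Edge H {p} {q} {y} e₂) (edge⇒Edge H {x} {y} {c} (∧-projˡ eq))
        ... | inj₁ c≡p = cong (_∨ does (c Fin.≟ q)) (dec-true (c Fin.≟ p) c≡p)
        ... | inj₂ c≡q = trans (cong (does (c Fin.≟ p) ∨_) (dec-true (c Fin.≟ q) c≡q)) (∨-zeroʳ _)
      empty : ∀ c → edge H x y c ≡ true → # (λ d → Γ c d ∧ avoids (λ _ → true) d) ≤ b
      empty c e = ≤-trans (#-mono {q = λ _ → false} none) (≤-trans (≤-reflexive (trans (sum-const n 0) (*-zeroʳ n))) z≤n)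
        where
        none : ∀ d → Γ c d ∧ avoids (λ _ → true) d ≡ true → false ≡ true
        none d eq = let γ , a = ∧-true {Γ c d} eq in
          true≢false γ (does-true (Avoids? (λ _ → true) d) a c (∧-intro e refl))

    mark-unshared : ∀ x y → Γ x y ≡ true → Mark x y
    mark-unshared x y γ = Greedy.fingerprint Γ (edge H x y) b w n<w[b+1] , λ ¬γ → true≢false γ ¬γ

    mark : ∀ x y → Mark x y
    mark x y = by-cases (Γ x y) refl
      where
      by-cases : ∀ γ → Γ x y ≡ γ → Mark x y
      by-cases true  = mark-unshared x y
      by-cases false = mark-shared x y

    opaque
      marked : Fin n → Fin n → Fin n → Bool
      marked x y = proj₁ (proj₁ (mark x y))

      #marked : ∀ x y → # (λ z → edge H x y z ∧ marked x y z) ≤ w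
      #marked x y = proj₁ (proj₂ (proj₁ (mark x y)))

      marked-sparse : ∀ {x y z} → edge H x y z ≡ true →
        # (λ v → Γ z v ∧ does (Greedy.Avoids? Γ (edge H x y) b w n<w[b+1] (marked x y) v)) ≤ b
      marked-sparse {x} {y} {z} = proj₂ (proj₂ (proj₁ (mark x y))) z

      ¬Γ⇒marked : ∀ {x y z} → Γ x y ≡ false → edge H x y z ≡ true → marked x y z ≡ true
      ¬Γ⇒marked {x} {y} {z} ¬γ = proj₂ (mark x y) ¬γ z

    -- Marks belong to an ordered pair and a vertex of its link, but the fingerprint consists of
    -- 3-sets; an edge is kept if any of its orders is marked.
    marked⁶ : Fin n → Fin n → Fin n → Bool
    marked⁶ x y z = marked x y z ∨ (marked x z y ∨ (marked y x z ∨ (marked y z x ∨ (marked z x y ∨ marked z y x))))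

    marked⇒marked⁶ : ∀ {a b c x y z} → (a , b , c) ∈ₗ orders x y z → marked a b c ≡ true → marked⁶ x y z ≡ true
    marked⇒marked⁶ {x = x} {y} {z} o m = six (marked x y z) (marked x z y) (marked y x z) (marked y z x) (marked z x y) (marked z y x) (position o m)
      where
      position : ∀ {a b c} → (a , b , c) ∈ₗ orders x y z → marked a b c ≡ true →
        marked x y z ≡ true ⊎ marked x z y ≡ true ⊎ marked y x z ≡ true ⊎ marked y z x ≡ true ⊎ marked z x y ≡ true ⊎ marked z y x ≡ true
      position (here refl) m = inj₁ m
      position (there (here refl)) m = inj₂ (inj₁ m)
      position (there (there (here refl))) m = inj₂ (inj₂ (inj₁ m))
      position (there (there (there (here refl)))) m = inj₂ (inj₂ (inj₂ (inj₁ m)))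
      position (there (there (there (there (here refl))))) m = inj₂ (inj₂ (inj₂ (inj₂ (inj₁ m))))
      position (there (there (there (there (there (here refl)))))) m = inj₂ (inj₂ (inj₂ (inj₂ (inj₂ m))))
      six : ∀ p q r s t u → p ≡ true ⊎ q ≡ true ⊎ r ≡ true ⊎ s ≡ true ⊎ t ≡ true ⊎ u ≡ true → p ∨ (q ∨ (r ∨ (s ∨ (t ∨ u)))) ≡ true
      six true  q r s t u _ = refl
      six false true  r s t u _ = refl
      six false false true  s t u _ = refl
      six false false false true  t u _ = refl
      six false false false false true  u _ = refl
      six false false false false false true _ = refl
      six false false false false false false (inj₂ (inj₂ (inj₂ (inj₂ (inj₁ ())))))
      six false false false false false false (inj₂ (inj₂ (inj₂ (inj₂ (inj₂ ())))))

    S₀ : Hypergraph n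
    S₀ = hypergraph (edgeSet H ∩ restrict marked⁶)

    marked⇒S₀ : ∀ {x y z} → edge H x y z ≡ true → marked x y z ≡ true → Edge S₀ x y z
    marked⇒S₀ {x} {y} {z} e m with i , i∈H , p ← edge⇒Edge H {x} {y} {z} e =
      i , x∈p∩q⁺ (i∈H , ∈-restrict⁺ marked⁶ (marked⇒marked⁶ (↭₃⇒orders p) m)) , p

    S₀⊆H : edgeSet S₀ ⊆ edgeSet H
    S₀⊆H = p∩q⊆p (edgeSet H) (restrict marked⁶)

    ∣S₀∣ : edges S₀ ≤ 6 * (n * (n * w))
    ∣S₀∣ = begin
      ∣ edgeSet H ∩ restrict marked⁶ ∣
        ≤⟨ p⊆q⇒∣p∣≤∣q∣ (λ {i} i∈ → let i∈H , i∈m = x∈p∩q⁻ (edgeSet H) (restrict marked⁶) i∈ in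
             ∈-restrict⁺ (λ x y z → edge H x y z ∧ marked⁶ x y z) (∧-intro (Edge⇒edge H (i , i∈H , refl)) (∈-restrict⁻ marked⁶ i∈m))) ⟩
      ∣ restrict (λ x y z → edge H x y z ∧ marked⁶ x y z) ∣
        ≤⟨ ∣restrict∣≤∑³ (λ x y z → edge H x y z ∧ marked⁶ x y z) ⟩
      ∑³ (λ x y z → ι (edge H x y z ∧ marked⁶ x y z))
        ≤⟨ ∑³-mono pointwise ⟩
      ∑³ (λ x y z → f x y z + f x z y + f y x z + f y z x + f z x y + f z y x)
        ≡⟨ ∑³-six f ⟩
      6 * ∑³ f
        ≤⟨ *-monoʳ-≤ 6 (sum-bounded (n * w) (λ x → sum-bounded w (#marked x))) ⟩
      6 * (n * (n * w)) ∎
      where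
      open ≤-Reasoning
      f : Fin n → Fin n → Fin n → ℕ
      f x y z = ι (edge H x y z ∧ marked x y z)
      six : ∀ e p q r s t u → ι (e ∧ (p ∨ (q ∨ (r ∨ (s ∨ (t ∨ u)))))) ≤ ι (e ∧ p) + ι (e ∧ q) + ι (e ∧ r) + ι (e ∧ s) + ι (e ∧ t) + ι (e ∧ u)
      six false p q r s t u = z≤n
      six true p q r s t u = begin
        ι (p ∨ (q ∨ (r ∨ (s ∨ (t ∨ u)))))
          ≤⟨ ≤-trans (ι-∨ p _) (+-monoʳ-≤ (ι p) (≤-trans (ι-∨ q _) (+-monoʳ-≤ (ι q) (≤-trans (ι-∨ r _) (+-monoʳ-≤ (ι r) (≤-trans (ι-∨ s _) (+-monoʳ-≤ (ι s) (ι-∨ t u)))))))) ⟩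
        ι p + (ι q + (ι r + (ι s + (ι t + ι u))))
          ≡⟨ e (ι p) (ι q) (ι r) (ι s) (ι t) (ι u) ⟩
        ι p + ι q + ι r + ι s + ι t + ι u ∎
        where
        e : ∀ p q r s t u → p + (q + (r + (s + (t + u)))) ≡ p + q + r + s + t + u
        e = solve-∀
      pointwise : ∀ x y z → ι (edge H x y z ∧ marked⁶ x y z) ≤ f x y z + f x z y + f y x z + f y z x + f z x y + f z y x
      pointwise x y z = subst (λ k → ι (edge H x y z ∧ marked⁶ x y z) ≤ k)
        (cong₂ _+_ (cong₂ _+_ (cong₂ _+_ (cong₂ _+_ (cong (f x y z +_)
          (sw (marked x z y) s₁)) (sw (marked y x z) s₂)) (sw (marked y z x) s₃)) (sw (marked z x y) s₄)) (sw (marked z y x) s₅))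
        (six (edge H x y z) (marked x y z) (marked x z y) (marked y x z) (marked y z x) (marked z x y) (marked z y x))
        where
        sw : ∀ {e e′} m → e ≡ e′ → ι (e ∧ m) ≡ ι (e′ ∧ m)
        sw m refl = refl
        s₁ : edge H x y z ≡ edge H x z y
        s₁ = edge-sym₂₃ H x y z
        s₂ : edge H x y z ≡ edge H y x z
        s₂ = edge-sym₁₂ H x y z
        s₃ : edge H x y z ≡ edge H y z x
        s₃ = trans s₂ (edge-sym₂₃ H y x z)
        s₄ : edge H x y z ≡ edge H z x y
        s₄ = trans s₁ (edge-sym₁₂ H x z y)
        s₅ : edge H x y z ≡ edge H z y x
        s₅ = trans s₄ (edge-sym₂₃ H z x y)

    module _ (S : Hypergraph n) (S₀⊆S : edgeSet S₀ ⊆ edgeSet S) (S⊆H : edgeSet S ⊆ edgeSet H) where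

      open Container b Γ S using (T; T-intro; admissible; Free?; sparse)

      Edge-S⇒H : ∀ x y z → edge S x y z ≡ true → edge H x y z ≡ true
      Edge-S⇒H x y z e = Edge⇒edge H (extend-Edge S S⊆H (edge⇒Edge S {x} {y} {z} e))

      -- If `xy` were outside Γ, the edge would be marked and hence in S. It is free because each
      -- `f` in the S-link of `yz` shares that link with `x`. It is sparse because S contains all
      -- marked edges, so that free vertices avoid the marks of `yz`.
      admissible-H : ∀ {i x y z} → i ∈ edgeSet H → ¬ i ∈ edgeSet S →
        (x , y , z) ∈ₗ (let a , b , c = triple i in orders a b c) → admissible x y z ≡ true
      admissible-H {i} {x} {y} {z} i∈H i∉S o = ∧-intro Γ-xy (∧-intro free-x sparse-x)
        where
        E : edge H x y z ≡ true
        E = Edge⇒edge H (i , i∈H , orders⇒↭₃ o)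
        E′ : edge H y z x ≡ true
        E′ = Edge⇒edge H (Edge-sym₂₃ H (Edge-sym₁₂ H (edge⇒Edge H {x} {y} {z} E)))
        Γ-xy : Γ x y ≡ true
        Γ-xy with Γ x y in eq
        ... | true  = refl
        ... | false = contradiction (S₀⊆S (x∈p∩q⁺ (i∈H , ∈-restrict⁺ marked⁶ (marked⇒marked⁶ o (¬Γ⇒marked eq E))))) i∉S
        free-x : does (Free? y z x) ≡ true
        free-x = dec-true (Free? y z x) λ f e → Shared⇒¬Γ (y , z , Edge-S⇒H y z f e , E′)
        sparse-x : sparse x y z ≡ true
        sparse-x = dec-true (_ ≤? b) (≤-trans
          (#-mono {q = λ v → Γ x v ∧ does (Greedy.Avoids? Γ (edge H y z) b w n<w[b+1] (marked y z) v)} λ v eq →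
            let γ , a = ∧-true {Γ x v} eq in
            ∧-intro γ (dec-true (Greedy.Avoids? Γ (edge H y z) b w n<w[b+1] (marked y z) v) λ f em →
              let e , m = ∧-true {edge H y z f} em in
              does-true (Free? y z v) a f (Edge⇒edge S (extend-Edge S₀ S₀⊆S (marked⇒S₀ e m)))))
          (marked-sparse E′))

      H─S⊆T : edgeSet H ─ edgeSet S ⊆ restrict T
      H─S⊆T {i} i∈ = ∈-restrict⁺ T (T-intro
        (adm (here refl)) (adm (there (here refl))) (adm (there (there (here refl))))
        (adm (there (there (there (here refl))))) (adm (there (there (there (there (here refl))))))
        (adm (there (there (there (there (there (here refl))))))))
        where
        adm : ∀ {x y z} → (x , y , z) ∈ₗ (let a , b , c = triple i in orders a b c) → admissible x y z ≡ true
        adm = admissible-H (p─q⊆p (edgeSet H) (edgeSet S) i∈) (λ i∈S → ∈─⇒∉ (edgeSet H) (edgeSet S) i∈ i∈S)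

-- The balanced complete tripartite hypergraph

window : ∀ {n} → ℕ → ℕ → Fin n → Bool
window lo l v = not (toℕ v <ᵇ lo) ∧ (toℕ v <ᵇ lo + l)

#window : ∀ {n} lo l → lo + l ≤ n → l ≤ # {n} (window lo l)
#window          zero     zero    le       = z≤n
#window {suc n}  zero     (suc l) (s≤s le) = s≤s (#window zero l le)
#window {suc n}  (suc lo) l       (s≤s le) = #window lo l le

window⁻ : ∀ {n} lo l {v : Fin n} → window lo l v ≡ true → lo ≤ toℕ v × toℕ v < lo + l
window⁻ lo l {v} eq = let p , q = ∧-true {not (toℕ v <ᵇ lo)} eq in
  ≮⇒≥ (does-false (toℕ v <? lo) (not-true p)) , does-true (toℕ v <? lo + l) q
  where
  not-true : ∀ {p} → not p ≡ true → p ≡ false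
  not-true {false} _ = refl

ι-∧ : ∀ p q → ι (p ∧ q) ≡ ι p * ι q
ι-∧ true  q = sym (+-identityʳ (ι q))
ι-∧ false q = refl

∑³-product : ∀ {n} (p q r : Fin n → Bool) → ∑³ (λ a b c → ι (p a ∧ (q b ∧ r c))) ≡ # p * (# q * # r)
∑³-product {n} p q r = begin
  ∑³ (λ a b c → ι (p a ∧ (q b ∧ r c)))
    ≡⟨ ∑³-cong (λ a b c → trans (ι-∧ (p a) (q b ∧ r c)) (cong (ι (p a) *_) (ι-∧ (q b) (r c)))) ⟩
  ∑³ (λ a b c → ι (p a) * (ι (q b) * ι (r c)))
    ≡⟨ sum-cong-≗ (λ a → sum-cong-≗ (λ b → trans (sym (*-distribˡ-sum (ι (p a)) (λ c → ι (q b) * ι (r c))))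
         (cong (ι (p a) *_) (sym (*-distribˡ-sum (ι (q b)) (λ c → ι (r c))))))) ⟩
  ∑[ a < n ] ∑[ b < n ] (ι (p a) * (ι (q b) * # r))
    ≡⟨ sum-cong-≗ (λ a → trans (sym (*-distribˡ-sum (ι (p a)) (λ b → ι (q b) * # r)))
         (cong (ι (p a) *_) (sym (*-distribʳ-sum (# r) (λ b → ι (q b)))))) ⟩
  ∑[ a < n ] (ι (p a) * (# q * # r))
    ≡⟨ *-distribʳ-sum (# q * # r) (λ a → ι (p a)) ⟨
  # p * (# q * # r) ∎
  where open ≡-Reasoning

module Balanced {n : ℕ} (k : ℕ) (3k≤n : k + k + k ≤ n) where

  -- The parts are three consecutive intervals of length `k`, so that transversal triples are
  -- automatically increasing. Vertices from `3k` on lie in no triple.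
  transversal : Fin n → Fin n → Fin n → Bool
  transversal a b c = window 0 k a ∧ (window k k b ∧ window (k + k) k c)

  transversal⁻ : ∀ {a b c} → transversal a b c ≡ true →
    toℕ a < k × (k ≤ toℕ b × toℕ b < k + k) × k + k ≤ toℕ c
  transversal⁻ {a} {b} {c} eq = let p , eq′ = ∧-true {window 0 k a} eq ; q , r = ∧-true {window k k b} eq′ in
    proj₂ (window⁻ 0 k p) , window⁻ k k q , proj₁ (window⁻ (k + k) k r)

  k³≤∣transversal∣ : k * (k * k) ≤ ∣ restrict transversal ∣
  k³≤∣transversal∣ = begin
    k * (k * k)
      ≤⟨ *-mono-≤ (#window {n} 0 k (≤-trans (≤-trans (m≤m+n k k) (m≤m+n (k + k) k)) 3k≤n))
           (*-mono-≤ (#window {n} k k (≤-trans (m≤m+n (k + k) k) 3k≤n)) (#window {n} (k + k) k 3k≤n)) ⟩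
    # {n} (window 0 k) * (# {n} (window k k) * # {n} (window (k + k) k))
      ≡⟨ ∑³-product {n} (window 0 k) (window k k) (window (k + k) k) ⟨
    ∑³ (λ a b c → ι (transversal a b c))
      ≤⟨ ∑³-mono (λ a b c → absorb (increasing a b c) (transversal a b c) (ordered a b c)) ⟩
    ∑³ (λ a b c → ι (increasing a b c ∧ transversal a b c))
      ≡⟨ ∣restrict∣ transversal ⟨
    ∣ restrict transversal ∣ ∎
    where
    open ≤-Reasoning
    absorb : ∀ p q → (q ≡ true → p ≡ true) → ι q ≤ ι (p ∧ q)
    absorb p false _   = z≤n
    absorb p true  imp rewrite imp refl = ≤-refl
    ordered : ∀ a b c → transversal a b c ≡ true → increasing a b c ≡ true
    ordered a b c eq = let a< , (b≥ , b<) , c≥ = transversal⁻ {a} {b} {c} eq in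
      ∧-intro (dec-true (a Fin.<? b) (<-≤-trans a< b≥)) (dec-true (b Fin.<? c) (<-≤-trans b< c≥))

  part : Fin n → Fin 3
  part v = if toℕ v <ᵇ k then 0F else (if toℕ v <ᵇ k + k then 1F else 2F)

  part-0 : ∀ {v} → toℕ v < k → part v ≡ 0F
  part-0 {v} lt rewrite dec-true (toℕ v <? k) lt = refl

  part-1 : ∀ {v} → k ≤ toℕ v → toℕ v < k + k → part v ≡ 1F
  part-1 {v} ge lt rewrite dec-false (toℕ v <? k) (≤⇒≯ ge) | dec-true (toℕ v <? k + k) lt = refl

  part-2 : ∀ {v} → k + k ≤ toℕ v → part v ≡ 2F
  part-2 {v} ge rewrite dec-false (toℕ v <? k) (≤⇒≯ (≤-trans (m≤m+n k k) ge)) | dec-false (toℕ v <? k + k) (≤⇒≯ ge) = refl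

  transversal-tripartite : (H : Hypergraph n) → edgeSet H ⊆ restrict transversal → Tripartite H
  transversal-tripartite H H⊆ = part , λ i i∈ →
    let a< , (b≥ , b<) , c≥ = transversal⁻ (∈-restrict⁻ transversal (H⊆ i∈))
        0≡ = part-0 a< ; 1≡ = part-1 b≥ b< ; 2≡ = part-2 c≥
    in (λ eq → 0≢1 (trans (sym 0≡) (trans eq 1≡)))
     , (λ eq → 1≢2 (trans (sym 1≡) (trans eq 2≡)))
     , (λ eq → 0≢2 (trans (sym 0≡) (trans eq 2≡)))
    where
    0≢1 : _≢_ {A = Fin 3} 0F 1F
    0≢1 ()
    1≢2 : _≢_ {A = Fin 3} 1F 2F
    1≢2 ()
    0≢2 : _≢_ {A = Fin 3} 0F 2F
    0≢2 ()

-- Counting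

Far : ∀ {n} → Hypergraph n → ℕ → Set
Far {n} H d = ∀ part → d ≤ ∣ edgeSet H ─ restrict {n} (rainbow part) ∣

module Codes {n : ℕ} (b e m s j : ℕ) where

  N : ℕ
  N = length (triples n)

  module _ (G : Subset (n * n)) (S : Subset N) where

    open Container {n} b (graph {n} G) (hypergraph {n} S)

    Dense : Set
    Dense = Σ (Fin n) λ x → Σ (Fin n) λ y → Σ (Fin n) λ z → T x y z ≡ true × n ≤ μ x y z + e

    Dense? : Dec Dense
    Dense? = Fin.any? λ x → Fin.any? λ y → Fin.any? λ z → (T x y z Bool.≟ true) ×-dec (n ≤? μ x y z + e)

    nonrainbow : Dense → Subset N
    nonrainbow (x , y , z , t , _) = restrict (λ u v w → T u v w ∧ not (rainbow (Partition.part {x} {y} {z} t) u v w))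

    sparse-codes : List (Subset N)
    sparse-codes = map (S ∪_) (choose (restrict T) (m ∸ s))

    -- Only the `j` exceptional edges `Q` are restricted to a small set. The others range over all
    -- triples, a loss that `count-dense` affords.
    dense-codes : Dense → List (Subset N)
    dense-codes dense = concatMap (λ Q → map (λ R → S ∪ (Q ∪ R)) (choose ⊤ (m ∸ s ∸ j))) (choose (nonrainbow dense) j)

    codes-if : Dec Dense → List (Subset N)
    codes-if (yes dense) = dense-codes dense
    codes-if (no _)      = sparse-codes

    codes : List (Subset N)
    codes = codes-if Dense?

    module _ {H : Subset N} (S⊆H : S ⊆ H) (∣S∣≡s : ∣ S ∣ ≡ s) (∣H∣≡m : ∣ H ∣ ≡ m) (H─S⊆T : H ─ S ⊆ restrict T) where

      ∣H─S∣ : ∣ H ─ S ∣ ≡ m ∸ s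
      ∣H─S∣ = trans (∣q─p∣≡∣q∣∸∣p∣ S⊆H) (cong₂ _∸_ ∣H∣≡m ∣S∣≡s)

      ∈-sparse-codes : H ∈ₗ sparse-codes
      ∈-sparse-codes = subst (_∈ₗ sparse-codes) (∪-─ S⊆H)
        (∈-map⁺ (S ∪_) (subst (λ k → H ─ S ∈ₗ choose (restrict T) k) ∣H─S∣ (∈-choose⁺ H─S⊆T)))

      ∈-dense-codes : Far {n} (hypergraph H) (s + j) → (dense : Dense) → H ∈ₗ dense-codes dense
      ∈-dense-codes far dense@(x , y , z , t , _) = code
        where
        B : Subset N
        B = nonrainbow dense
        part : Fin n → Fin 3
        part = Partition.part {x} {y} {z} t
        cover : H ─ restrict (rainbow part) ⊆ S ∪ ((H ─ S) ∩ B)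
        cover {i} i∈ = by-cases (i ∈? S)
          where
          by-cases : Dec (i ∈ S) → i ∈ S ∪ ((H ─ S) ∩ B)
          by-cases (yes i∈S) = x∈p∪q⁺ (inj₁ i∈S)
          by-cases (no  i∉S) = x∈p∪q⁺ {p = S} (inj₂ (x∈p∩q⁺ (i∈H─S ,
                  ∈-restrict⁺ (λ u v w → T u v w ∧ not (rainbow part u v w)) (∧-intro (∈-restrict⁻ T (H─S⊆T i∈H─S)) not-rainbow))))
            where
            i∈H─S : i ∈ H ─ S
            i∈H─S = x∈p∧x∉q⇒x∈p─q (p─q⊆p H (restrict (rainbow part)) i∈) i∉S
            not-rainbow : not (let u , v , w = triple i in rainbow part u v w) ≡ true
            not-rainbow = cong not (false-if (λ eq → ∈─⇒∉ H (restrict (rainbow part)) i∈ (∈-restrict⁺ (rainbow part) eq)))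
              where
              false-if : ∀ {p} → ¬ p ≡ true → p ≡ false
              false-if {true}  ¬t = contradiction refl ¬t
              false-if {false} _  = refl
        -- At least `s + j` edges of H are not rainbow for this partition, and at most `s` of them
        -- are in S; the others are non-rainbow triples of T.
        j≤ : j ≤ ∣ (H ─ S) ∩ B ∣
        j≤ = +-cancelˡ-≤ s _ _ (≤-trans (far part) (≤-trans (p⊆q⇒∣p∣≤∣q∣ cover)
          (≤-trans (∣p∪q∣≤∣p∣+∣q∣ S ((H ─ S) ∩ B)) (≤-reflexive (cong (_+ ∣ (H ─ S) ∩ B ∣) ∣S∣≡s)))))
        middle : Σ (Subset N) λ Q → ⊥ ⊆ Q × Q ⊆ (H ─ S) ∩ B × ∣ Q ∣ ≡ j
        middle = subset-between ⊥ ((H ─ S) ∩ B) j ⊥⊆ (≤-trans (≤-reflexive (∣⊥∣≡0 N)) z≤n) j≤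
        code : H ∈ₗ dense-codes dense
        code = let Q , _ , Q⊆ , ∣Q∣≡j = middle in code-from Q Q⊆ ∣Q∣≡j
          where
          code-from : ∀ Q → Q ⊆ (H ─ S) ∩ B → ∣ Q ∣ ≡ j → H ∈ₗ dense-codes dense
          code-from Q Q⊆ ∣Q∣≡j = subst (_∈ₗ dense-codes dense) (trans (cong (S ∪_) (∪-─ Q⊆H─S)) (∪-─ S⊆H))
            (∈-concatMap⁺ (λ Q → map (λ R → S ∪ (Q ∪ R)) (choose ⊤ (m ∸ s ∸ j))) (lose Q∈ R∈))
            where
            Q⊆H─S : Q ⊆ H ─ S
            Q⊆H─S i∈ = p∩q⊆p (H ─ S) B (Q⊆ i∈)
            Q∈ : Q ∈ₗ choose B j
            Q∈ = subst (λ k → Q ∈ₗ choose B k) ∣Q∣≡j (∈-choose⁺ (λ i∈ → p∩q⊆q (H ─ S) B (Q⊆ i∈)))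
            R∈ : S ∪ (Q ∪ ((H ─ S) ─ Q)) ∈ₗ map (λ R → S ∪ (Q ∪ R)) (choose ⊤ (m ∸ s ∸ j))
            R∈ = ∈-map⁺ (λ R → S ∪ (Q ∪ R)) (subst (λ k → (H ─ S) ─ Q ∈ₗ choose ⊤ k)
              (trans (∣q─p∣≡∣q∣∸∣p∣ Q⊆H─S) (cong₂ _∸_ ∣H─S∣ ∣Q∣≡j)) (∈-choose⁺ ⊆⊤))

      ∈-codes : Far {n} (hypergraph H) (s + j) → H ∈ₗ codes
      ∈-codes far = by-cases Dense?
        where
        by-cases : ∀ d → H ∈ₗ codes-if d
        by-cases (yes dense) = ∈-dense-codes far dense
        by-cases (no _)      = ∈-sparse-codes

    module _ (D X : ℕ)
      (sparse-bound : ∀ M τ → 6 * M ≤ τ → τ ≤ n * (n * n) → (18 * n + 9 * e) * τ ≤ 27 * b * τ + n * (4 * (n * n * n) + 270 * (n * n)) →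
        D * (M C (m ∸ s)) ≤ X)
      (dense-bound : ∀ B → B ≤ 3 * (n * (n * (9 * b + 2 * e))) → D * ((B C j) * (N C (m ∸ s ∸ j))) ≤ X) where

      length-codes : D * length codes ≤ X
      length-codes = by-cases Dense?
        where
        by-cases : ∀ d → D * length (codes-if d) ≤ X
        by-cases (yes dense@(x , y , z , t , large)) =
          ≤-trans (*-monoʳ-≤ D count) (dense-bound ∣ nonrainbow dense ∣
            (≤-trans (∣restrict∣≤∑³ (λ u v w → T u v w ∧ not (rainbow (Partition.part {x} {y} {z} t) u v w)))
              (Partition.#nonrainbow {x} {y} {z} t e large)))
          where
          count : length (dense-codes dense) ≤ (∣ nonrainbow dense ∣ C j) * (N C (m ∸ s ∸ j))
          count = ≤-trans (≤-reflexive (sym (*-identityˡ _)))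
            (≤-trans (length-concatMap-≤ (λ Q → map (λ R → S ∪ (Q ∪ R)) (choose ⊤ (m ∸ s ∸ j))) 1 (N C (m ∸ s ∸ j))
              (λ Q → ≤-reflexive (trans (*-identityˡ _) (trans (length-map (λ R → S ∪ (Q ∪ R)) (choose {N} ⊤ (m ∸ s ∸ j)))
                (trans (length-choose {N} ⊤ (m ∸ s ∸ j)) (cong (_C (m ∸ s ∸ j)) (∣⊤∣≡n N))))))
              (choose (nonrainbow dense) j))
              (≤-reflexive (cong (_* (N C (m ∸ s ∸ j))) (length-choose (nonrainbow dense) j))))
        by-cases (no ¬dense) = ≤-trans
          (≤-reflexive (cong (D *_) (trans (length-map (S ∪_) (choose (restrict T) (m ∸ s))) (length-choose (restrict T) (m ∸ s)))))
          (sparse-bound ∣ restrict T ∣ τ (6∣restrict∣≤∑³ T T-sym₁₂ T-sym₂₃)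
            (sum-bounded (n * n) (λ x → sum-bounded n (λ y → #≤n (T x y))))
            (density e λ {x} {y} {z} t → ≰⇒≥ (λ large → ¬dense (x , y , z , t , large))))

module _ {n : ℕ} (b w e m s j X : ℕ) (2≤w : 2 ≤ w) (n<w[b+1] : n < w * suc b) (6n²w≤s : 6 * (n * (n * w)) ≤ s) (s≤m : s ≤ m)
  (sparse-bound : ∀ M τ → 6 * M ≤ τ → τ ≤ n * (n * n) → (18 * n + 9 * e) * τ ≤ 27 * b * τ + n * (4 * (n * n * n) + 270 * (n * n)) →
    2 ^ s * 2 ^ (n * n) * ((length (triples n) C s) * (M C (m ∸ s))) ≤ X)
  (dense-bound : ∀ B → B ≤ 3 * (n * (n * (9 * b + 2 * e))) → 2 ^ s * 2 ^ (n * n) * ((length (triples n) C s) * ((B C j) * (length (triples n) C (m ∸ s ∸ j)))) ≤ X)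
  where

  open Codes {n} b e m s j using (N; codes; length-codes; ∈-codes)

  all-codes : List (Subset N)
  all-codes = concatMap (λ G → concatMap (codes G) (choose ⊤ s)) (subsets (n * n))

  ∈-all-codes : (H : Hypergraph n) → TriangleFree H → edges H ≡ m → Far H (s + j) → edgeSet H ∈ₗ all-codes
  ∈-all-codes H free ∣H∣≡m far =
    let S , S₀⊆S , S⊆H , ∣S∣≡s = subset-between (edgeSet (S₀ H free b w 2≤w n<w[b+1])) (edgeSet H) s
             (S₀⊆H H free b w 2≤w n<w[b+1]) (≤-trans (∣S₀∣ H free b w 2≤w n<w[b+1]) 6n²w≤s) (≤-trans s≤m (≤-reflexive (sym ∣H∣≡m)))
    in ∈-concatMap⁺ (λ G → concatMap (codes G) (choose ⊤ s)) (lose (∈-subsets (unshared H))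
        (∈-concatMap⁺ (codes (unshared H)) (lose
          (subst (λ k → S ∈ₗ choose ⊤ k) ∣S∣≡s (∈-choose⁺ ⊆⊤))
          (∈-codes (unshared H) S S⊆H ∣S∣≡s ∣H∣≡m (H─S⊆T H free b w 2≤w n<w[b+1] (hypergraph S) S₀⊆S S⊆H) far))))

  -- The `2^(n²)` choices of Γ and the `N C s` choices of S cancel against the factors in the two
  -- bounds. Cancellation needs `N C s` to be nonzero; if it is zero there is no S to choose and the
  -- list is empty.
  length-all-codes : 2 ^ s * length all-codes ≤ X
  length-all-codes = by-cases (N C s) refl
    where
    by-cases : ∀ c → N C s ≡ c → 2 ^ s * length all-codes ≤ X
    by-cases zero    eq = ≤-trans (length-concatMap-≤ (λ G → concatMap (codes G) (choose ⊤ s)) (2 ^ s) 0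
      (λ G → ≤-reflexive (trans (cong (λ l → 2 ^ s * length (concatMap (codes G) l)) empty) (*-zeroʳ (2 ^ s)))) (subsets (n * n)))
      (≤-trans (≤-reflexive (*-zeroʳ (length (subsets (n * n))))) z≤n)
      where
      empty : choose {N} ⊤ s ≡ []
      empty = length-0 (trans (length-choose {N} ⊤ s) (trans (cong (_C s) (∣⊤∣≡n N)) eq))
        where
        length-0 : ∀ {A : Set} {xs : List A} → length xs ≡ 0 → xs ≡ []
        length-0 {xs = []} _ = refl
    by-cases (suc c) eq = *-cancelˡ-≤ (2 ^ (n * n) * suc c) {{m*n≢0 (2 ^ (n * n)) (suc c) {{m^n≢0 2 (n * n)}}}} (begin
      2 ^ (n * n) * suc c * (2 ^ s * length all-codes)
        ≡⟨ shuffle (2 ^ (n * n)) (suc c) (2 ^ s) (length all-codes) ⟩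
      2 ^ s * 2 ^ (n * n) * suc c * length all-codes
        ≤⟨ length-concatMap-≤ (λ G → concatMap (codes G) (choose ⊤ s)) (2 ^ s * 2 ^ (n * n) * suc c) (suc c * X) inner (subsets (n * n)) ⟩
      length (subsets (n * n)) * (suc c * X)
        ≡⟨ cong (_* (suc c * X)) (length-subsets (n * n)) ⟩
      2 ^ (n * n) * (suc c * X)
        ≡⟨ *-assoc (2 ^ (n * n)) (suc c) X ⟨
      2 ^ (n * n) * suc c * X ∎)
      where
      open ≤-Reasoning
      shuffle : ∀ a c p l → a * c * (p * l) ≡ p * a * c * l
      shuffle = solve-∀
      reassoc : ∀ x → 2 ^ s * 2 ^ (n * n) * suc c * x ≡ 2 ^ s * 2 ^ (n * n) * ((N C s) * x)
      reassoc x = trans (*-assoc (2 ^ s * 2 ^ (n * n)) (suc c) x) (cong (λ t → 2 ^ s * 2 ^ (n * n) * (t * x)) (sym eq))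
      inner : ∀ G → 2 ^ s * 2 ^ (n * n) * suc c * length (concatMap (codes G) (choose ⊤ s)) ≤ suc c * X
      inner G = ≤-trans (length-concatMap-≤ (codes G) (2 ^ s * 2 ^ (n * n) * suc c) X
        (λ S → length-codes G S (2 ^ s * 2 ^ (n * n) * suc c) X
          (λ M τ h₁ h₂ h₃ → ≤-trans (≤-reflexive (reassoc (M C (m ∸ s)))) (sparse-bound M τ h₁ h₂ h₃))
          (λ B h → ≤-trans (≤-reflexive (reassoc ((B C j) * (N C (m ∸ s ∸ j))))) (dense-bound B h)))
        (choose ⊤ s))
        (≤-reflexive (cong (_* X) (trans (length-choose {N} ⊤ s) (trans (cong (_C s) (∣⊤∣≡n N)) eq))))

  bad-bound : ∀ (Hs : List (Hypergraph n)) → Unique Hs →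
    (∀ {H} → H ∈ₗ Hs → TriangleFree H × edges H ≡ m × Far H (s + j)) → 2 ^ s * length Hs ≤ X
  bad-bound Hs unique bad = ≤-trans (*-monoʳ-≤ (2 ^ s)
    (≤-trans (≤-reflexive (sym (length-map edgeSet Hs))) (Unique-length-≤ (Unique.map⁺ (λ { refl → refl }) unique) covered)))
    length-all-codes
    where
    covered : ∀ {p} → p ∈ₗ map edgeSet Hs → p ∈ₗ all-codes
    covered p∈ = let H , H∈ , p≡ = ∈-map⁻ edgeSet p∈ ; free , size , far = bad H∈ in
      subst (_∈ₗ all-codes) (sym p≡) (∈-all-codes H free size far)

-- Parameters

-- The lower coefficients of `(3κ + 2)³` are 54, 36 and 8, with sum 98; `κ ≥ 1` raises all of these
-- terms to `κ²`.
n³≤ : ∀ κ n → 1 ≤ κ → n ≤ 3 * κ + 2 → n * (n * n) ≤ 27 * (κ * (κ * κ)) + 98 * (κ * κ)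
n³≤ (suc c) n _ le = ≤-trans (*-mono-≤ le (*-mono-≤ le le)) (m+n≤o⇒m≤o _ (≤-reflexive (eq c)))
  where
  eq : ∀ c → (3 * suc c + 2) * ((3 * suc c + 2) * (3 * suc c + 2)) + (44 * (c * c) + 52 * c) ≡
             27 * (suc c * (suc c * suc c)) + 98 * (suc c * suc c)
  eq = solve-∀

3κ+2≤5κ : ∀ {κ n} → 1 ≤ κ → n ≤ 3 * κ + 2 → n ≤ 5 * κ
3κ+2≤5κ {κ} 1≤κ le = ≤-trans le (≤-trans (+-monoʳ-≤ (3 * κ) (*-monoʳ-≤ 2 1≤κ)) (≤-reflexive (eq κ)))
  where
  eq : ∀ κ → 3 * κ + 2 * κ ≡ 5 * κ
  eq = solve-∀

-- After multiplication by `2v` the term `9 e τ` gains about `18 n τ` and the term `27 b τ` costs at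
-- most `9 n τ`. Half of the gain survives and lowers the leading constant from `2/9` to
-- `(2/9) * 4v/(4v+1)`.
density-arith : ∀ v n e b τ → 1 ≤ n → n ≤ e * v + v → 6 * (v * b) ≤ n → τ ≤ n * (n * n) →
  (18 * n + 9 * e) * τ ≤ 27 * b * τ + n * (4 * (n * n * n) + 270 * (n * n)) →
  (36 * v + 9) * τ ≤ 8 * v * (n * (n * n)) + 558 * v * (n * n)
density-arith v n@(suc _) e b τ _ ve vb τ≤ ineq = *-cancelˡ-≤ n (+-cancelˡ-≤ (9 * n * τ) _ _ (begin
  9 * n * τ + n * ((36 * v + 9) * τ)                                       ≡⟨ e₁ v n τ ⟩
  18 * n * τ + 36 * v * n * τ                                              ≤⟨ +-monoˡ-≤ _ (*-monoˡ-≤ τ (*-monoʳ-≤ 18 ve)) ⟩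
  18 * (e * v + v) * τ + 36 * v * n * τ                                    ≡⟨ e₂ v n e τ ⟩
  2 * v * ((18 * n + 9 * e) * τ) + 18 * v * τ                              ≤⟨ +-mono-≤ (*-monoʳ-≤ (2 * v) ineq) (*-monoʳ-≤ (18 * v) τ≤) ⟩
  2 * v * (27 * b * τ + n * (4 * (n * n * n) + 270 * (n * n))) + 18 * v * (n * (n * n))
                                                                           ≡⟨ e₃ v n b τ ⟩
  9 * (6 * (v * b)) * τ + n * (8 * v * (n * (n * n)) + 558 * v * (n * n))  ≤⟨ +-monoˡ-≤ _ (*-monoˡ-≤ τ (*-monoʳ-≤ 9 vb)) ⟩
  9 * n * τ + n * (8 * v * (n * (n * n)) + 558 * v * (n * n)) ∎))
  where
  open ≤-Reasoning
  e₁ : ∀ v n τ → 9 * n * τ + n * ((36 * v + 9) * τ) ≡ 18 * n * τ + 36 * v * n * τ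
  e₁ = solve-∀
  e₂ : ∀ v n e τ → 18 * (e * v + v) * τ + 36 * v * n * τ ≡ 2 * v * ((18 * n + 9 * e) * τ) + 18 * v * τ
  e₂ = solve-∀
  e₃ : ∀ v n b τ → 2 * v * (27 * b * τ + n * (4 * (n * n * n) + 270 * (n * n))) + 18 * v * (n * (n * n)) ≡
    9 * (6 * (v * b)) * τ + n * (8 * v * (n * (n * n)) + 558 * v * (n * n))
  e₃ = solve-∀

-- The leading terms give the ratio `8v/(8v+2)`; weakening it to `(8v+1)/(8v+2)`, which is
-- `u/(u+1)`, makes room for the lower-order terms. These total `8 * 98 + 558 * 25`, padded by 8 to
-- `27 * 546`, whence `546 * v ≤ κ`.
sparse-arith : ∀ v κ n τ M → 1 ≤ κ → n ≤ 3 * κ + 2 → 546 * v ≤ κ → 6 * M ≤ τ →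
  (36 * v + 9) * τ ≤ 8 * v * (n * (n * n)) + 558 * v * (n * n) → (8 * v + 2) * M ≤ (8 * v + 1) * (κ * (κ * κ))
sparse-arith v κ n τ M 1≤κ n≤ v≤κ M≤τ ineq = *-cancelˡ-≤ 27 (begin
  27 * ((8 * v + 2) * M)                                                     ≡⟨ e₁ v M ⟩
  (36 * v + 9) * (6 * M)                                                     ≤⟨ *-monoʳ-≤ (36 * v + 9) M≤τ ⟩
  (36 * v + 9) * τ                                                           ≤⟨ ineq ⟩
  8 * v * (n * (n * n)) + 558 * v * (n * n)
    ≤⟨ +-mono-≤ (*-monoʳ-≤ (8 * v) (n³≤ κ n 1≤κ n≤)) (*-monoʳ-≤ (558 * v) (*-mono-≤ (3κ+2≤5κ 1≤κ n≤) (3κ+2≤5κ 1≤κ n≤))) ⟩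
  8 * v * (27 * (κ * (κ * κ)) + 98 * (κ * κ)) + 558 * v * (5 * κ * (5 * κ))
    ≤⟨ m≤m+n _ (8 * v * (κ * κ)) ⟩
  8 * v * (27 * (κ * (κ * κ)) + 98 * (κ * κ)) + 558 * v * (5 * κ * (5 * κ)) + 8 * v * (κ * κ)
    ≡⟨ e₂ v κ ⟩
  216 * v * (κ * (κ * κ)) + 27 * (546 * v) * (κ * κ)                         ≤⟨ +-monoʳ-≤ (216 * v * (κ * (κ * κ))) (*-monoˡ-≤ (κ * κ) (*-monoʳ-≤ 27 v≤κ)) ⟩
  216 * v * (κ * (κ * κ)) + 27 * κ * (κ * κ)                                 ≡⟨ e₃ v κ ⟩
  27 * ((8 * v + 1) * (κ * (κ * κ))) ∎)
  where
  open ≤-Reasoning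
  e₁ : ∀ v M → 27 * ((8 * v + 2) * M) ≡ (36 * v + 9) * (6 * M)
  e₁ = solve-∀
  e₂ : ∀ v κ → 8 * v * (27 * (κ * (κ * κ)) + 98 * (κ * κ)) + 558 * v * (5 * κ * (5 * κ)) + 8 * v * (κ * κ)
    ≡ 216 * v * (κ * (κ * κ)) + 27 * (546 * v) * (κ * κ)
  e₂ = solve-∀
  e₃ : ∀ v κ → 216 * v * (κ * (κ * κ)) + 27 * κ * (κ * κ) ≡ 27 * ((8 * v + 1) * (κ * (κ * κ)))
  e₃ = solve-∀

n³≤125κ³ : ∀ κ n → 1 ≤ κ → n ≤ 3 * κ + 2 → n * (n * n) ≤ 125 * (κ * (κ * κ))
n³≤125κ³ κ n 1≤κ n≤ = ≤-trans (*-mono-≤ le (*-mono-≤ le le)) (≤-reflexive (eq κ))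
  where
  le : n ≤ 5 * κ
  le = 3κ+2≤5κ 1≤κ n≤
  eq : ∀ κ → 5 * κ * (5 * κ * (5 * κ)) ≡ 125 * (κ * (κ * κ))
  eq = solve-∀

-- Since `k ≤ M`, at least `N/(u+1)` elements remain after `k` are taken, and
-- `s ≤ (k+s)/(4(u+1)) ≤ N/(2(u+1))` takes at most half of these.
gap-sparse : ∀ u N M k s → suc u * M ≤ u * N → k ≤ M → 4 * suc u * s ≤ k + s → N ≤ 2 * suc u * (N ∸ (k + s))
gap-sparse u N M k s M≤ k≤M s≤ = ≤-trans (m+n≤o⇒m≤o∸n N bound) (≤-reflexive (sym (*-distribˡ-∸ (2 * suc u) N (k + s))))
  where
  open ≤-Reasoning
  M≤N : M ≤ N
  M≤N = *-cancelˡ-≤ (suc u) (≤-trans M≤ (*-monoˡ-≤ N (n≤1+n u)))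
  k+s≤2N : k + s ≤ 2 * N
  k+s≤2N = +-cancelʳ-≤ (2 * s) _ _ (begin
    k + s + 2 * s            ≡⟨ e₀ k s ⟩
    k + 3 * s                ≤⟨ +-mono-≤ (≤-trans k≤M M≤N) 3s≤ ⟩
    N + (N + s)              ≤⟨ ≤-reflexive (e₁ N s) ⟩
    2 * N + s                ≤⟨ +-monoʳ-≤ (2 * N) (m≤m+n s _) ⟩
    2 * N + 2 * s ∎)
    where
    e₀ : ∀ k s → k + s + 2 * s ≡ k + 3 * s
    e₀ = solve-∀
    e₁ : ∀ N s → N + (N + s) ≡ 2 * N + s
    e₁ = solve-∀
    3s≤ : 3 * s ≤ N + s
    3s≤ = begin
      3 * s                  ≤⟨ *-monoˡ-≤ s {3} {4 * suc u} (≤-trans (n≤1+n 3) (m≤m*n 4 (suc u))) ⟩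
      4 * suc u * s          ≤⟨ s≤ ⟩
      k + s                  ≤⟨ +-monoˡ-≤ s (≤-trans k≤M M≤N) ⟩
      N + s ∎
  bound : N + 2 * suc u * (k + s) ≤ 2 * suc u * N
  bound = *-cancelˡ-≤ 2 (begin
    2 * (N + 2 * suc u * (k + s))                            ≡⟨ e₁ u N k s ⟩
    2 * N + 4 * (suc u * k) + 4 * suc u * s                  ≤⟨ +-mono-≤ (+-monoʳ-≤ (2 * N) (*-monoʳ-≤ 4 (≤-trans (*-monoʳ-≤ (suc u) k≤M) M≤))) (≤-trans s≤ k+s≤2N) ⟩
    2 * N + 4 * (u * N) + 2 * N                              ≡⟨ e₂ u N ⟩
    2 * (2 * suc u * N) ∎)
    where
    e₁ : ∀ u N k s → 2 * (N + 2 * suc u * (k + s)) ≡ 2 * N + 4 * (suc u * k) + 4 * suc u * s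
    e₁ = solve-∀
    e₂ : ∀ u N → 2 * N + 4 * (u * N) + 2 * N ≡ 2 * (2 * suc u * N)
    e₂ = solve-∀

-- `9 b + 2 e` is at most `7n/(2v)`, so `B` is at most `(21/2) * 125 * N/v`; the constant 10000 in
-- `v` is ample.
dense-arith : ∀ Λ v n b e B N → v ≡ 10000 * Λ → 6 * (v * b) ≤ n → e * v ≤ n → n * (n * n) ≤ 125 * N →
  B ≤ 3 * (n * (n * (9 * b + 2 * e))) → 2 * (Λ * B) ≤ N
dense-arith Λ v n b e B N v≡ vb ve n³≤ B≤ = *-cancelˡ-≤ 30000 (begin
  30000 * (2 * (Λ * B))                            ≡⟨ e₁ Λ B ⟩
  6 * (10000 * Λ * B)                              ≡⟨ cong (λ t → 6 * (t * B)) v≡ ⟨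
  6 * (v * B)                                      ≤⟨ *-monoʳ-≤ 6 (*-monoʳ-≤ v B≤) ⟩
  6 * (v * (3 * (n * (n * (9 * b + 2 * e)))))      ≡⟨ e₂ v n b e ⟩
  3 * (n * n) * (9 * (6 * (v * b)) + 12 * (e * v)) ≤⟨ *-monoʳ-≤ (3 * (n * n)) (+-mono-≤ (*-monoʳ-≤ 9 vb) (*-monoʳ-≤ 12 ve)) ⟩
  3 * (n * n) * (9 * n + 12 * n)                   ≡⟨ e₃ n ⟩
  63 * (n * (n * n))                               ≤⟨ *-monoʳ-≤ 63 n³≤ ⟩
  63 * (125 * N)                                   ≡⟨ *-assoc 63 125 N ⟨
  7875 * N                                         ≤⟨ *-monoˡ-≤ N (≤ᵇ⇒≤ 7875 30000 _) ⟩
  30000 * N ∎)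
  where
  open ≤-Reasoning
  e₁ : ∀ Λ B → 30000 * (2 * (Λ * B)) ≡ 6 * (10000 * Λ * B)
  e₁ = solve-∀
  e₂ : ∀ v n b e → 6 * (v * (3 * (n * (n * (9 * b + 2 * e))))) ≡ 3 * (n * n) * (9 * (6 * (v * b)) + 12 * (e * v))
  e₂ = solve-∀
  e₃ : ∀ n → 3 * (n * n) * (9 * n + 12 * n) ≡ 63 * (n * (n * n))
  e₃ = solve-∀

n≤[2+a]^n : ∀ a n → n ≤ (2 + a) ^ n
n≤[2+a]^n a zero    = z≤n
n≤[2+a]^n a (suc n) = ≤-trans (+-mono-≤ (m^n>0 (2 + a) n) (n≤[2+a]^n a n))
  (+-monoʳ-≤ ((2 + a) ^ n) (m≤m+n ((2 + a) ^ n) (a * (2 + a) ^ n)))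

-- From rational to natural inequalities, and the two sides of the comparison

toℚᵘ-ℕ→ℚ : ∀ k → toℚᵘ (ℕ→ℚ k) ℚᵘ.≃ mkℚᵘ (ℤ.+ k) 0
toℚᵘ-ℕ→ℚ k = ℚ.toℚᵘ-fromℚᵘ (mkℚᵘ (ℤ.+ k) 0)

-- `q` is the denominator of `δ`; its numerator is at least 1, so `δ ≥ 1/q`.
scaled-≤ : ∀ δ → Positive δ → Σ ℕ λ q → NonZero q × (∀ x y → q * x ≤ y → ℕ→ℚ x ℚ.≤ δ ℚ.* ℕ→ℚ y)
scaled-≤ δ@(mkℚ (ℤ.+ suc p) d _) _ = suc d , _ , λ x y le → ℚ.toℚᵘ-cancel-≤ (begin
  toℚᵘ (ℕ→ℚ x)                                     ≃⟨ toℚᵘ-ℕ→ℚ x ⟩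
  mkℚᵘ (ℤ.+ x) 0                                   ≤⟨ *≤* (cross x y le) ⟩
  mkℚᵘ (ℤ.+ suc p) d ℚᵘ.* mkℚᵘ (ℤ.+ y) 0           ≃⟨ ℚᵘ.*-congˡ {mkℚᵘ (ℤ.+ suc p) d} (toℚᵘ-ℕ→ℚ y) ⟨
  toℚᵘ δ ℚᵘ.* toℚᵘ (ℕ→ℚ y)                         ≃⟨ ℚ.toℚᵘ-homo-* δ (ℕ→ℚ y) ⟨
  toℚᵘ (δ ℚ.* ℕ→ℚ y) ∎)
  where
  open ℚᵘ.≤-Reasoning
  cross : ∀ x y → suc d * x ≤ y → ℤ.+ x ℤ.* (ℤ.+ (suc d * 1)) ℤ.≤ (ℤ.+ suc p ℤ.* ℤ.+ y) ℤ.* ℤ.+ 1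
  cross x y le = subst₂ ℤ._≤_ (ℤ.pos-* x (suc d * 1))
    (trans (ℤ.pos-* (suc p) y) (sym (ℤ.*-identityʳ (ℤ.+ suc p ℤ.* ℤ.+ y))))
    (ℤ.+≤+ (≤-trans (≤-reflexive (trans (cong (x *_) (*-identityʳ (suc d))) (*-comm x (suc d)))) (≤-trans le (m≤m+n y (p * y)))))

ℕ→ℚ-product-cancel : ∀ a b c → ℕ→ℚ a ℚ.* ℕ→ℚ b ℚ.≤ ℕ→ℚ c → a * b ≤ c
ℕ→ℚ-product-cancel a b c le = ℤ.drop‿+≤+ (subst₂ ℤ._≤_
  (trans (ℤ.*-identityʳ (ℤ.+ a ℤ.* ℤ.+ b)) (sym (ℤ.pos-* a b))) (ℤ.*-identityʳ (ℤ.+ c)) (ℚᵘ.drop-*≤* le′))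
  where
  open ℚᵘ.≤-Reasoning
  le′ : mkℚᵘ (ℤ.+ a) 0 ℚᵘ.* mkℚᵘ (ℤ.+ b) 0 ℚᵘ.≤ mkℚᵘ (ℤ.+ c) 0
  le′ = begin
    mkℚᵘ (ℤ.+ a) 0 ℚᵘ.* mkℚᵘ (ℤ.+ b) 0      ≃⟨ ℚᵘ.*-cong (toℚᵘ-ℕ→ℚ a) (toℚᵘ-ℕ→ℚ b) ⟨
    toℚᵘ (ℕ→ℚ a) ℚᵘ.* toℚᵘ (ℕ→ℚ b)          ≃⟨ ℚ.toℚᵘ-homo-* (ℕ→ℚ a) (ℕ→ℚ b) ⟨
    toℚᵘ (ℕ→ℚ a ℚ.* ℕ→ℚ b)                  ≤⟨ ℚ.toℚᵘ-mono-≤ le ⟩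
    toℚᵘ (ℕ→ℚ c)                            ≃⟨ toℚᵘ-ℕ→ℚ c ⟩
    mkℚᵘ (ℤ.+ c) 0 ∎

m<[1+m/n]*n : ∀ m n .{{_ : NonZero n}} → m < suc (m / n) * n
m<[1+m/n]*n m n = ≤-trans (s≤s (≤-reflexive (m≡m%n+[m/n]*n m n))) (+-monoˡ-≤ (m / n * n) (m%n<n m n))

rainbow⁻ : ∀ {n} (part : Fin n → Fin 3) {a b c} → rainbow part a b c ≡ true → part a ≢ part b × part b ≢ part c × part a ≢ part c
rainbow⁻ part {a} {b} {c} eq =
  let p , eq′ = ∧-true {not (does (part a Fin.≟ part b))} eq
      q , r = ∧-true {not (does (part b Fin.≟ part c))} eq′
  in does-false (part a Fin.≟ part b) (not-true p) , does-false (part b Fin.≟ part c) (not-true q) , does-false (part a Fin.≟ part c) (not-true r)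
  where
  not-true : ∀ {p} → not p ≡ true → p ≡ false
  not-true {false} _ = refl

module _ {n : ℕ} {δ : ℚ} {q : ℕ} (scale : ∀ x y → q * x ≤ y → ℕ→ℚ x ℚ.≤ δ ℚ.* ℕ→ℚ y) where

  -- Deleting the edges that are not rainbow for `part` leaves a tripartite hypergraph, so there
  -- must be more than `m/q` of them.
  far-from-tripartite : ∀ {m} (H : Hypergraph n) → ¬ TripartiteAfterRemoving δ m H →
    ∀ part → m < q * ∣ edgeSet H ─ restrict (rainbow part) ∣
  far-from-tripartite {m} H ¬tri part = ≰⇒> λ le → ¬tri
    ( hypergraph (edgeSet H ∩ R) , p∩q⊆p (edgeSet H) R
    , (part , λ i i∈ → rainbow⁻ part (∈-restrict⁻ (rainbow part) (proj₂ (x∈p∩q⁻ (edgeSet H) R i∈))))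
    , scale (edges H ∸ ∣ edgeSet H ∩ R ∣) m (≤-trans (*-monoʳ-≤ q removed) le))
    where
    R : Subset (length (triples n))
    R = restrict (rainbow part)
    cover : edgeSet H ⊆ (edgeSet H ∩ R) ∪ (edgeSet H ─ R)
    cover {i} i∈ = by-cases (i ∈? R)
      where
      by-cases : Dec (i ∈ R) → i ∈ (edgeSet H ∩ R) ∪ (edgeSet H ─ R)
      by-cases (yes i∈R) = x∈p∪q⁺ (inj₁ (x∈p∩q⁺ (i∈ , i∈R)))
      by-cases (no  i∉R) = x∈p∪q⁺ {p = edgeSet H ∩ R} (inj₂ (x∈p∧x∉q⇒x∈p─q i∈ i∉R))
    removed : edges H ∸ ∣ edgeSet H ∩ R ∣ ≤ ∣ edgeSet H ─ R ∣
    removed = m≤n+o⇒m∸n≤o _ ∣ edgeSet H ∩ R ∣ (≤-trans (p⊆q⇒∣p∣≤∣q∣ cover) (∣p∪q∣≤∣p∣+∣q∣ (edgeSet H ∩ R) (edgeSet H ─ R)))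

module _ {n : ℕ} (k : ℕ) (3k≤n : k + k + k ≤ n) where
  open Balanced k 3k≤n

  all-bound : ∀ m (Hs : List (Hypergraph n)) → (∀ H → TFm n m H → H ∈ₗ Hs) → ∣ restrict transversal ∣ C m ≤ length Hs
  all-bound m Hs complete = ≤-trans
    (≤-reflexive (trans (sym (length-choose (restrict transversal) m)) (sym (length-map (hypergraph {n}) (choose (restrict transversal) m)))))
    (Unique-length-≤ (Unique.map⁺ (λ { refl → refl }) (choose-Unique (restrict transversal) m)) covered)
    where
    covered : ∀ {H} → H ∈ₗ map (hypergraph {n}) (choose (restrict transversal) m) → H ∈ₗ Hs
    covered {H} H∈ = let p , p∈ , H≡ = ∈-map⁻ (hypergraph {n}) H∈ ; p⊆ , ∣p∣ = ∈-choose⁻ (restrict transversal) m p∈ in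
      subst (_∈ₗ Hs) (sym H≡) (complete (hypergraph p)
        (Tripartite⇒TriangleFree (hypergraph p) (transversal-tripartite (hypergraph p) p⊆) , ∣p∣))

length-triples : ∀ n → length (triples n) ≤ n * (n * n)
length-triples n = begin
  length (triples n)                           ≡⟨ ∣⊤∣≡n (length (triples n)) ⟨
  ∣ ⊤ {length (triples n)} ∣                   ≤⟨ p⊆q⇒∣p∣≤∣q∣ {p = ⊤} {q = restrict {n} (λ _ _ _ → true)} (λ _ → ∈-restrict⁺ (λ _ _ _ → true) refl) ⟩
  ∣ restrict {n} (λ _ _ _ → true) ∣            ≤⟨ ∣restrict∣≤∑³ {n} (λ _ _ _ → true) ⟩
  ∑³ {n} (λ _ _ _ → 1)                         ≤⟨ sum-bounded {n} (n * n) (λ x → sum-bounded {n} n (λ y → #≤n {n} (λ _ → true))) ⟩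
  n * (n * n) ∎
  where open ≤-Reasoning

-- q ≥ 1/δ; the error terms of the stability lemma are e = n / v and b = n / (6v); a sparse T has density at most
-- u / (u + 1) of the balanced tripartite hypergraph; and fingerprints have size s ≤ m / Q.
module Parameters (q Λ v u L Q : ℕ) {{_ : NonZero q}} {{_ : NonZero v}} {{_ : NonZero L}}
  (Λ≡ : Λ ≡ (16 * 250) ^ (3 * q)) (v≡ : v ≡ 10000 * Λ) (u≡ : u ≡ 8 * v + 1) (L≡ : L ≡ 125 * (2 * suc u))
  (Q≡ : Q ≡ 1 + 3 * q + 4 * suc u + suc (2 * u) * (4 * (L * suc (2 * u)))) where

  module _ {n m : ℕ} (n-large : 3 * (546 * v + 1) ≤ n) (m-large : Q * (6 * (n * (n * (6 * v)))) ≤ m) where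

    instance
      nz-6v : NonZero (6 * v)
      nz-6v = m*n≢0 6 v
      nz-3q : NonZero (3 * q)
      nz-3q = m*n≢0 3 q

    κ e b s r j : ℕ
    κ = n / 3
    e = n / v
    b = n / (6 * v)
    -- The size bound for `S₀` with `w = 6v` marks per ordered pair; this many suffice because
    -- `n < 6v (b + 1)`.
    s = 6 * (n * (n * (6 * v)))
    r = 3 * q
    j = suc (m / r)

    κ-large : 546 * v + 1 ≤ κ
    κ-large = ≤-trans (≤-reflexive (sym (m*n/n≡m (546 * v + 1) 3)))
      (/-monoˡ-≤ 3 (≤-trans (≤-reflexive (*-comm (546 * v + 1) 3)) n-large))

    1≤κ : 1 ≤ κ
    1≤κ = ≤-trans (m≤n+m 1 (546 * v)) κ-large

    546v≤κ : 546 * v ≤ κ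
    546v≤κ = ≤-trans (m≤m+n (546 * v) 1) κ-large

    3κ≤n : κ + κ + κ ≤ n
    3κ≤n = ≤-trans (≤-reflexive (eq κ)) (m/n*n≤m n 3)
      where
      eq : ∀ k → k + k + k ≡ k * 3
      eq = solve-∀

    n≤3κ+2 : n ≤ 3 * κ + 2
    n≤3κ+2 = ≤-trans (≤-pred (m<[1+m/n]*n n 3)) (≤-reflexive (eq κ))
      where
      eq : ∀ k → 2 + k * 3 ≡ 3 * k + 2
      eq = solve-∀

    1≤n : 1 ≤ n
    1≤n = ≤-trans 1≤κ (≤-trans (m≤m+n κ κ) (≤-trans (m≤m+n (κ + κ) κ) 3κ≤n))

    n≤ev+v : n ≤ e * v + v
    n≤ev+v = ≤-trans (<⇒≤ (m<[1+m/n]*n n v)) (≤-reflexive (+-comm v (e * v)))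

    n<6v[b+1] : n < 6 * v * suc b
    n<6v[b+1] = ≤-trans (m<[1+m/n]*n n (6 * v)) (≤-reflexive (*-comm (suc b) (6 * v)))

    6vb≤n : 6 * (v * b) ≤ n
    6vb≤n = ≤-trans (≤-reflexive (trans (sym (*-assoc 6 v b)) (*-comm (6 * v) b))) (m/n*n≤m n (6 * v))

    2≤6v : 2 ≤ 6 * v
    2≤6v = ≤-trans (s≤s (s≤s z≤n)) (m≤m*n 6 v)

    n²≤s : n * n ≤ s
    n²≤s = ≤-trans (*-monoʳ-≤ n (m≤m*n n (6 * v))) (m≤n*m (n * (n * (6 * v))) 6)

    n≤s : n ≤ s
    n≤s = ≤-trans (m≤m*n n n {{>-nonZero 1≤n}}) n²≤s

    times-s : ∀ {x} → x ≤ Q → x * s ≤ m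
    times-s x≤Q = ≤-trans (*-monoˡ-≤ s x≤Q) m-large

    r≤Q : r ≤ Q
    r≤Q = ≤-trans (≤-trans (n≤1+n r) (≤-trans (m≤m+n (1 + r) (4 * suc u)) (m≤m+n (1 + r + 4 * suc u) _))) (≤-reflexive (sym Q≡))

    s≤m : s ≤ m
    s≤m = ≤-trans (≤-reflexive (sym (*-identityˡ s))) (times-s (≤-trans (s≤s z≤n) (≤-reflexive (sym Q≡))))

    r≤m : r ≤ m
    r≤m = ≤-trans (m≤m*n r s {{>-nonZero (≤-trans 1≤n n≤s)}}) (times-s r≤Q)

    -- One `m` each for the fingerprint, for rounding `j` up, and for the quotient `m / r`; hence
    -- the 3 in `r = 3 q`, which brings `s + j` down to `m/q`.
    r[s+j]≤3m : r * (s + j) ≤ 3 * m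
    r[s+j]≤3m = begin
      r * (s + j)                    ≡⟨ eq₁ r s (m / r) ⟩
      r * s + (r + m / r * r)        ≤⟨ +-mono-≤ (times-s r≤Q) (+-mono-≤ r≤m (m/n*n≤m m r)) ⟩
      m + (m + m)                    ≡⟨ eq₂ m ⟩
      3 * m ∎
      where
      open ≤-Reasoning
      eq₁ : ∀ r s d → r * (s + suc d) ≡ r * s + (r + d * r)
      eq₁ = solve-∀
      eq₂ : ∀ m → m + (m + m) ≡ 3 * m
      eq₂ = solve-∀

    s+j≤m : s + j ≤ m
    s+j≤m = *-cancelˡ-≤ 3 (≤-trans (*-monoˡ-≤ (s + j) (m≤m*n 3 q)) r[s+j]≤3m)

    far : ∀ {x} → m < q * x → s + j ≤ x
    far {x} m<qx = <⇒≤ (*-cancelˡ-< r (s + j) x (≤-<-trans r[s+j]≤3m (≤-trans (*-monoʳ-< 3 m<qx) (≤-reflexive (sym (*-assoc 3 q x))))))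

    m≤rj : m ≤ r * j
    m≤rj = ≤-trans (<⇒≤ (m<[1+m/n]*n m r)) (≤-reflexive (*-comm j r))

    open Balanced κ 3κ≤n using (transversal; k³≤∣transversal∣)

    N N₀ k k′ : ℕ
    N  = length (triples n)
    N₀ = ∣ restrict transversal ∣
    k  = m ∸ s
    k′ = m ∸ s ∸ j

    k+s≡m : k + s ≡ m
    k+s≡m = m∸n+n≡m s≤m

    k′+j+s≡m : k′ + j + s ≡ m
    k′+j+s≡m = trans (cong (_+ s) (m∸n+n≡m (m+n≤o⇒m≤o∸n j (≤-trans (≤-reflexive (+-comm j s)) s+j≤m)))) k+s≡m

    N≤125N₀ : N ≤ 125 * N₀
    N≤125N₀ = ≤-trans (length-triples n) (≤-trans (n³≤125κ³ κ n 1≤κ n≤3κ+2) (*-monoʳ-≤ 125 k³≤∣transversal∣))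

    vanish : ∀ a c {d} → d ≡ 0 → a * (c * d) ≤ N₀ C m
    vanish a c refl = ≤-trans (≤-reflexive (trans (cong (a *_) (*-zeroʳ c)) (*-zeroʳ a))) z≤n

    sparse-bound : ∀ M τ → 6 * M ≤ τ → τ ≤ n * (n * n) → (18 * n + 9 * e) * τ ≤ 27 * b * τ + n * (4 * (n * n * n) + 270 * (n * n)) →
      2 ^ s * 2 ^ (n * n) * ((N C s) * (M C k)) ≤ N₀ C m
    sparse-bound M τ M≤ τ≤ dens = by-cases (k ≤? M)
      where
      M≤N₀ : suc u * M ≤ u * N₀
      M≤N₀ = subst (λ t → suc t * M ≤ t * N₀) (sym u≡) (≤-trans (≤-reflexive (cong (_* M) (sym (+-suc (8 * v) 1))))
        (≤-trans (sparse-arith v κ n τ M 1≤κ n≤3κ+2 546v≤κ M≤ (density-arith v n e b τ 1≤n n≤ev+v 6vb≤n τ≤ dens))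
          (*-monoʳ-≤ (8 * v + 1) k³≤∣transversal∣)))
      4[1+u]≤Q : 4 * suc u ≤ Q
      4[1+u]≤Q = ≤-trans (≤-trans (m≤n+m (4 * suc u) (1 + r)) (m≤m+n (1 + r + 4 * suc u) _)) (≤-reflexive (sym Q≡))
      big : ℕ
      big = suc (2 * u) * (4 * (L * suc (2 * u)))
      big≤Q : suc big ≤ Q
      big≤Q = ≤-trans (s≤s (m≤n+m big (3 * q + 4 * suc u))) (≤-reflexive (sym Q≡))
      by-cases : Dec (k ≤ M) → 2 ^ s * 2 ^ (n * n) * ((N C s) * (M C k)) ≤ N₀ C m
      -- Without enough triples in T the count is zero. In the other case `k ≤ M` keeps `N₀ - m`
      -- proportional to `N₀`.
      by-cases (no k≰M) = vanish (2 ^ s * 2 ^ (n * n)) (N C s) (k>n⇒nCk≡0 (≰⇒> k≰M))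
      by-cases (yes k≤M) = subst (λ t → 2 ^ s * 2 ^ (n * n) * ((N C s) * (M C k)) ≤ N₀ C t) k+s≡m
        (count-sparse u L (n * n) s k n²≤s
          -- The summand 1 of `Q` accounts for `m = k + s`, leaving `big * s ≤ k`.
          (+-cancelˡ-≤ s _ _ (≤-trans (times-s big≤Q) (≤-reflexive (trans (sym k+s≡m) (+-comm k s)))))
          M≤N₀
          (≤-trans N≤125N₀ (≤-trans (*-monoʳ-≤ 125 (gap-sparse u N₀ M k s M≤N₀ k≤M (≤-trans (times-s 4[1+u]≤Q) (≤-reflexive (sym k+s≡m)))))
            (≤-reflexive (trans (sym (*-assoc 125 (2 * suc u) (N₀ ∸ (k + s)))) (cong (_* (N₀ ∸ (k + s))) (sym L≡)))))))

    dense-bound : ∀ B → B ≤ 3 * (n * (n * (9 * b + 2 * e))) → 2 ^ s * 2 ^ (n * n) * ((N C s) * ((B C j) * (N C k′))) ≤ N₀ C m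
    dense-bound B B≤ = by-cases (j ≤? B)
      where
      2ΛB≤N₀ : 2 * (Λ * B) ≤ N₀
      2ΛB≤N₀ = dense-arith Λ v n b e B N₀ v≡ 6vb≤n (m/n*n≤m n v)
        (≤-trans (n³≤125κ³ κ n 1≤κ n≤3κ+2) (*-monoʳ-≤ 125 k³≤∣transversal∣)) B≤
      r≤Λ : r ≤ Λ
      -- The base is `16 * 250 = 2 + 3998`.
      r≤Λ = ≤-trans (n≤[2+a]^n 3998 r) (≤-reflexive (sym Λ≡))
      by-cases : Dec (j ≤ B) → 2 ^ s * 2 ^ (n * n) * ((N C s) * ((B C j) * (N C k′))) ≤ N₀ C m
      by-cases (no j≰B) = vanish (2 ^ s * 2 ^ (n * n)) (N C s) (cong (_* (N C k′)) (k>n⇒nCk≡0 (≰⇒> j≰B)))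
      by-cases (yes j≤B) = subst (λ t → 2 ^ s * 2 ^ (n * n) * ((N C s) * ((B C j) * (N C k′))) ≤ N₀ C t) k′+j+s≡m
        (count-dense 250 r (n * n) s j k′ n²≤s (subst (_≤ r * j) (sym k′+j+s≡m) m≤rj)
          (subst₂ (λ x y → x * B ≤ N₀ ∸ y) Λ≡ (sym k′+j+s≡m) ΛB≤)
          (subst (λ y → N ≤ 250 * (N₀ ∸ y)) (sym k′+j+s≡m) N≤))
        where
        -- Having `j` exceptional triples to choose from forces `m` to be small: `m ≤ Λ B ≤ N₀/2`,
        -- so at least half of `N₀` is left and `250 = 125 * 2` is a valid L.
        m≤ΛB : m ≤ Λ * B
        m≤ΛB = ≤-trans m≤rj (*-mono-≤ r≤Λ j≤B)
        ΛB≤ : Λ * B ≤ N₀ ∸ m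
        ΛB≤ = m+n≤o⇒m≤o∸n (Λ * B) (≤-trans (+-monoʳ-≤ (Λ * B) m≤ΛB) (≤-trans (≤-reflexive (cong (Λ * B +_) (sym (+-identityʳ (Λ * B))))) 2ΛB≤N₀))
        N₀≤ : N₀ ≤ 2 * (N₀ ∸ m)
        N₀≤ = ≤-trans (m≤n+m∸n N₀ m) (≤-trans (+-monoˡ-≤ (N₀ ∸ m) (≤-trans m≤ΛB ΛB≤)) (≤-reflexive (cong (N₀ ∸ m +_) (sym (+-identityʳ (N₀ ∸ m))))))
        N≤ : N ≤ 250 * (N₀ ∸ m)
        N≤ = ≤-trans N≤125N₀ (≤-trans (*-monoʳ-≤ 125 N₀≤) (≤-reflexive (sym (*-assoc 125 2 (N₀ ∸ m)))))

    -- `n ≤ s ≤ 2^s` weakens the surplus factor to `n`, so that `n ≥ 1/η` will suffice.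
    few-bad : ∀ (bad all : List (Hypergraph n)) → Unique bad →
      (∀ {H} → H ∈ₗ bad → TFm n m H × (∀ part → m < q * ∣ edgeSet H ─ restrict (rainbow part) ∣)) →
      (∀ H → TFm n m H → H ∈ₗ all) → n * length bad ≤ length all
    few-bad bad all unique bad⇒ complete = ≤-trans (*-monoˡ-≤ (length bad) (≤-trans n≤s (n≤[2+a]^n 0 s)))
      (≤-trans (bad-bound b (6 * v) e m s j (N₀ C m) 2≤6v n<6v[b+1] ≤-refl s≤m sparse-bound dense-bound bad unique
        (λ H∈ → let (free , size) , away = bad⇒ H∈ in free , size , λ part → far (away part)))
        (all-bound κ 3κ≤n m all complete))

    module _ {δ : ℚ} (scale : ∀ x y → q * x ≤ y → ℕ→ℚ x ℚ.≤ δ ℚ.* ℕ→ℚ y) where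

      n*bad≤all : ∀ {bad all} → HasCount (BadTFm n m δ) bad → HasCount (TFm n m) all → n * bad ≤ all
      n*bad≤all (Bs , unique , bad⇔ , refl) (As , _ , all⇔ , refl) = few-bad Bs As unique
        (λ {H} H∈ → let tfm , ¬tri = Equivalence.to (bad⇔ H) H∈ in tfm , far-from-tripartite {n} {δ} {q} scale H ¬tri)
        (λ H → Equivalence.from (all⇔ H))

  Conclusion : ℚ → Set
  Conclusion δ = Σ ℚ λ K → (η : ℚ) → Positive η →
    Σ ℕ λ n₀ → (n : ℕ) → n₀ ≤ n → (m : ℕ) →
    K ℚ.* ℕ→ℚ (n ^ 2) ℚ.≤ ℕ→ℚ m → m ≤ n C 3 →
    (bad all : ℕ) → HasCount (BadTFm n m δ) bad → HasCount (TFm n m) all →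
    ℕ→ℚ bad ℚ.≤ η ℚ.* ℕ→ℚ all

  conclusion : ∀ {δ} → (∀ x y → q * x ≤ y → ℕ→ℚ x ℚ.≤ δ ℚ.* ℕ→ℚ y) → Conclusion δ
  -- Since `s = 36 v n²`, this constant says exactly `Q * s ≤ m`.
  conclusion {δ} scale = ℕ→ℚ (Q * (36 * v)) , λ η η>0 →
    let q′ , _ , scale′ = scaled-≤ η η>0 in
    -- The first summand makes `κ` large enough for the lower-order terms; the second gives
    -- `n ≥ q′ ≥ 1/η`.
    3 * (546 * v + 1) + q′ , λ n n₀≤n m K≤ _ bad all hasBad hasAll →
      scale′ bad all (≤-trans (*-monoˡ-≤ bad (≤-trans (m≤n+m q′ (3 * (546 * v + 1))) n₀≤n))
        (n*bad≤all {n} {m} (≤-trans (m≤m+n (3 * (546 * v + 1)) q′) n₀≤n) (large n m K≤) {δ} scale hasBad hasAll))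
    where
    large : ∀ n m → ℕ→ℚ (Q * (36 * v)) ℚ.* ℕ→ℚ (n ^ 2) ℚ.≤ ℕ→ℚ m → Q * (6 * (n * (n * (6 * v)))) ≤ m
    large n m K≤ = ≤-trans (≤-reflexive (trans (eq Q v n) (cong (λ t → Q * (36 * v) * (n * t)) (sym (*-identityʳ n)))))
      (ℕ→ℚ-product-cancel (Q * (36 * v)) (n ^ 2) m K≤)
      where
      eq : ∀ Q v n → Q * (6 * (n * (n * (6 * v)))) ≡ Q * (36 * v) * (n * n)
      eq = solve-∀

theorem8p2 : (δ : ℚ) → Positive δ →
    Σ ℚ λ K → (η : ℚ) → Positive η →
    Σ ℕ λ n₀ → (n : ℕ) → n₀ ≤ n → (m : ℕ) →
    K ℚ.* ℕ→ℚ (n ^ 2) ℚ.≤ ℕ→ℚ m → m ≤ n C 3 →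
    (bad all : ℕ) → HasCount (BadTFm n m δ) bad → HasCount (TFm n m) all →
    ℕ→ℚ bad ℚ.≤ η ℚ.* ℕ→ℚ all
theorem8p2 δ δ>0 = let q , nz-q , scale = scaled-≤ δ δ>0 in choose-parameters q nz-q scale
  where
  choose-parameters : ∀ q → NonZero q → (∀ x y → q * x ≤ y → ℕ→ℚ x ℚ.≤ δ ℚ.* ℕ→ℚ y) → _
  choose-parameters q nz-q scale = Parameters.conclusion q Λ v u L _ {{nz-q}} {{nz-v}} {{nz-L}} refl refl refl refl refl {δ} scale
    where
    Λ v u L : ℕ
    -- This is `(16 L)^q` of `count-dense` with `L = 250` and with `3 * q` bounding `m / j`.
    Λ = (16 * 250) ^ (3 * q)
    v = 10000 * Λ
    u = 8 * v + 1
    -- 125 compares all triples with `N₀`, and `2 (u + 1)` compares `N₀` with `N₀ - m`.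
    L = 125 * (2 * suc u)
    nz-v : NonZero v
    nz-v = m*n≢0 10000 Λ {{_}} {{m^n≢0 (16 * 250) (3 * q)}}
    nz-L : NonZero L
    nz-L = m*n≢0 125 (2 * suc u)
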